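{- Let ${\bf v} \in \mathbb{R}^{|\mathcal{T}_3|}$ with ${\bf v}(T_3) = 1$ and ${\bf v}(C_3) = 0$. Then $\nu_{\bf v} \ge \frac{85}{98}$. In particular, for all $n \equiv 1,3 \pmod 6$, every tournament on $n$ vertices has a triangle decomposition where the number of copies of $C_3$ in the decomposition is at most $\frac{13}{98\cdot 6} n^2(1+o_n(1))$.
   Context: $\mathcal{T}_3 = \{T_3, C_3\}$ where $T_3$ is the transitive tournament on 3 vertices and $C_3$ is the directed (cyclic) triangle. A triangle decomposition ($3$-decomposition) $L$ of a tournament $G$ on $n$ vertices is a set of 3-vertex subtournaments such that every pair of vertices lies in exactly one of them; $\nu_{\bf v}(L)$ is the fraction of elements of $L$ that are copies of $T_3$ (for this ${\bf v}$); $\nu_{\bf v}(G) = \max_L \nu_{\bf v}(L)$; $\nu_{\bf v}(n)$ is the minimum of $\nu_{\bf v}(G)$ over $n$-vertex tournaments when $n \equiv 1,3 \pmod 6$, and otherwise $\nu_{\bf v}(m)$ for the largest $m \le n$ with $m \equiv 1,3 \pmod 6$; $\nu_{\bf v} = \lim_{n\to\infty}\nu_{\bf v}(n)$. -}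

module Defs where

open import Data.Nat using (ℕ; zero; suc; _+_; _*_; _≤_)
open import Data.Fin using (Fin; _≟_)
open import Data.Bool using (Bool; true; false; _∧_; _∨_; not; T)
open import Data.List using (List; length; filter; map; foldr)
open import Data.List.Relation.Unary.All using (All)
open import Data.Product using (_×_; Σ; ∃; _,_)
open import Relation.Nullary using (¬_)
open import Relation.Nullary.Decidable using (⌊_⌋)
open import Relation.Binary.PropositionalEquality using (_≡_; _≢_)

record Tournament (n : ℕ) : Set where
  field
    beats      : Fin n → Fin n → Bool
    irrefl     : ∀ i → beats i i ≡ false
    antisym    : ∀ i j → i ≢ j → beats i j ≡ not (beats j i)
open Tournament public

record Triple (n : ℕ) : Set where
  constructor triple
  field
    a b c : Fin n
open Triple public

_==_ : ∀ {n} → Fin n → Fin n → Bool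
i == j = ⌊ i ≟ j ⌋

distinct3 : ∀ {n} → Triple n → Set
distinct3 t = (a t ≢ b t) × (a t ≢ c t) × (b t ≢ c t)

inTriple : ∀ {n} → Fin n → Triple n → Bool
inTriple i t = (i == a t) ∨ (i == b t) ∨ (i == c t)

coversPair : ∀ {n} → Fin n → Fin n → Triple n → Bool
coversPair i j t = inTriple i t ∧ inTriple j t

count : ∀ {A : Set} → (A → Bool) → List A → ℕ
count p xs = foldr (λ x r → if p x then suc r else r) 0 xs
  where
  if_then_else_ : Bool → ℕ → ℕ → ℕ
  if true then x else y = x
  if false then x else y = y

isCyclic : ∀ {n} → Tournament n → Triple n → Bool
isCyclic G t =
  (beats G (a t) (b t) ∧ beats G (b t) (c t) ∧ beats G (c t) (a t)) ∨
  (beats G (a t) (c t) ∧ beats G (c t) (b t) ∧ beats G (b t) (a t))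

-- The subtournament induced on t is the transitive triangle T₃
-- (every 3-vertex tournament is either C₃ or T₃).
isTransitive : ∀ {n} → Tournament n → Triple n → Bool
isTransitive G t = not (isCyclic G t)

-- A triangle decomposition: a list of 3-vertex subsets such that every
-- pair of distinct vertices lies in exactly one of them.
-- (The tournament structure on each triple is the induced one, so the
-- decomposition only depends on the vertex sets.)
IsTriangleDecomposition : ∀ {n} → List (Triple n) → Set
IsTriangleDecomposition {n} L =
  All distinct3 L × (∀ (i j : Fin n) → i ≢ j → count (coversPair i j) L ≡ 1)

numT3 : ∀ {n} → Tournament n → List (Triple n) → ℕ
numT3 G L = count (isTransitive G) L

-- ν_v(L) ≥ 85/98 − 1/(k+1), cleared of denominators:
--   numT3/|L| ≥ 85/98 − 1/(k+1)
--   ⇔ 85 (k+1) |L| ≤ 98 (k+1) numT3 + 98 |L|.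
FractionT3AtLeast : ∀ {n} → Tournament n → List (Triple n) → ℕ → Set
FractionT3AtLeast G L k =
  85 * suc k * length L ≤ 98 * suc k * numT3 G L + 98 * length L

{-# OPTIONS --safe #-}
module Submission where

-- In a tournament on seven vertices let f be the least number of cyclic lines of a
-- Fano plane. There is a form Q, a positive semidefinite quadratic form in the
-- types of the triples seen from a vertex, such that 1811 f + Q ≤ 1613 for all
-- tournaments on seven vertices; up to isomorphism this is a finite check. For a
-- random embedding of seven points into a large tournament the expectation of Q is a
-- sum of squares up to an error o(1), so a random copy has E f ≤ 1613/1811 + o(1).
-- Hence a design with almost all pairs in blocks of size seven can be relabelled such
-- that, with the best Fano plane in every block, a proportion of at most
-- 1613/(7·1811) + o(1) < 13/98 of its triples is cyclic.
--
-- Such a design exists on n = 6 x + e points for e = 1, 3 and large x. Write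
-- x = 400 m + t with m ≡ 1 modulo 400! and t bounded. The points are t sextuples at
-- infinity, e further points, and one point for each element of ℤ/m and each of the
-- 2400 nonzero vectors of F₇⁴; the latter fall into 400 directions ρ. As differences of
-- the ρ are units modulo m, the graphs of ρ ↦ a ρ + b are the blocks of a transversal
-- design. For most slopes a, such a graph carries the affine lines of F₇⁴ off the
-- origin, which are the blocks of size seven. The remaining t slopes absorb the
-- sextuples at infinity by Bose's construction with doubled points, and the systems of
-- Bose and Skolem fill the groups.

-- In a random tournament a quarter of all triples are cyclic, nearly twice 13/98, so a fixed triple
-- system with random labels is not enough; the gain comes from the choice among the thirty Fano
-- planes on each block after the relabelling. The form Q is a sum of squares only when the two
-- triples at a vertex range independently, coincidences included, so the seven-tuples with a
-- repeated point have to be counted. What is needed is E f < 13/14, and 1613/1811 is about 0.891.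
-- This gap pays for the repetitions and for all pairs outside blocks of size seven, which are
-- counted as if their triples were cyclic; hence 85/98 is reached without error term, from a
-- threshold independent of `k`. The gap also fixes the dimension: lines through the origin are not
-- blocks, which loses about 6/(7^d - 1) of the pairs in dimension d, while about 0.6 percent can be
-- afforded. So d = 3 fails and d = 4 suffices; moreover the 400 directions of F₇⁴ become an odd
-- number with one group at infinity, as Bose's construction requires.

-- Finite sums over enumerated types

module Sums where

  open import Data.Bool using (Bool; true; false; _∧_; not)
  open import Data.Empty using (⊥-elim)
  open import Data.Fin using (Fin; zero; suc)
  import Data.Fin.Properties as Finₚ
  open import Data.Integer using (ℤ; +_; _+_; _*_; -_; _-_; _≤_; +≤+)
  import Data.Integer.Properties as ℤₚ
  open import Data.Integer.Tactic.RingSolver using (solve-∀)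
  open import Data.List using (List; []; _∷_; _++_; map; length; concatMap)
  open import Data.Nat as ℕ using (ℕ; zero; suc)
  open import Data.Product using (_×_; _,_)
  open import Data.Sum using (_⊎_; inj₁; inj₂)
  import Data.Sum.Properties as Sumₚ
  open import Function using (_∘_)
  open import Relation.Nullary using (yes; no; does)
  open import Relation.Nullary.Decidable using (map′; _×-dec_)
  open import Relation.Binary using (DecidableEquality)
  open import Relation.Binary.PropositionalEquality hiding ([_])

  private variable
    A B C : Set

  ∑ : List A → (A → ℤ) → ℤ
  ∑ []       f = + 0
  ∑ (x ∷ xs) f = f x + ∑ xs f

  +ˡ : ∀ a {b c} → b ≡ c → a + b ≡ a + c
  +ˡ a = cong (λ z → a + z)

  𝟙 : Bool → ℤ
  𝟙 true  = + 1
  𝟙 false = + 0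

  ∑-cong : ∀ (xs : List A) {f g : A → ℤ} → (∀ x → f x ≡ g x) → ∑ xs f ≡ ∑ xs g
  ∑-cong []       e = refl
  ∑-cong (x ∷ xs) e = cong₂ _+_ (e x) (∑-cong xs e)

  ∑-mono : ∀ (xs : List A) {f g : A → ℤ} → (∀ x → f x ≤ g x) → ∑ xs f ≤ ∑ xs g
  ∑-mono []       e = ℤₚ.≤-refl
  ∑-mono (x ∷ xs) e = ℤₚ.+-mono-≤ (e x) (∑-mono xs e)

  ∑-zero : ∀ (xs : List A) → ∑ xs (λ _ → + 0) ≡ + 0
  ∑-zero []       = refl
  ∑-zero (x ∷ xs) = trans (ℤₚ.+-identityˡ _) (∑-zero xs)

  ∑-+ : ∀ (xs : List A) (f g : A → ℤ) → ∑ xs (λ x → f x + g x) ≡ ∑ xs f + ∑ xs g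
  ∑-+ []       f g = refl
  ∑-+ (x ∷ xs) f g = trans (+ˡ (f x + g x) (∑-+ xs f g)) (interchange (f x) (g x) (∑ xs f) (∑ xs g))
    where
    interchange : ∀ a b c d → (a + b) + (c + d) ≡ (a + c) + (b + d)
    interchange = solve-∀

  ∑-*ˡ : ∀ (xs : List A) c (f : A → ℤ) → ∑ xs (λ x → c * f x) ≡ c * ∑ xs f
  ∑-*ˡ []       c f = sym (ℤₚ.*-zeroʳ c)
  ∑-*ˡ (x ∷ xs) c f = trans (+ˡ (c * f x) (∑-*ˡ xs c f)) (sym (ℤₚ.*-distribˡ-+ c (f x) (∑ xs f)))

  ∑-*ʳ : ∀ (xs : List A) c (f : A → ℤ) → ∑ xs (λ x → f x * c) ≡ ∑ xs f * c
  ∑-*ʳ xs c f = trans (∑-cong xs λ x → ℤₚ.*-comm (f x) c) (trans (∑-*ˡ xs c f) (ℤₚ.*-comm c _))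

  ∑-neg : ∀ (xs : List A) (f : A → ℤ) → ∑ xs (λ x → - f x) ≡ - ∑ xs f
  ∑-neg []       f = refl
  ∑-neg (x ∷ xs) f = trans (+ˡ (- f x) (∑-neg xs f)) (sym (ℤₚ.neg-distrib-+ (f x) _))

  ∑-- : ∀ (xs : List A) (f g : A → ℤ) → ∑ xs (λ x → f x - g x) ≡ ∑ xs f - ∑ xs g
  ∑-- xs f g = trans (∑-+ xs f (-_ ∘ g)) (+ˡ (∑ xs f) (∑-neg xs g))

  ∑-swap : ∀ (xs : List A) (ys : List B) (f : A → B → ℤ) →
    ∑ xs (λ x → ∑ ys (f x)) ≡ ∑ ys (λ y → ∑ xs (λ x → f x y))
  ∑-swap []       ys f = sym (∑-zero ys)
  ∑-swap (x ∷ xs) ys f = trans (+ˡ (∑ ys (f x)) (∑-swap xs ys f)) (sym (∑-+ ys (f x) _))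

  ∑-++ : ∀ (xs ys : List A) (f : A → ℤ) → ∑ (xs ++ ys) f ≡ ∑ xs f + ∑ ys f
  ∑-++ []       ys f = sym (ℤₚ.+-identityˡ _)
  ∑-++ (x ∷ xs) ys f = trans (+ˡ (f x) (∑-++ xs ys f)) (sym (ℤₚ.+-assoc (f x) _ _))

  ∑-map : ∀ (xs : List A) (g : A → B) (f : B → ℤ) → ∑ (map g xs) f ≡ ∑ xs (f ∘ g)
  ∑-map []       g f = refl
  ∑-map (x ∷ xs) g f = +ˡ (f (g x)) (∑-map xs g f)

  ∑-const : ∀ (xs : List A) c → ∑ xs (λ _ → c) ≡ + length xs * c
  ∑-const []       c = sym (ℤₚ.*-zeroˡ c)
  ∑-const (x ∷ xs) c = trans (+ˡ c (∑-const xs c)) (expand c (+ length xs))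
    where
    expand : ∀ c l → c + l * c ≡ (+ 1 + l) * c
    expand = solve-∀

  pairsWith : List A → (A → List B) → List (A × B)
  pairsWith []       g = []
  pairsWith (x ∷ xs) g = map (x ,_) (g x) ++ pairsWith xs g

  ∑-pairsWith : ∀ (xs : List A) (g : A → List B) (f : A × B → ℤ) →
    ∑ (pairsWith xs g) f ≡ ∑ xs (λ x → ∑ (g x) (λ y → f (x , y)))
  ∑-pairsWith []       g f = refl
  ∑-pairsWith (x ∷ xs) g f = trans (∑-++ (map (x ,_) (g x)) _ f)
    (cong₂ _+_ (∑-map (g x) (x ,_) f) (∑-pairsWith xs g f))

  ∑-concatMap : ∀ (xs : List A) (g : A → List B) (f : B → ℤ) → ∑ (concatMap g xs) f ≡ ∑ xs λ x → ∑ (g x) f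
  ∑-concatMap []       g f = refl
  ∑-concatMap (x ∷ xs) g f = trans (∑-++ (g x) (concatMap g xs) f) (+ˡ (∑ (g x) f) (∑-concatMap xs g f))

  𝟙-∧ : ∀ a b → 𝟙 (a ∧ b) ≡ 𝟙 a * 𝟙 b
  𝟙-∧ true  true  = refl
  𝟙-∧ true  false = refl
  𝟙-∧ false b     = refl

  𝟙-not : ∀ a → 𝟙 (not a) ≡ + 1 - 𝟙 a
  𝟙-not true  = refl
  𝟙-not false = refl

  𝟙≥0 : ∀ b → + 0 ≤ 𝟙 b
  𝟙≥0 true  = +≤+ ℕ.z≤n
  𝟙≥0 false = +≤+ ℕ.z≤n

  𝟙≤1 : ∀ b → 𝟙 b ≤ + 1
  𝟙≤1 true  = +≤+ (ℕ.s≤s ℕ.z≤n)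
  𝟙≤1 false = +≤+ ℕ.z≤n

  -- `once` packs membership and absence of repetitions into one equation, so that a sum over `list`
  -- behaves as the sum over the type.
  record Enum (A : Set) : Set where
    field
      list : List A
      _≟_  : DecidableEquality A
      once : ∀ a → ∑ list (λ x → 𝟙 (does (x ≟ a))) ≡ + 1

    pick : ∀ (f : A → ℤ) a → ∑ list (λ x → 𝟙 (does (x ≟ a)) * f x) ≡ f a
    pick f a = trans (∑-cong list at-a)
      (trans (∑-*ʳ list (f a) _) (trans (cong (_* f a) (once a)) (ℤₚ.*-identityˡ (f a))))
      where
      at-a : ∀ x → 𝟙 (does (x ≟ a)) * f x ≡ 𝟙 (does (x ≟ a)) * f a
      at-a x with x ≟ a
      ... | yes refl = refl
      ... | no _     = refl

  open Enum

  -- Double counting over the graph of the bijection: the indicator of b = φ a is inserted by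
  -- `pick`, the sums are exchanged, and the same indicator, now read as a = ψ b, is removed. `p`
  -- and `r` cut out the subsets on which `φ` and `ψ` are mutually inverse.
  ∑-reindex : (EA : Enum A) (EB : Enum B) (p : A → Bool) (r : B → Bool) (φ : A → B) (ψ : B → A) →
    (∀ a → p a ≡ true → r (φ a) ≡ true) → (∀ a → p a ≡ true → ψ (φ a) ≡ a) →
    (∀ b → r b ≡ true → p (ψ b) ≡ true) → (∀ b → r b ≡ true → φ (ψ b) ≡ b) →
    (f : B → ℤ) → ∑ (list EA) (λ a → 𝟙 (p a) * f (φ a)) ≡ ∑ (list EB) (λ b → 𝟙 (r b) * f b)
  ∑-reindex EA EB p r φ ψ pr ψφ rp φψ f = begin
    ∑ as (λ a → 𝟙 (p a) * f (φ a))
      ≡⟨ ∑-cong as (λ a → trans (cong (𝟙 (p a) *_) (sym (pick EB f (φ a)))) (sym (∑-*ˡ bs (𝟙 (p a)) _))) ⟩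
    ∑ as (λ a → ∑ bs λ b → 𝟙 (p a) * (𝟙 (does (_≟_ EB b (φ a))) * f b))
      ≡⟨ ∑-swap as bs _ ⟩
    ∑ bs (λ b → ∑ as λ a → 𝟙 (p a) * (𝟙 (does (_≟_ EB b (φ a))) * f b))
      ≡⟨ ∑-cong bs (λ b → ∑-cong as λ a → graph a b) ⟩
    ∑ bs (λ b → ∑ as λ a → 𝟙 (does (_≟_ EA a (ψ b))) * (𝟙 (r b) * f b))
      ≡⟨ ∑-cong bs (λ b → pick EA (λ _ → 𝟙 (r b) * f b) (ψ b)) ⟩
    ∑ bs (λ b → 𝟙 (r b) * f b) ∎
    where
    open ≡-Reasoning
    as = list EA
    bs = list EB
    graph : ∀ a b → 𝟙 (p a) * (𝟙 (does (_≟_ EB b (φ a))) * f b) ≡ 𝟙 (does (_≟_ EA a (ψ b))) * (𝟙 (r b) * f b)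
    graph a b with p a in pa | r b in rb | _≟_ EB b (φ a) | _≟_ EA a (ψ b)
    ... | true  | true  | yes _ | yes _ = refl
    ... | true  | true  | yes b≡ | no a≢ = ⊥-elim (a≢ (sym (trans (cong ψ b≡) (ψφ a pa))))
    ... | true  | true  | no b≢ | yes a≡ = ⊥-elim (b≢ (sym (trans (cong φ a≡) (φψ b rb))))
    ... | true  | true  | no _ | no _ = refl
    ... | true  | false | yes b≡ | _ with () ← trans (sym rb) (trans (cong r b≡) (pr a pa))
    ... | true  | false | no _ | yes _ = refl
    ... | true  | false | no _ | no _ = refl
    ... | false | true  | _ | yes a≡ with () ← trans (sym pa) (trans (cong p a≡) (rp b rb))
    ... | false | true  | _ | no _ = refl
    ... | false | false | _ | yes _ = refl
    ... | false | false | _ | no _ = refl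

  ∑-bij : (EA : Enum A) (EB : Enum B) (φ : A → B) (ψ : B → A) → (∀ a → ψ (φ a) ≡ a) → (∀ b → φ (ψ b) ≡ b) →
    (f : B → ℤ) → ∑ (list EA) (f ∘ φ) ≡ ∑ (list EB) f
  ∑-bij EA EB φ ψ ψφ φψ f = trans (sym (∑-cong (list EA) λ a → ℤₚ.*-identityˡ _))
    (trans (∑-reindex EA EB (λ _ → true) (λ _ → true) φ ψ (λ _ _ → refl) (λ a _ → ψφ a) (λ _ _ → refl) (λ b _ → φψ b) f)
      (∑-cong (list EB) λ b → ℤₚ.*-identityˡ _))

  fins : ∀ n → List (Fin n)
  fins zero    = []
  fins (suc n) = zero ∷ map suc (fins n)

  length-fins : ∀ n → length (fins n) ≡ n
  length-fins zero    = refl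
  length-fins (suc n) = cong suc (trans (Data.List.Properties.length-map suc (fins n)) (length-fins n))
    where import Data.List.Properties

  enumFin : ∀ n → Enum (Fin n)
  enumFin n = record { list = fins n ; _≟_ = Finₚ._≟_ ; once = once′ }
    where
    once′ : ∀ {n} (a : Fin n) → ∑ (fins n) (λ x → 𝟙 (does (x Finₚ.≟ a))) ≡ + 1
    once′ {suc n} zero    = trans (+ˡ (+ 1) (trans (∑-map (fins n) suc _) (∑-zero (fins n)))) refl
    once′ {suc n} (suc a) = trans (ℤₚ.+-identityˡ _) (trans (∑-map (fins n) suc _) (once′ a))

  enum× : Enum A → Enum B → Enum (A × B)
  enum× EA EB = record
    { list = pairsWith (list EA) (λ _ → list EB)
    ; _≟_  = λ (x , y) (a , b) → map′ (λ (p , q) → cong₂ _,_ p q) (λ { refl → refl , refl }) (_≟_ EA x a ×-dec _≟_ EB y b)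
    ; once = λ (a , b) → trans (∑-pairsWith (list EA) _ _)
        (trans (∑-cong (list EA) λ x → trans (∑-cong (list EB) λ y → 𝟙-∧ (does (_≟_ EA x a)) (does (_≟_ EB y b))) (trans (∑-*ˡ (list EB) (𝟙 (does (_≟_ EA x a))) _)
            (trans (cong (𝟙 (does (_≟_ EA x a)) *_) (once EB b)) (ℤₚ.*-identityʳ _)))) (once EA a))
    }

  enum⊎ : Enum A → Enum B → Enum (A ⊎ B)
  enum⊎ EA EB = record
    { list = map inj₁ (list EA) ++ map inj₂ (list EB)
    ; _≟_  = Sumₚ.≡-dec (_≟_ EA) (_≟_ EB)
    ; once = λ { (inj₁ a) → trans (parts (inj₁ a)) (trans (cong₂ _+_ (trans (∑-cong (list EA) λ x → l x a) (once EA a)) (∑-zero (list EB))) refl)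
               ; (inj₂ b) → trans (parts (inj₂ b)) (trans (cong₂ _+_ (∑-zero (list EA)) (trans (∑-cong (list EB) λ x → r x b) (once EB b))) refl) }
    }
    where
    dec = Sumₚ.≡-dec (_≟_ EA) (_≟_ EB)
    parts : ∀ c → ∑ (map inj₁ (list EA) ++ map inj₂ (list EB)) (λ x → 𝟙 (does (dec x c)))
       ≡ ∑ (list EA) (λ x → 𝟙 (does (dec (inj₁ x) c))) + ∑ (list EB) (λ x → 𝟙 (does (dec (inj₂ x) c)))
    parts c = trans (∑-++ (map inj₁ (list EA)) _ _) (cong₂ _+_ (∑-map (list EA) inj₁ _) (∑-map (list EB) inj₂ _))
    l : ∀ x a → 𝟙 (does (dec (inj₁ x) (inj₁ a))) ≡ 𝟙 (does (_≟_ EA x a))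
    l x a with _≟_ EA x a
    ... | yes refl = refl
    ... | no _ = refl
    r : ∀ x a → 𝟙 (does (dec (inj₂ x) (inj₂ a))) ≡ 𝟙 (does (_≟_ EB x a))
    r x a with _≟_ EB x a
    ... | yes refl = refl
    ... | no _ = refl

  ∑× : (EA : Enum A) (EB : Enum B) (f : A × B → ℤ) →
    ∑ (list (enum× EA EB)) f ≡ ∑ (list EA) λ a → ∑ (list EB) λ b → f (a , b)
  ∑× EA EB f = ∑-pairsWith (list EA) _ f

  ∑⊎ : (EA : Enum A) (EB : Enum B) (f : A ⊎ B → ℤ) →
    ∑ (list (enum⊎ EA EB)) f ≡ ∑ (list EA) (f ∘ inj₁) + ∑ (list EB) (f ∘ inj₂)
  ∑⊎ EA EB f = trans (∑-++ (map inj₁ (list EA)) _ f) (cong₂ _+_ (∑-map (list EA) inj₁ f) (∑-map (list EB) inj₂ f))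

-- Permutations and uniformly random tuples

module Permutations where

  open Sums
  open import Data.Bool using (Bool; true; false; _∧_; not)
  open import Data.Bool.Properties using (∧-zeroʳ)
  open import Data.Empty using (⊥-elim)
  open import Data.Fin using (Fin; zero; suc; punchIn; punchOut)
  open import Data.Fin.Properties using (_≟_; punchIn-punchOut; punchOut-punchIn; punchIn-injective; punchInᵢ≢i; punchOut-cong)
  open import Data.Integer using (ℤ; +_; _+_; _*_; -_; _-_; _≤_)
  import Data.Integer.Properties as ℤₚ
  open import Data.Integer.Tactic.RingSolver using (solve-∀)
  open import Data.List using (List; []; _∷_)
  open import Data.Nat as ℕ using (ℕ; zero; suc; _!)
  import Data.Nat.Properties as ℕₚ
  open import Data.Product using (_×_; _,_; ∃)
  open import Data.Unit using (⊤; tt)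
  open import Data.Vec using (Vec; []; _∷_; map; insertAt)
  open import Data.Vec.Properties using (map-∘; map-insertAt)
  open import Function using (_∘_)
  open import Relation.Nullary using (yes; no; does; contradiction)
  open import Relation.Nullary.Decidable using (dec-true; dec-false)
  open import Relation.Binary.PropositionalEquality hiding ([_])

  -- Lehmer codes: the first entry is the image of `zero`, the rest permutes the remaining points. A
  -- sum over codes is an iterated sum over these choices, which permits induction on n.
  Perm : ℕ → Set
  Perm zero    = ⊤
  Perm (suc n) = Fin (suc n) × Perm n

  to : ∀ {n} → Perm n → Fin n → Fin n
  to (i , π) zero    = i
  to (i , π) (suc x) = punchIn i (to π x)

  from : ∀ {n} → Perm n → Fin n → Fin n
  from {suc n} (i , π) y with i ≟ y
  ... | yes _  = zero
  ... | no i≢y = suc (from π (punchOut i≢y))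

  to-from : ∀ {n} (π : Perm n) y → to π (from π y) ≡ y
  to-from {suc n} (i , π) y with i ≟ y
  ... | yes i≡y = i≡y
  ... | no i≢y  = trans (cong (punchIn i) (to-from π (punchOut i≢y))) (punchIn-punchOut i≢y)

  from-to : ∀ {n} (π : Perm n) x → from π (to π x) ≡ x
  from-to {suc n} (i , π) zero with i ≟ i
  ... | yes _  = refl
  ... | no i≢i = ⊥-elim (i≢i refl)
  from-to {suc n} (i , π) (suc x) with i ≟ punchIn i (to π x)
  ... | yes i≡ = ⊥-elim (punchInᵢ≢i i (to π x) (sym i≡))
  ... | no i≢  = cong suc (trans (cong (from π) (trans (punchOut-cong i refl) (punchOut-punchIn i))) (from-to π x))

  perms : ∀ n → List (Perm n)
  perms zero    = tt ∷ []
  perms (suc n) = pairsWith (fins (suc n)) λ _ → perms n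

  ∑-perms : ∀ n (f : Perm (suc n) → ℤ) → ∑ (perms (suc n)) f ≡ ∑ (fins (suc n)) λ i → ∑ (perms n) λ π → f (i , π)
  ∑-perms n f = ∑-pairsWith (fins (suc n)) (λ _ → perms n) f

  ∑T : ∀ n k → (Vec (Fin n) k → ℤ) → ℤ
  ∑T n zero    h = h []
  ∑T n (suc k) h = ∑ (fins n) λ i → ∑T n k (h ∘ (i ∷_))

  ∑T-cong : ∀ n k {g h : Vec (Fin n) k → ℤ} → (∀ t → g t ≡ h t) → ∑T n k g ≡ ∑T n k h
  ∑T-cong n zero    e = e []
  ∑T-cong n (suc k) e = ∑-cong (fins n) λ i → ∑T-cong n k λ t → e (i ∷ t)

  ∑T-mono : ∀ n k {g h : Vec (Fin n) k → ℤ} → (∀ t → g t ≤ h t) → ∑T n k g ≤ ∑T n k h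
  ∑T-mono n zero    e = e []
  ∑T-mono n (suc k) e = ∑-mono (fins n) λ i → ∑T-mono n k λ t → e (i ∷ t)

  ∑T-*ˡ : ∀ n k c (h : Vec (Fin n) k → ℤ) → ∑T n k (λ t → c * h t) ≡ c * ∑T n k h
  ∑T-*ˡ n zero    c h = refl
  ∑T-*ˡ n (suc k) c h = trans (∑-cong (fins n) λ i → ∑T-*ˡ n k c (h ∘ (i ∷_))) (∑-*ˡ (fins n) c _)

  ∑T-- : ∀ n k (g h : Vec (Fin n) k → ℤ) → ∑T n k (λ t → g t - h t) ≡ ∑T n k g - ∑T n k h
  ∑T-- n zero    g h = refl
  ∑T-- n (suc k) g h = trans (∑-cong (fins n) λ i → ∑T-- n k (g ∘ (i ∷_)) (h ∘ (i ∷_))) (∑-- (fins n) _ _)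

  ∑T-swap : ∀ {A : Set} n k (xs : List A) (h : A → Vec (Fin n) k → ℤ) →
    ∑ xs (λ x → ∑T n k (h x)) ≡ ∑T n k (λ t → ∑ xs λ x → h x t)
  ∑T-swap n zero    xs h = refl
  ∑T-swap n (suc k) xs h = trans (∑-swap xs (fins n) _) (∑-cong (fins n) λ i → ∑T-swap n k xs λ x t → h x (i ∷ t))

  fresh : ∀ {n k} → Fin n → Vec (Fin n) k → Bool
  fresh i []      = true
  fresh i (x ∷ t) = not (does (i ≟ x)) ∧ fresh i t

  distinct : ∀ {n k} → Vec (Fin n) k → Bool
  distinct []      = true
  distinct (x ∷ t) = fresh x t ∧ distinct t

  ≟-does-comm : ∀ {n} (x y : Fin n) → does (x ≟ y) ≡ does (y ≟ x)
  ≟-does-comm x y with x ≟ y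
  ... | yes x≡y = sym (dec-true (y ≟ x) (sym x≡y))
  ... | no x≢y  = sym (dec-false (y ≟ x) (x≢y ∘ sym))

  does-≟-map : ∀ {m n} (f : Fin m → Fin n) → (∀ {x y} → f x ≡ f y → x ≡ y) → ∀ x y → does (f x ≟ f y) ≡ does (x ≟ y)
  does-≟-map f inj x y with x ≟ y
  ... | yes x≡y = dec-true (f x ≟ f y) (cong f x≡y)
  ... | no x≢y  = dec-false (f x ≟ f y) (x≢y ∘ inj)

  fresh-map : ∀ {m n k} (f : Fin m → Fin n) → (∀ {x y} → f x ≡ f y → x ≡ y) → ∀ i (t : Vec (Fin m) k) → fresh (f i) (map f t) ≡ fresh i t
  fresh-map f inj i []      = refl
  fresh-map f inj i (x ∷ t) = cong₂ (λ a b → not a ∧ b) (does-≟-map f inj i x) (fresh-map f inj i t)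

  distinct-map : ∀ {m n k} (f : Fin m → Fin n) → (∀ {x y} → f x ≡ f y → x ≡ y) → (t : Vec (Fin m) k) → distinct (map f t) ≡ distinct t
  distinct-map f inj []      = refl
  distinct-map f inj (x ∷ t) = cong₂ _∧_ (fresh-map f inj x t) (distinct-map f inj t)

  fresh-insertAt : ∀ {n k} x (t : Vec (Fin n) k) p i → fresh x (insertAt t p i) ≡ not (does (x ≟ i)) ∧ fresh x t
  fresh-insertAt x t       zero    i = refl
  fresh-insertAt x (y ∷ t) (suc p) i = trans (cong (not (does (x ≟ y)) ∧_) (fresh-insertAt x t p i))
    (swap (not (does (x ≟ y))) (not (does (x ≟ i))) (fresh x t))
    where
    swap : ∀ a b c → a ∧ (b ∧ c) ≡ b ∧ (a ∧ c)
    swap true  b c = refl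
    swap false b c = sym (∧-zeroʳ b)

  distinct-insertAt : ∀ {n k} (t : Vec (Fin n) k) p i → distinct (insertAt t p i) ≡ fresh i t ∧ distinct t
  distinct-insertAt t       zero    i = refl
  distinct-insertAt (x ∷ t) (suc p) i = trans (cong₂ _∧_ (fresh-insertAt x t p i) (distinct-insertAt t p i))
    (trans (cong (λ a → (not a ∧ fresh x t) ∧ (fresh i t ∧ distinct t)) (≟-does-comm x i)) (rearrange (not (does (i ≟ x))) (fresh x t) (fresh i t) (distinct t)))
    where
    rearrange : ∀ a b c d → (a ∧ b) ∧ (c ∧ d) ≡ (a ∧ c) ∧ (b ∧ d)
    rearrange true  true  c d = refl
    rearrange true  false c d = sym (∧-zeroʳ c)
    rearrange false b     c d = refl

  fresh-zero : ∀ {n k} (t : Vec (Fin n) k) → fresh zero (map suc t) ≡ true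
  fresh-zero []      = refl
  fresh-zero (x ∷ t) = fresh-zero t

  -- For such functions the sum over all tuples is the sum over tuples of distinct points, so `∑T`
  -- can serve for both.
  Vanishing : ∀ {n k} → (Vec (Fin n) k → ℤ) → Set
  Vanishing h = ∀ t → distinct t ≡ false → h t ≡ + 0

  ∑-punchIn : ∀ {n} i (f : Fin (suc n) → ℤ) → ∑ (fins n) (f ∘ punchIn i) ≡ ∑ (fins (suc n)) λ x → 𝟙 (not (does (i ≟ x))) * f x
  ∑-punchIn {n} zero f = sym (trans (ℤₚ.+-identityˡ _) (trans (∑-map (fins n) suc _) (∑-cong (fins n) λ x → ℤₚ.*-identityˡ (f (suc x)))))
  ∑-punchIn {suc n} (suc i) f = cong₂ _+_ (sym (ℤₚ.*-identityˡ (f zero)))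
    (trans (∑-map (fins n) suc _) (trans (∑-punchIn i (f ∘ suc)) (sym (∑-map (fins (suc n)) suc λ x → 𝟙 (not (does (suc i ≟ x))) * f x))))

  ∑T-punchIn : ∀ {n} k i (g : Vec (Fin (suc n)) k → ℤ) →
    ∑T n k (g ∘ map (punchIn i)) ≡ ∑T (suc n) k λ t → 𝟙 (fresh i t) * g t
  ∑T-punchIn zero i g = sym (ℤₚ.*-identityˡ (g []))
  ∑T-punchIn {n} (suc k) i g = begin
    ∑ (fins n) (λ y → ∑T n k λ t → g (punchIn i y ∷ map (punchIn i) t))
      ≡⟨ ∑-cong (fins n) (λ y → ∑T-punchIn k i (g ∘ (punchIn i y ∷_))) ⟩
    ∑ (fins n) (λ y → ∑T (suc n) k λ t → 𝟙 (fresh i t) * g (punchIn i y ∷ t))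
      ≡⟨ ∑-punchIn i (λ x → ∑T (suc n) k λ t → 𝟙 (fresh i t) * g (x ∷ t)) ⟩
    ∑ (fins (suc n)) (λ x → 𝟙 (not (does (i ≟ x))) * ∑T (suc n) k λ t → 𝟙 (fresh i t) * g (x ∷ t))
      ≡⟨ ∑-cong (fins (suc n)) (λ x → trans (sym (∑T-*ˡ (suc n) k (𝟙 (not (does (i ≟ x)))) _))
          (∑T-cong (suc n) k λ t → trans (sym (ℤₚ.*-assoc (𝟙 (not (does (i ≟ x)))) (𝟙 (fresh i t)) (g (x ∷ t)))) (cong (_* g (x ∷ t)) (sym (𝟙-∧ (not (does (i ≟ x))) (fresh i t)))))) ⟩
    ∑T (suc n) (suc k) (λ t → 𝟙 (fresh i t) * g t) ∎
    where open ≡-Reasoning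

  -- Subtraction is taken in ℤ, so no hypothesis k ≤ n is made; as the left side is nonnegative, the
  -- equation even forces k ≤ n, which `room` exploits.
  ∑-fresh : ∀ {n k} (t : Vec (Fin n) k) → distinct t ≡ true → ∑ (fins n) (λ i → 𝟙 (fresh i t)) ≡ + n - + k
  ∑-fresh {n} [] _ = trans (∑-const (fins n) (+ 1)) (trans (ℤₚ.*-identityʳ _) (trans (cong +_ (length-fins n)) (sym (ℤₚ.+-identityʳ (+ n)))))
  ∑-fresh {n} {suc k} (x ∷ t) d with fresh x t in f
  ... | true = begin
    ∑ (fins n) (λ i → 𝟙 (not (does (i ≟ x)) ∧ fresh i t))
      ≡⟨ ∑-cong (fins n) (λ i → minus (does (i ≟ x)) (fresh i t)) ⟩
    ∑ (fins n) (λ i → 𝟙 (fresh i t) - 𝟙 (does (i ≟ x)) * 𝟙 (fresh i t))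
      ≡⟨ ∑-- (fins n) (λ i → 𝟙 (fresh i t)) _ ⟩
    ∑ (fins n) (λ i → 𝟙 (fresh i t)) - ∑ (fins n) (λ i → 𝟙 (does (i ≟ x)) * 𝟙 (fresh i t))
      ≡⟨ cong₂ _-_ (∑-fresh t d) (trans (Enum.pick (enumFin n) (λ i → 𝟙 (fresh i t)) x) (cong 𝟙 f)) ⟩
    (+ n - + k) - + 1
      ≡⟨ step (+ n) (+ k) ⟩
    + n - (+ 1 + + k) ∎
    where
    open ≡-Reasoning
    minus : ∀ a b → 𝟙 (not a ∧ b) ≡ 𝟙 b - 𝟙 a * 𝟙 b
    minus true  true  = refl
    minus true  false = refl
    minus false true  = refl
    minus false false = refl
    step : ∀ n k → (n - k) - + 1 ≡ n - (+ 1 + k)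
    step = solve-∀

  room : ∀ {n k} r (s : Vec (Fin n) k) → distinct s ≡ true → suc n ≡ k ℕ.+ r → (distinct s ≡ true) × ∃ λ r′ → r ≡ suc r′
  room (suc r) s d n≡ = d , r , refl
  room {n} {k} zero s d n≡ with refl ← trans n≡ (ℕₚ.+-identityʳ k) =
    contradiction (subst (+ 0 ≤_) (trans (∑-fresh s d) (minus-one (+ n)))
      (subst (λ z → z ≤ ∑ (fins n) (λ i → 𝟙 (fresh i s))) (∑-zero (fins n)) (∑-mono (fins n) λ i → 𝟙≥0 (fresh i s)))) (λ ())
    where
    minus-one : ∀ n → n - (+ 1 + n) ≡ - (+ 1)
    minus-one = solve-∀

  -- The image of `zero` is the first choice in a Lehmer code, so tuples are classified by whether,
  -- and at which place p, they contain `zero`.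
  data Preimage {n} : ∀ {k} → Vec (Fin (suc n)) k → Set where
    missed : ∀ {k} (s : Vec (Fin n) k) → Preimage (map suc s)
    hit    : ∀ {k} (s : Vec (Fin n) k) p → Preimage (insertAt (map suc s) p zero)

  preimage : ∀ {n k} (s : Vec (Fin (suc n)) k) → distinct s ≡ true → Preimage s
  preimage [] _ = missed []
  preimage (x ∷ s) d with fresh x s in f
  preimage (x ∷ s) d | true with preimage s d
  preimage (zero  ∷ .(map suc s)) d | true | missed s = hit s zero
  preimage (suc x ∷ .(map suc s)) d | true | missed s = missed (x ∷ s)
  preimage (zero  ∷ .(insertAt (map suc s) p zero)) d | true | hit s p with () ← trans (sym f) (fresh-insertAt zero (map suc s) p zero)
  preimage (suc x ∷ .(insertAt (map suc s) p zero)) d | true | hit s p = hit (x ∷ s) (suc p)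

  ∑T-insertAt : ∀ {n} k p (h : Vec (Fin n) (suc k) → ℤ) → ∑ (fins n) (λ i → ∑T n k λ t → h (insertAt t p i)) ≡ ∑T n (suc k) h
  ∑T-insertAt k zero h = refl
  ∑T-insertAt {n} (suc k) (suc p) h = trans (∑-swap (fins n) (fins n) _) (∑-cong (fins n) λ x → ∑T-insertAt k p (h ∘ (x ∷_)))

  -- Under a uniformly random permutation, a tuple of distinct points goes to a
  -- uniformly random tuple of distinct points.
  ∑-perms-uniform : ∀ n k r → n ≡ k ℕ.+ r → (s : Vec (Fin n) k) → distinct s ≡ true → (h : Vec (Fin n) k → ℤ) → Vanishing h →
    ∑ (perms n) (λ π → h (map (to π) s)) ≡ + (r !) * ∑T n k h
  ∑-perms-uniform zero zero zero _ [] _ h _ = trans (ℤₚ.+-identityʳ (h [])) (sym (ℤₚ.*-identityˡ (h [])))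
  ∑-perms-uniform (suc n) k r n≡ s d h van with preimage s d
  -- The tuple avoids `zero`, whose image i may be any point outside the image tuple; there are suc
  -- r of these, which turns r ! into (suc r) !.
  ∑-perms-uniform (suc n) k r n≡ .(map suc s) d h van | missed s with room r s (trans (sym (distinct-map suc (λ { refl → refl }) s)) d) n≡
  ... | d′ , r , refl = begin
    ∑ (perms (suc n)) (λ π → h (map (to π) (map suc s)))
      ≡⟨ ∑-perms n _ ⟩
    ∑ (fins (suc n)) (λ i → ∑ (perms n) λ π → h (map (to (i , π)) (map suc s)))
      ≡⟨ ∑-cong (fins (suc n)) (λ i → ∑-cong (perms n) λ π → cong h (trans (sym (map-∘ (to (i , π)) suc s)) (map-∘ (punchIn i) (to π) s))) ⟩
    ∑ (fins (suc n)) (λ i → ∑ (perms n) λ π → h (map (punchIn i) (map (to π) s)))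
      ≡⟨ ∑-cong (fins (suc n)) (λ i → ∑-perms-uniform n k r (ℕₚ.suc-injective (trans n≡ (ℕₚ.+-suc k r))) s d′ (h ∘ map (punchIn i))
           λ t dt → van _ (trans (distinct-map (punchIn i) (λ {x} {y} → punchIn-injective i x y) t) dt)) ⟩
    ∑ (fins (suc n)) (λ i → + (r !) * ∑T n k (h ∘ map (punchIn i)))
      ≡⟨ ∑-*ˡ (fins (suc n)) (+ (r !)) _ ⟩
    + (r !) * ∑ (fins (suc n)) (λ i → ∑T n k (h ∘ map (punchIn i)))
      ≡⟨ cong (+ (r !) *_) (trans (∑-cong (fins (suc n)) λ i → ∑T-punchIn k i h) (∑T-swap (suc n) k (fins (suc n)) _)) ⟩
    + (r !) * ∑T (suc n) k (λ t → ∑ (fins (suc n)) λ i → 𝟙 (fresh i t) * h t)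
      ≡⟨ cong (+ (r !) *_) (trans (∑T-cong (suc n) k count) (∑T-*ˡ (suc n) k (+ suc r) h)) ⟩
    + (r !) * (+ suc r * ∑T (suc n) k h)
      ≡⟨ trans (sym (ℤₚ.*-assoc (+ (r !)) (+ suc r) _)) (cong (_* ∑T (suc n) k h) (trans (sym (ℤₚ.pos-* (r !) (suc r))) (cong +_ (ℕₚ.*-comm (r !) (suc r))))) ⟩
    + (suc r !) * ∑T (suc n) k h ∎
    where
    open ≡-Reasoning
    count : ∀ t → ∑ (fins (suc n)) (λ i → 𝟙 (fresh i t) * h t) ≡ + suc r * h t
    count t with distinct t in dt
    ... | true  = trans (∑-*ʳ (fins (suc n)) (h t) λ i → 𝟙 (fresh i t)) (cong (_* h t) (trans (∑-fresh t dt)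
           (trans (cong (λ z → + z - + k) n≡) (remainder (+ k) (+ suc r)))))
      where
      remainder : ∀ k r → (k + r) - k ≡ r
      remainder = solve-∀
    ... | false = trans (∑-cong (fins (suc n)) λ i → cong (𝟙 (fresh i t) *_) (van t dt)) (trans (∑-cong (fins (suc n)) λ i → ℤₚ.*-zeroʳ (𝟙 (fresh i t)))
           (trans (∑-zero (fins (suc n))) (sym (trans (cong (+ suc r *_) (van t dt)) (ℤₚ.*-zeroʳ (+ suc r))))))
  -- Here the image i of `zero` is itself the entry at place p. That i differs from the other
  -- entries may be dropped as a condition, since h vanishes otherwise.
  ∑-perms-uniform (suc n) (suc k) r n≡ .(insertAt (map suc s) p zero) d h van | hit s p = begin
    ∑ (perms (suc n)) (λ π → h (map (to π) (insertAt (map suc s) p zero)))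
      ≡⟨ ∑-perms n _ ⟩
    ∑ (fins (suc n)) (λ i → ∑ (perms n) λ π → h (map (to (i , π)) (insertAt (map suc s) p zero)))
      ≡⟨ ∑-cong (fins (suc n)) (λ i → ∑-cong (perms n) λ π → cong h (trans (map-insertAt (to (i , π)) zero (map suc s) p)
           (cong (λ v → insertAt v p i) (trans (sym (map-∘ (to (i , π)) suc s)) (map-∘ (punchIn i) (to π) s))))) ⟩
    ∑ (fins (suc n)) (λ i → ∑ (perms n) λ π → h (insertAt (map (punchIn i) (map (to π) s)) p i))
      ≡⟨ ∑-cong (fins (suc n)) (λ i → ∑-perms-uniform n k r (ℕₚ.suc-injective n≡) s d′ (λ t → h (insertAt (map (punchIn i) t) p i))
           λ t dt → van _ (trans (distinct-insertAt _ p i) (trans (cong (fresh i (map (punchIn i) t) ∧_)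
               (trans (distinct-map (punchIn i) (λ {x} {y} → punchIn-injective i x y) t) dt)) (∧-zeroʳ _)))) ⟩
    ∑ (fins (suc n)) (λ i → + (r !) * ∑T n k (λ t → h (insertAt (map (punchIn i) t) p i)))
      ≡⟨ ∑-*ˡ (fins (suc n)) (+ (r !)) _ ⟩
    + (r !) * ∑ (fins (suc n)) (λ i → ∑T n k (λ t → h (insertAt (map (punchIn i) t) p i)))
      ≡⟨ cong (+ (r !) *_) (∑-cong (fins (suc n)) λ i → trans (∑T-punchIn k i (λ t → h (insertAt t p i))) (∑T-cong (suc n) k λ t → absorb i t)) ⟩
    + (r !) * ∑ (fins (suc n)) (λ i → ∑T (suc n) k (λ t → h (insertAt t p i)))
      ≡⟨ cong (+ (r !) *_) (∑T-insertAt k p h) ⟩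
    + (r !) * ∑T (suc n) (suc k) h ∎
    where
    open ≡-Reasoning
    d′ : distinct s ≡ true
    d′ = trans (sym (trans (distinct-insertAt (map suc s) p zero)
           (cong₂ _∧_ (fresh-zero s) (distinct-map suc (λ { refl → refl }) s)))) d
    absorb : ∀ i t → 𝟙 (fresh i t) * h (insertAt t p i) ≡ h (insertAt t p i)
    absorb i t with fresh i t in f
    ... | true  = ℤₚ.*-identityˡ _
    ... | false = sym (van _ (trans (distinct-insertAt t p i) (cong (_∧ distinct t) f)))

  length-perms : ∀ n → ∑ (perms n) (λ _ → + 1) ≡ + (n !)
  length-perms n = trans (∑-perms-uniform n 0 n refl [] refl (λ _ → + 1) (λ { [] () })) (ℤₚ.*-identityʳ _)

  -- If every term exceeded c, so would the sum, strictly because the list is not empty.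
  ∑-exists : ∀ {A : Set} (xs : List A) (f : A → ℤ) c → xs ≢ [] → ∑ xs f ≤ ∑ xs (λ _ → c) → ∃ λ x → f x ≤ c
  ∑-exists [] f c ne _ = ⊥-elim (ne refl)
  ∑-exists (x ∷ xs) f c _ le with f x ℤₚ.≤? c
  ... | yes fx≤c = x , fx≤c
  ∑-exists (x ∷ []) f c _ le | no fx≰c = ⊥-elim (fx≰c (subst₂ _≤_ (ℤₚ.+-identityʳ (f x)) (ℤₚ.+-identityʳ c) le))
  ∑-exists (x ∷ y ∷ xs) f c _ le | no fx≰c = ∑-exists (y ∷ xs) f c (λ ())
    (ℤₚ.≮⇒≥ λ lt → ℤₚ.<⇒≱ (ℤₚ.+-mono-< (ℤₚ.≰⇒> fx≰c) lt) le)

-- Kinds of triples and the quadratic form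

module Kernel where

  open Sums
  open import Data.Bool using (Bool; true; false; _∧_; _∨_)
  open import Data.Bool.Properties using (∧-comm; ∧-assoc; ∨-comm)
  open import Data.Fin using (Fin; suc)
  open import Data.Fin.Patterns
  open import Data.Integer using (ℤ; +_; _+_; _*_; -_; _-_)
  open import Data.List using ([]; _∷_)
  open import Data.Nat as ℕ using (ℕ; suc)
  import Data.Nat.Properties as ℕₚ
  open import Data.Product using (_×_; _,_)
  open import Data.Vec using (Vec; []; _∷_; lookup)
  open import Relation.Binary.PropositionalEquality hiding ([_])

  private variable
    V : Set

  cyc : (V → V → Bool) → V → V → V → Bool
  cyc b x y z = (b x y ∧ b y z ∧ b z x) ∨ (b x z ∧ b z y ∧ b y x)

  cyc-rotate : ∀ (b : V → V → Bool) x y z → cyc b x y z ≡ cyc b y z x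
  cyc-rotate b x y z = cong₂ _∨_ (rot (b x y) (b y z) (b z x)) (trans (rot (b x z) (b z y) (b y x)) (rot (b z y) (b y x) (b x z)))
    where
    rot : ∀ p q r → p ∧ q ∧ r ≡ q ∧ r ∧ p
    rot p q r = trans (∧-comm p (q ∧ r)) (∧-assoc q r p)

  cyc-swap : ∀ (b : V → V → Bool) x y z → cyc b x y z ≡ cyc b x z y
  cyc-swap b x y z = ∨-comm (b x y ∧ b y z ∧ b z x) (b x z ∧ b z y ∧ b y x)

  cyc-swap₁ : ∀ (b : V → V → Bool) x y z → cyc b x y z ≡ cyc b y x z
  cyc-swap₁ b x y z = trans (cyc-swap b x y z) (trans (cyc-rotate b x z y) (trans (cyc-rotate b z y x) refl))

  bit : Bool → ℕ
  bit true  = 1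
  bit false = 0

  -- The isomorphism type of a triple X seen from a vertex v, by the number of
  -- out-neighbours of v in X, the number of cyclic triangles of v with two points
  -- of X, and whether X itself is cyclic.
  kind : ℕ → ℕ → Bool → Fin 12
  kind 0 _ false = 0F
  kind 0 _ true  = 1F
  kind 1 0 false = 2F
  kind 1 1 false = 3F
  kind 1 _ false = 4F
  kind 1 _ true  = 5F
  kind 2 0 false = 6F
  kind 2 1 false = 7F
  kind 2 _ false = 8F
  kind 2 _ true  = 9F
  kind _ _ false = suc 9F
  kind _ _ true  = suc (suc 9F)

  -- Found by semidefinite programming; the form is the sum of the squares of the four
  -- weighted sums over the triples seen from a vertex.
  weights : Vec (Vec ℤ 12) 4
  weights =
    (- + 2 ∷ - + 10 ∷   + 3 ∷   + 5 ∷   + 13 ∷ - + 14 ∷   + 3 ∷   + 5 ∷ + 13 ∷ - + 14 ∷ - + 2 ∷ - + 10 ∷ []) ∷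
    (  + 0 ∷   + 11 ∷ - + 1 ∷   + 4 ∷ - + 12 ∷   +  7 ∷   + 1 ∷ - + 4 ∷ + 12 ∷ - +  7 ∷   + 0 ∷ - + 11 ∷ []) ∷
    (- + 6 ∷ - +  5 ∷ - + 2 ∷ - + 6 ∷ - +  6 ∷   +  1 ∷   + 2 ∷   + 6 ∷ +  6 ∷ - +  1 ∷   + 6 ∷   +  5 ∷ []) ∷
    (- + 4 ∷ - +  3 ∷ - + 2 ∷ - + 5 ∷   +  4 ∷   +  3 ∷ - + 2 ∷ - + 5 ∷ +  4 ∷   +  3 ∷ - + 4 ∷ - +  3 ∷ []) ∷ []

  -- Reversal of all arcs exchanges the kinds 0, 1 with 10, 11 and the kinds 2 to 5 with 6 to 9.
  -- Under it the first and fourth rows are even, the second and third odd.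
  weight : Fin 4 → Fin 12 → ℤ
  weight j f = lookup (lookup weights j) f

  opaque
    kernel : Fin 12 → Fin 12 → ℤ
    kernel f g = ∑ (fins 4) λ j → weight j f * weight j g

  -- The relation and its cyclic triples are separate arguments, so that tables can replace `b` and
  -- `cyc b` in the finite check.
  kindOf : (V → V → Bool) → (V → V → V → Bool) → V → V → V → V → Fin 12
  kindOf o c v x y z = kind (bit (o v x) ℕ.+ (bit (o v y) ℕ.+ bit (o v z))) (bit (c v x y) ℕ.+ (bit (c v x z) ℕ.+ bit (c v y z))) (c x y z)

  kindOf-swap₁ : ∀ (b : V → V → Bool) v x y z → kindOf b (cyc b) v x y z ≡ kindOf b (cyc b) v y x z
  kindOf-swap₁ b v x y z rewrite cyc-swap b v x y | cyc-swap₁ b x y z =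
    cong₂ (λ m n → kind m n (cyc b y x z)) (+-swap (bit (b v x)) (bit (b v y)) _)
      (cong (bit (cyc b v y x) ℕ.+_) (ℕₚ.+-comm (bit (cyc b v x z)) _))
    where
    +-swap : ∀ a b c → a ℕ.+ (b ℕ.+ c) ≡ b ℕ.+ (a ℕ.+ c)
    +-swap a b c = trans (sym (ℕₚ.+-assoc a b c)) (trans (cong (ℕ._+ c) (ℕₚ.+-comm a b)) (ℕₚ.+-assoc b a c))

  kindOf-swap₂ : ∀ (b : V → V → Bool) v x y z → kindOf b (cyc b) v x y z ≡ kindOf b (cyc b) v x z y
  kindOf-swap₂ b v x y z rewrite cyc-swap b v y z | cyc-swap b x y z =
    cong₂ (λ m n → kind m n (cyc b x z y)) (cong (bit (b v x) ℕ.+_) (ℕₚ.+-comm (bit (b v y)) _)) (+-swap (bit (cyc b v x y)) (bit (cyc b v x z)) _)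
    where
    +-swap : ∀ a b c → a ℕ.+ (b ℕ.+ c) ≡ b ℕ.+ (a ℕ.+ c)
    +-swap a b c = trans (sym (ℕₚ.+-assoc a b c)) (trans (cong (ℕ._+ c) (ℕₚ.+-comm a b)) (ℕₚ.+-assoc b a c))

  Star : Set → Set
  Star V = V × (V × V × V) × (V × V × V)

  opaque
    term : (V → V → Bool) → Star V → ℤ
    term b (v , (x , y , z) , (x′ , y′ , z′)) = kernel (kindOf b (cyc b) v x y z) (kindOf b (cyc b) v x′ y′ z′)

  star : ∀ {A : Set} → Vec A 7 → Star A
  star (v ∷ x ∷ y ∷ z ∷ x′ ∷ y′ ∷ z′ ∷ []) = v , (x , y , z) , (x′ , y′ , z′)

-- Steiner triple systems as quasigroups

module SteinerSystems where

  open import Data.Bool using (true)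
  open import Relation.Nullary using (Dec; yes; does)
  open import Relation.Binary.PropositionalEquality

  -- For x ≢ y the triple through x and y is {x, y, x ∙ y}.
  record Steiner (A : Set) : Set where
    infixl 7 _∙_
    field
      _∙_  : A → A → A
      idem : ∀ x → x ∙ x ≡ x
      comm : ∀ x y → x ∙ y ≡ y ∙ x
      cancel : ∀ x y → x ∙ (x ∙ y) ≡ y

  open Steiner public

  transport : ∀ {A B : Set} (φ : A → B) (ψ : B → A) → (∀ a → ψ (φ a) ≡ a) → (∀ b → φ (ψ b) ≡ b) → Steiner A → Steiner B
  transport φ ψ ψφ φψ s = record
    { _∙_    = λ x y → φ (_∙_ s (ψ x) (ψ y))
    ; idem   = λ x → trans (cong φ (idem s (ψ x))) (φψ x)
    ; comm   = λ x y → cong φ (comm s (ψ x) (ψ y))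
    ; cancel = λ x y → trans (cong φ (trans (cong (_∙_ s (ψ x)) (ψφ _)) (cancel s (ψ x) (ψ y)))) (φψ y)
    }

  fromDoes : ∀ {P : Set} (d : Dec P) → does d ≡ true → P
  fromDoes (yes p) _ = p

-- The seventy stars on seven points

module Stars where

  open Sums
  open Permutations
  open Kernel
  open SteinerSystems using (fromDoes)
  open import Data.Bool using (Bool; true; false; if_then_else_)
  open import Data.Fin using (Fin; zero; suc; toℕ)
  open import Data.Fin.Patterns
  import Data.Fin.Properties as Finₚ
  open import Data.Product.Properties using (≡-dec)
  open import Data.Integer using (ℤ; +_; _+_; _*_)
  import Data.Integer.Properties as ℤₚ
  open import Data.Integer.Tactic.RingSolver using (solve-∀)
  open import Data.List using (List; []; _∷_; concatMap; replicate; _++_)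
  import Data.List as List
  open import Data.Nat as ℕ using (ℕ; zero; suc)
  open import Data.Product using (_×_; _,_; proj₁)
  open import Data.Vec using (Vec; []; _∷_; map)
  open import Relation.Nullary using (Dec)
  import Data.List.Properties as Listₚ
  open import Relation.Binary.PropositionalEquality hiding ([_])

  private variable
    V A : Set

  if-elim : ∀ {B : Set} (f : A → B) c (s s′ : A) → f s′ ≡ f s → f (if c then s else s′) ≡ f s
  if-elim f true  s s′ e = refl
  if-elim f false s s′ e = e

  if-both : (P : A → Set) (c : Bool) {s s′ : A} → P s → P s′ → P (if c then s else s′)
  if-both P true  p q = p
  if-both P false p q = q

  Triple′ : Set
  Triple′ = Fin 7 × Fin 7 × Fin 7

  swap₁ swap₂ sort₁ sort₂ sort₃ : Triple′ → Triple′
  swap₁ (x , y , z) = y , x , z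
  swap₂ (x , y , z) = x , z , y
  sort₁ t@(x , y , z) = if toℕ x ℕ.≤ᵇ toℕ y then t else swap₁ t
  sort₂ t@(x , y , z) = if toℕ y ℕ.≤ᵇ toℕ z then t else swap₂ t
  sort₃ t = sort₁ (sort₂ (sort₁ t))

  order : Fin 7 → Triple′ → Triple′ → Star (Fin 7)
  order v s t = if toℕ (proj₁ s) ℕ.≤ᵇ toℕ (proj₁ t) then (v , s , t) else (v , t , s)

  -- Both triples are sorted, then exchanged if necessary; thus the 3!·3!·2 = 72 orderings of a star
  -- with disjoint triples share one normal form.
  norm : Star (Fin 7) → Star (Fin 7)
  norm (v , s , t) = order v (sort₃ s) (sort₃ t)

  opaque
    unfolding kernel
    kernel-comm : ∀ f g → kernel f g ≡ kernel g f
    kernel-comm f g = ∑-cong (fins 4) λ j → ℤₚ.*-comm (weight j f) (weight j g)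

  module _ (b : Fin 7 → Fin 7 → Bool) where
    private
      k : Fin 7 → Triple′ → Fin 12
      k v (x , y , z) = kindOf b (cyc b) v x y z

    k-sort₁ : ∀ v t → k v (sort₁ t) ≡ k v t
    k-sort₁ v t@(x , y , z) = if-elim (k v) (toℕ x ℕ.≤ᵇ toℕ y) t (swap₁ t) (sym (kindOf-swap₁ b v x y z))
    k-sort₂ : ∀ v t → k v (sort₂ t) ≡ k v t
    k-sort₂ v t@(x , y , z) = if-elim (k v) (toℕ y ℕ.≤ᵇ toℕ z) t (swap₂ t) (sym (kindOf-swap₂ b v x y z))
    k-sort₃ : ∀ v t → k v (sort₃ t) ≡ k v t
    k-sort₃ v t = trans (k-sort₁ v (sort₂ (sort₁ t))) (trans (k-sort₂ v (sort₁ t)) (k-sort₁ v t))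

    opaque
      unfolding term
      term-order : ∀ v s t → term b (order v s t) ≡ term b (v , s , t)
      term-order v s t = if-elim (term b) (toℕ (proj₁ s) ℕ.≤ᵇ toℕ (proj₁ t)) (v , s , t) (v , t , s) (kernel-comm (k v t) (k v s))

      term-norm : ∀ s → term b (norm s) ≡ term b s
      term-norm (v , s , t) = trans (term-order v (sort₃ s) (sort₃ t)) (cong₂ kernel (k-sort₃ v s) (k-sort₃ v t))

  -- The ten splittings of six points into two triples, in lexicographic order to match the sorted
  -- list.
  stars : A → A → A → A → A → A → A → List (Star A)
  stars v a b c d e f =
    (v , (a , b , c) , (d , e , f)) ∷ (v , (a , b , d) , (c , e , f)) ∷ (v , (a , b , e) , (c , d , f)) ∷
    (v , (a , b , f) , (c , d , e)) ∷ (v , (a , c , d) , (b , e , f)) ∷ (v , (a , c , e) , (b , d , f)) ∷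
    (v , (a , c , f) , (b , d , e)) ∷ (v , (a , d , e) , (b , c , f)) ∷ (v , (a , d , f) , (b , c , e)) ∷
    (v , (a , e , f) , (b , c , d)) ∷ []

  allStars : List (Star (Fin 7))
  allStars = stars 0F 1F 2F 3F 4F 5F 6F ++ stars 1F 0F 2F 3F 4F 5F 6F ++ stars 2F 0F 1F 3F 4F 5F 6F ++
    stars 3F 0F 1F 2F 4F 5F 6F ++ stars 4F 0F 1F 2F 3F 5F 6F ++ stars 5F 0F 1F 2F 3F 4F 6F ++ stars 6F 0F 1F 2F 3F 4F 5F

  points : Vec (Fin 7) 7
  points = 0F ∷ 1F ∷ 2F ∷ 3F ∷ 4F ∷ 5F ∷ 6F ∷ []

  starOf : Perm 7 → Star (Fin 7)
  starOf π = star (map (to π) points)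

  -- Sorting brings lists with the same entries into one order, so that an equality of sums becomes
  -- a decidable equality of lists.
  module MergeSort (key : A → ℕ) where
    merge : List A → List A → List A
    merge []       ys = ys
    merge (x ∷ xs) ys = into ys
      where
      into : List A → List A
      into []       = x ∷ xs
      into (y ∷ ys) = if key x ℕ.≤ᵇ key y then x ∷ merge xs (y ∷ ys) else y ∷ into ys

    mergePairs : List (List A) → List (List A)
    mergePairs (xs ∷ ys ∷ xss) = merge xs ys ∷ mergePairs xss
    mergePairs xss             = xss

    mergeAll : ℕ → List (List A) → List A
    mergeAll zero    xss = List.concat xss
    mergeAll (suc n) xss = mergeAll n (mergePairs xss)

    ∑-merge : ∀ (f : A → ℤ) xs ys → ∑ (merge xs ys) f ≡ ∑ xs f + ∑ ys f
    ∑-merge f []       ys = sym (ℤₚ.+-identityˡ _)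
    ∑-merge f (x ∷ xs) [] = sym (ℤₚ.+-identityʳ _)
    ∑-merge f (x ∷ xs) (y ∷ ys) = if-both (λ zs → ∑ zs f ≡ (f x + ∑ xs f) + (f y + ∑ ys f)) (key x ℕ.≤ᵇ key y)
      (trans (+ˡ (f x) (∑-merge f xs (y ∷ ys))) (sym (ℤₚ.+-assoc (f x) (∑ xs f) _)))
      (trans (+ˡ (f y) (∑-merge f (x ∷ xs) ys)) (rearrange (f x) (f y) (∑ xs f) (∑ ys f)))
      where
      rearrange : ∀ a b c d → b + ((a + c) + d) ≡ (a + c) + (b + d)
      rearrange = solve-∀

    ∑∑ : (A → ℤ) → List (List A) → ℤ
    ∑∑ f xss = ∑ xss (λ xs → ∑ xs f)

    ∑-mergePairs : ∀ f xss → ∑∑ f (mergePairs xss) ≡ ∑∑ f xss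
    ∑-mergePairs f []               = refl
    ∑-mergePairs f (xs ∷ [])        = refl
    ∑-mergePairs f (xs ∷ ys ∷ xss)  = trans (cong₂ _+_ (∑-merge f xs ys) (∑-mergePairs f xss)) (ℤₚ.+-assoc (∑ xs f) (∑ ys f) _)

    ∑-mergeAll : ∀ f n xss → ∑ (mergeAll n xss) f ≡ ∑∑ f xss
    ∑-mergeAll f zero []         = refl
    ∑-mergeAll f zero (xs ∷ xss) = trans (∑-++ xs (List.concat xss) f) (+ˡ (∑ xs f) (∑-mergeAll f zero xss))
    ∑-mergeAll f (suc n) xss     = trans (∑-mergeAll f n (mergePairs xss)) (∑-mergePairs f xss)

  -- The root and the first triple determine a normalised star on seven distinct points, so ties
  -- occur only between equal stars.
  starKey : Star (Fin 7) → ℕ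
  starKey (v , (x , y , z) , (x′ , y′ , z′)) = toℕ v ℕ.* 343 ℕ.+ (toℕ x ℕ.* 49 ℕ.+ (toℕ y ℕ.* 7 ℕ.+ toℕ z))

  open MergeSort starKey

  infix 4 _≟-stars_
  _≟-stars_ : (xs ys : List (Star (Fin 7))) → Dec (xs ≡ ys)
  _≟-stars_ = Listₚ.≡-dec (≡-dec Finₚ._≟_ (≡-dec triple≟ triple≟))
    where
    triple≟ : (s t : Triple′) → Dec (s ≡ t)
    triple≟ = ≡-dec Finₚ._≟_ (≡-dec Finₚ._≟_ Finₚ._≟_)

  sorted-stars : mergeAll 13 (List.map (λ π → norm (starOf π) ∷ []) (perms 7)) ≡ concatMap (replicate 72) allStars
  -- As 2^13 exceeds 5040, thirteen rounds of pairwise merging leave a single sorted list.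
  sorted-stars = fromDoes (_ ≟-stars _) refl

  ∑-replicate : ∀ n (x : A) (f : A → ℤ) → ∑ (replicate n x) f ≡ + n * f x
  ∑-replicate zero    x f = sym (ℤₚ.*-zeroˡ (f x))
  ∑-replicate (suc n) x f = trans (+ˡ (f x) (∑-replicate n x f)) (expand (f x) (+ n))
    where
    expand : ∀ c l → c + l * c ≡ (+ 1 + l) * c
    expand = solve-∀

  ∑-concatMap-replicate : ∀ n (xs : List A) (f : A → ℤ) → ∑ (concatMap (replicate n) xs) f ≡ + n * ∑ xs f
  ∑-concatMap-replicate n []       f = sym (ℤₚ.*-zeroʳ (+ n))
  ∑-concatMap-replicate n (x ∷ xs) f = trans (∑-++ (replicate n x) _ f) (trans (cong₂ _+_ (∑-replicate n x f) (∑-concatMap-replicate n xs f))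
    (sym (ℤₚ.*-distribˡ-+ (+ n) (f x) (∑ xs f))))

  ∑-normalised : ∀ b ps ss n m → mergeAll n (List.map (λ π → norm (starOf π) ∷ []) ps) ≡ concatMap (replicate m) ss →
    ∑ ps (λ π → term b (starOf π)) ≡ + m * ∑ ss (term b)
  ∑-normalised b ps ss n m sorted = begin
    ∑ ps (λ π → term b (starOf π))
      ≡⟨ ∑-cong ps (λ π → trans (sym (term-norm b (starOf π))) (sym (ℤₚ.+-identityʳ (term b (norm (starOf π)))))) ⟩
    ∑ ps (λ π → ∑ (norm (starOf π) ∷ []) (term b))
      ≡⟨ ∑-map ps (λ π → norm (starOf π) ∷ []) (λ xs → ∑ xs (term b)) ⟨
    ∑∑ (term b) (List.map (λ π → norm (starOf π) ∷ []) ps)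
      ≡⟨ ∑-mergeAll (term b) n (List.map (λ π → norm (starOf π) ∷ []) ps) ⟨
    ∑ (mergeAll n (List.map (λ π → norm (starOf π) ∷ []) ps)) (term b)
      ≡⟨ cong (λ xs → ∑ xs (term b)) sorted ⟩
    ∑ (concatMap (replicate m) ss) (term b)
      ≡⟨ ∑-concatMap-replicate m ss (term b) ⟩
    + m * ∑ ss (term b) ∎
    where open ≡-Reasoning

  -- Each star arises from 72 orderings of the seven points.
  ∑-starOf : ∀ b → ∑ (perms 7) (λ π → term b (starOf π)) ≡ + 72 * ∑ allStars (term b)
  ∑-starOf b = ∑-normalised b (perms 7) allStars 13 72 sorted-stars

-- Small tournaments up to isomorphism

module Tournaments where

  open Sums
  open Permutations
  open Kernel
  open Stars
  open SteinerSystems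
  open import Data.Bool using (Bool; true; false; not)
  import Data.Bool.Properties as Boolₚ
  open import Data.Fin using (Fin; zero; suc)
  open import Data.Fin.Patterns
  open import Data.List using (List; []; _∷_; _++_)
  import Data.List as List
  open import Data.List.Membership.Propositional using (_∈_)
  open import Data.List.Membership.Propositional.Properties using (∈-++⁺ˡ; ∈-++⁺ʳ; ∈-map⁺; ∈-cartesianProduct⁺)
  open import Data.List.Relation.Unary.All using ([]; _∷_)
  open import Data.List.Relation.Binary.Pointwise using (Pointwise; []; _∷_; decidable)
  open import Data.List.Relation.Unary.Any as Any using (Any; here; there)
  open import Data.Nat as ℕ using (ℕ; zero; suc)
  import Data.Nat.Properties as ℕₚ
  open import Data.Nat.DivMod using (_mod_; _/_; _%_)
  open import Data.Product using (_×_; _,_)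
  open import Data.Product.Properties using (≡-dec)
  open import Data.Unit using (⊤; tt)
  open import Data.Vec using (Vec; []; _∷_; lookup; tabulate)
  import Data.Vec.Properties as Vecₚ
  open import Function using (_∘_)
  open import Relation.Nullary using (Dec; yes; does; contradiction)
  open import Relation.Binary.PropositionalEquality hiding ([_])

  private variable
    V : Set

  record IsTournament (b : V → V → Bool) : Set where
    field
      irr  : ∀ i → b i i ≡ false
      anti : ∀ i j → i ≢ j → b i j ≡ not (b j i)
  open IsTournament public

  pullback : ∀ {W : Set} {b : V → V → Bool} (f : W → V) → (∀ {x y} → f x ≡ f y → x ≡ y) → IsTournament b → IsTournament λ i j → b (f i) (f j)
  pullback f inj t = record { irr = λ i → irr t (f i) ; anti = λ i j i≢j → anti t (f i) (f j) (i≢j ∘ inj) }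

  -- Tournaments as triangular bit tables; the newest vertex is 0.
  Tri : ℕ → Set
  Tri zero    = ⊤
  Tri (suc k) = Tri k × Vec Bool k

  beats′ : ∀ {k} → Tri k → Fin k → Fin k → Bool
  beats′ (t , r) zero    zero    = false
  beats′ (t , r) zero    (suc j) = lookup r j
  beats′ (t , r) (suc i) zero    = not (lookup r i)
  beats′ (t , r) (suc i) (suc j) = beats′ t i j

  encode : ∀ {k} → (Fin k → Fin k → Bool) → Tri k
  encode {zero}  b = tt
  encode {suc k} b = encode (λ i j → b (suc i) (suc j)) , tabulate (λ j → b zero (suc j))

  beats-encode : ∀ {k} {b : Fin k → Fin k → Bool} → IsTournament b → ∀ i j → beats′ (encode b) i j ≡ b i j
  beats-encode t zero    zero    = sym (irr t zero)
  beats-encode t zero    (suc j) = Vecₚ.lookup∘tabulate _ j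
  beats-encode t (suc i) zero    = trans (cong not (Vecₚ.lookup∘tabulate _ i)) (sym (anti t (suc i) zero λ ()))
  beats-encode t (suc i) (suc j) = beats-encode (pullback suc (λ { refl → refl }) t) i j

  beats-tournament : ∀ {k} (t : Tri k) → IsTournament (beats′ t)
  beats-tournament t = record { irr = irrefl′ t ; anti = anti′ t }
    where
    irrefl′ : ∀ {k} (t : Tri k) i → beats′ t i i ≡ false
    irrefl′ (t , r) zero    = refl
    irrefl′ (t , r) (suc i) = irrefl′ t i
    anti′ : ∀ {k} (t : Tri k) i j → i ≢ j → beats′ t i j ≡ not (beats′ t j i)
    anti′ (t , r) zero    zero    i≢j = contradiction refl i≢j
    anti′ (t , r) zero    (suc j) i≢j = sym (Boolₚ.not-involutive (lookup r j))
    anti′ (t , r) (suc i) zero    i≢j = refl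
    anti′ (t , r) (suc i) (suc j) i≢j = anti′ t i j (i≢j ∘ cong suc)

  to-injective : ∀ {n} (π : Perm n) {x y} → to π x ≡ to π y → x ≡ y
  to-injective π {x} {y} e = trans (sym (from-to π x)) (trans (cong (from π) e) (from-to π y))

  relabel : ∀ {k} → Perm k → Tri k → Tri k
  relabel π t = encode λ i j → beats′ t (to π i) (to π j)

  beats-relabel : ∀ {k} (π : Perm k) t i j → beats′ (relabel π t) i j ≡ beats′ t (to π i) (to π j)
  beats-relabel π t = beats-encode (pullback (to π) (to-injective π) (beats-tournament t))

  Closed : ∀ {k} → (Tri k → Set) → Set
  Closed P = ∀ π t → P (relabel π t) → P t

  -- Every tournament on k vertices is isomorphic to one in the list.
  Represents : ∀ {k} → List (Tri k) → Set₁
  Represents {k} rs = ∀ (P : Tri k → Set) → Closed P → (∀ t → t ∈ rs → P t) → ∀ t → P t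

  rows : ∀ k → List (Vec Bool k)
  rows zero    = [] ∷ []
  rows (suc k) = List.map (true ∷_) (rows k) ++ List.map (false ∷_) (rows k)

  ∈-rows : ∀ {k} (r : Vec Bool k) → r ∈ rows k
  ∈-rows []          = here refl
  ∈-rows {suc k} (true  ∷ r) = ∈-++⁺ˡ (∈-map⁺ (true ∷_) (∈-rows r))
  ∈-rows {suc k} (false ∷ r) = ∈-++⁺ʳ (List.map (true ∷_) (rows k)) (∈-map⁺ (false ∷_) (∈-rows r))

  infix 4 _≟T_
  _≟T_ : ∀ {k} (s t : Tri k) → Dec (s ≡ t)
  _≟T_ {zero}  tt tt = yes refl
  _≟T_ {suc k} = ≡-dec _≟T_ (Vecₚ.≡-dec Boolₚ._≟_)

  member? : ∀ {k} (t : Tri k) ts → Dec (Any (t ≡_) ts)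
  member? t = Any.any? (t ≟T_)

  extensions : ∀ {k} → List (Tri k) → List (Tri (suc k))
  extensions {k} rs = List.cartesianProduct rs (rows k)

  -- Each tournament of the first list is carried into rs by one of the permutations in its entry of the second.
  Reaches : ∀ {k} → List (Tri k) → List (Tri k) → List (List (Perm k)) → Set
  Reaches rs = Pointwise λ t → Any λ π → Any (relabel π t ≡_) rs

  reaches? : ∀ {k} (rs ts : List (Tri k)) πss → Dec (Reaches rs ts πss)
  reaches? rs = decidable λ t → Any.any? λ π → member? (relabel π t) rs

  -- Deleting the newest vertex leaves a tournament to which `rep` applies. The induction predicate
  -- ranges over all rows of that vertex, because relabelling the others permutes its row.
  represents-suc : ∀ {k} {rs : List (Tri k)} {rs′ πss} → Represents rs → Reaches rs′ (extensions rs) πss → Represents rs′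
  represents-suc {k} {rs} {rs′} rep reach P closed onReps (t , row) = rep (λ t → ∀ row → P (t , row))
    -- The code (zero , π) fixes the newest vertex and acts as π on the others.
    (λ π t Pt row → closed (zero , π) (t , row) (Pt _))
    (λ t t∈rs row → found (t , row) reach (∈-cartesianProduct⁺ t∈rs (∈-rows row))) t row
    where
    found-at : ∀ t {πs} → Any (λ π → Any (relabel π t ≡_) rs′) πs → P t
    found-at t (here {x = π} r∈) = closed π t (onReps _ r∈)
    found-at t (there a)         = found-at t a
    found : ∀ t {ts πss} → Reaches rs′ ts πss → t ∈ ts → P t
    found t (r ∷ _)  (here refl) = found-at t r
    found t (_ ∷ rs) (there t∈)  = found t rs t∈

  row : ∀ k → ℕ → Vec Bool k
  row zero    n = []
  row (suc k) n = does (n % 2 ℕ.≟ 1) ∷ row k (n / 2)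

  -- The row of the newest vertex occupies the lowest k bits.
  decode : ∀ k → ℕ → Tri k
  decode zero    n = tt
  decode (suc k) n = decode k (n / (2 ℕ.^ k)) , row k n
    where instance nz = ℕₚ.m^n≢0 2 k

  permOf : ∀ k → ℕ → Perm k
  permOf zero    n = tt
  permOf (suc k) n = n mod suc k , permOf k (n / suc k)

  -- The lists have 2, 4, 12 and 56 entries, the numbers of tournaments on 3, 4, 5 and 6 vertices up
  -- to isomorphism.
  reps₃ : List (Tri 3)
  reps₃ = List.map (decode 3) (0 ∷ 2 ∷ [])

  reps₄ : List (Tri 4)
  reps₄ = List.map (decode 4) (0 ∷ 2 ∷ 4 ∷ 5 ∷ [])

  reps₅ : List (Tri 5)
  reps₅ = List.map (decode 5) (0 ∷ 2 ∷ 4 ∷ 5 ∷ 8 ∷ 9 ∷ 10 ∷ 11 ∷ 12 ∷ 40 ∷ 41 ∷ 76 ∷ [])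

  reps₆ : List (Tri 6)
  reps₆ = List.map (decode 6)
    (0 ∷ 2 ∷ 4 ∷ 5 ∷ 8 ∷ 9 ∷ 10 ∷ 11 ∷ 12 ∷ 16 ∷ 17 ∷ 18 ∷ 19 ∷ 20 ∷ 21 ∷ 22 ∷ 23 ∷ 24 ∷ 25 ∷ 26 ∷ 28 ∷
     72 ∷ 73 ∷ 80 ∷ 81 ∷ 83 ∷ 87 ∷ 88 ∷ 89 ∷ 140 ∷ 144 ∷ 145 ∷ 146 ∷ 147 ∷ 148 ∷ 149 ∷ 150 ∷ 152 ∷ 153 ∷
     154 ∷ 156 ∷ 176 ∷ 177 ∷ 178 ∷ 179 ∷ 181 ∷ 280 ∷ 281 ∷ 282 ∷ 313 ∷ 314 ∷ 344 ∷ 345 ∷ 377 ∷ 408 ∷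
     1332 ∷ [])

  -- One Lehmer code, written in mixed radix, for each of the 12·32 extensions; below six vertices
  -- all permutations are searched instead.
  routes₆ : List (List (Perm 6))
  routes₆ = List.map (λ n → permOf 6 n ∷ [])
    (517 ∷ 157 ∷ 0 ∷ 37 ∷ 519 ∷ 0 ∷ 0 ∷ 7 ∷ 518 ∷ 158 ∷ 0 ∷ 0 ∷ 0 ∷ 0 ∷ 0 ∷ 1 ∷ 517 ∷ 157 ∷ 0 ∷ 37 ∷ 0 ∷
     0 ∷ 0 ∷ 0 ∷ 0 ∷ 0 ∷ 0 ∷ 0 ∷ 0 ∷ 0 ∷ 0 ∷ 0 ∷ 517 ∷ 157 ∷ 0 ∷ 37 ∷ 519 ∷ 159 ∷ 0 ∷ 7 ∷ 524 ∷ 164 ∷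
     12 ∷ 9 ∷ 0 ∷ 0 ∷ 0 ∷ 1 ∷ 517 ∷ 157 ∷ 36 ∷ 14 ∷ 36 ∷ 36 ∷ 36 ∷ 32 ∷ 12 ∷ 12 ∷ 12 ∷ 3 ∷ 0 ∷ 0 ∷ 0 ∷
     1 ∷ 517 ∷ 157 ∷ 520 ∷ 37 ∷ 519 ∷ 40 ∷ 0 ∷ 7 ∷ 518 ∷ 158 ∷ 0 ∷ 1 ∷ 0 ∷ 10 ∷ 0 ∷ 1 ∷ 517 ∷ 157 ∷ 0 ∷
     37 ∷ 0 ∷ 16 ∷ 0 ∷ 7 ∷ 0 ∷ 0 ∷ 0 ∷ 1 ∷ 0 ∷ 4 ∷ 0 ∷ 1 ∷ 517 ∷ 157 ∷ 526 ∷ 37 ∷ 555 ∷ 46 ∷ 0 ∷ 7 ∷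
     518 ∷ 158 ∷ 0 ∷ 37 ∷ 48 ∷ 46 ∷ 0 ∷ 1 ∷ 517 ∷ 75 ∷ 162 ∷ 135 ∷ 48 ∷ 16 ∷ 0 ∷ 7 ∷ 162 ∷ 75 ∷ 162 ∷
     153 ∷ 48 ∷ 34 ∷ 0 ∷ 1 ∷ 517 ∷ 157 ∷ 161 ∷ 37 ∷ 519 ∷ 1 ∷ 41 ∷ 7 ∷ 518 ∷ 157 ∷ 167 ∷ 1 ∷ 0 ∷ 1 ∷
     11 ∷ 1 ∷ 517 ∷ 157 ∷ 161 ∷ 37 ∷ 0 ∷ 1 ∷ 17 ∷ 7 ∷ 517 ∷ 157 ∷ 5 ∷ 1 ∷ 0 ∷ 1 ∷ 5 ∷ 1 ∷ 517 ∷ 157 ∷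
     167 ∷ 37 ∷ 519 ∷ 1 ∷ 47 ∷ 7 ∷ 518 ∷ 157 ∷ 167 ∷ 37 ∷ 0 ∷ 1 ∷ 47 ∷ 1 ∷ 517 ∷ 157 ∷ 83 ∷ 37 ∷ 0 ∷ 1 ∷
     17 ∷ 7 ∷ 517 ∷ 157 ∷ 35 ∷ 1 ∷ 35 ∷ 1 ∷ 35 ∷ 1 ∷ 517 ∷ 157 ∷ 197 ∷ 37 ∷ 519 ∷ 163 ∷ 41 ∷ 7 ∷ 518 ∷
     157 ∷ 53 ∷ 13 ∷ 0 ∷ 1 ∷ 11 ∷ 1 ∷ 517 ∷ 157 ∷ 77 ∷ 37 ∷ 523 ∷ 1 ∷ 137 ∷ 7 ∷ 517 ∷ 157 ∷ 23 ∷ 13 ∷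
     0 ∷ 1 ∷ 137 ∷ 1 ∷ 517 ∷ 157 ∷ 197 ∷ 37 ∷ 519 ∷ 163 ∷ 203 ∷ 7 ∷ 518 ∷ 157 ∷ 197 ∷ 37 ∷ 0 ∷ 1 ∷ 155 ∷
     1 ∷ 316 ∷ 436 ∷ 77 ∷ 37 ∷ 322 ∷ 496 ∷ 137 ∷ 7 ∷ 316 ∷ 436 ∷ 77 ∷ 1 ∷ 514 ∷ 514 ∷ 155 ∷ 1 ∷ 517 ∷
     157 ∷ 520 ∷ 37 ∷ 675 ∷ 49 ∷ 41 ∷ 7 ∷ 674 ∷ 157 ∷ 1 ∷ 1 ∷ 1 ∷ 1 ∷ 1 ∷ 1 ∷ 517 ∷ 157 ∷ 1 ∷ 37 ∷ 315 ∷
     49 ∷ 1 ∷ 7 ∷ 314 ∷ 157 ∷ 1 ∷ 1 ∷ 0 ∷ 1 ∷ 1 ∷ 1 ∷ 517 ∷ 157 ∷ 520 ∷ 37 ∷ 549 ∷ 49 ∷ 47 ∷ 7 ∷ 518 ∷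
     73 ∷ 413 ∷ 133 ∷ 59 ∷ 19 ∷ 47 ∷ 7 ∷ 517 ∷ 157 ∷ 529 ∷ 37 ∷ 553 ∷ 49 ∷ 17 ∷ 7 ∷ 517 ∷ 73 ∷ 383 ∷
     133 ∷ 29 ∷ 19 ∷ 17 ∷ 7 ∷ 517 ∷ 157 ∷ 520 ∷ 37 ∷ 681 ∷ 49 ∷ 47 ∷ 7 ∷ 518 ∷ 73 ∷ 176 ∷ 133 ∷ 61 ∷
     19 ∷ 47 ∷ 7 ∷ 517 ∷ 157 ∷ 322 ∷ 37 ∷ 321 ∷ 49 ∷ 17 ∷ 7 ∷ 517 ∷ 73 ∷ 0 ∷ 133 ∷ 148 ∷ 19 ∷ 17 ∷ 7 ∷
     517 ∷ 521 ∷ 538 ∷ 37 ∷ 591 ∷ 179 ∷ 41 ∷ 7 ∷ 674 ∷ 158 ∷ 232 ∷ 37 ∷ 58 ∷ 58 ∷ 11 ∷ 11 ∷ 517 ∷ 434 ∷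
     175 ∷ 494 ∷ 315 ∷ 434 ∷ 41 ∷ 7 ∷ 111 ∷ 261 ∷ 111 ∷ 494 ∷ 28 ∷ 261 ∷ 28 ∷ 7 ∷ [])

  represents₃ : Represents reps₃
  represents₃ = represents-suc (represents-suc (represents-suc {rs = tt ∷ []} (λ P _ on t → on t (here refl))
    (fromDoes (reaches? (decode 1 0 ∷ []) (extensions (tt ∷ [])) (List.replicate 1 (perms 1))) refl))
    (fromDoes (reaches? (decode 2 0 ∷ []) (extensions (decode 1 0 ∷ [])) (List.replicate 2 (perms 2))) refl))
    (fromDoes (reaches? reps₃ (extensions (decode 2 0 ∷ [])) (List.replicate 4 (perms 3))) refl)

  represents₅ : Represents reps₅
  represents₅ = represents-suc (represents-suc represents₃
    (fromDoes (reaches? reps₄ (extensions reps₃) (List.replicate 16 (perms 4))) refl))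
    (fromDoes (reaches? reps₅ (extensions reps₄) (List.replicate 64 (perms 5))) refl)

  represents₆ : Represents reps₆
  represents₆ = represents-suc represents₅ (fromDoes (reaches? reps₆ (extensions reps₅) routes₆) refl)

-- Fano planes and the inequality on seven points

module SevenPoints where

  open Sums
  open Permutations
  open Kernel
  open Stars
  open Tournaments
  open SteinerSystems
  open import Data.Bool using (Bool; false)
  open import Data.Fin using (Fin; zero; suc; toℕ)
  open import Data.Fin.Patterns
  open import Data.Fin.Properties as Finₚ using (all?)
  open import Data.Integer using (ℤ; +_; _+_; _*_; _≤_)
  open import Data.Integer.Properties as ℤₚ using (_≤?_)
  open import Data.Integer.Tactic.RingSolver using (solve-∀)
  open import Data.List using (List; []; _∷_; concatMap; _++_)
  import Data.List as List
  import Data.List.Properties as Listₚ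
  open import Data.List.Relation.Unary.All as All using (All; []; _∷_)
  open import Data.List.Relation.Unary.Any as Any using (Any)
  open import Data.Nat as ℕ using (ℕ; zero; suc)
  open import Data.Product using (_,_)
  open import Data.Product.Properties using (≡-dec)
  open import Data.Vec using (Vec; []; _∷_; lookup; tabulate)
  import Data.Vec.Properties as Vecₚ
  open import Relation.Nullary using (Dec)
  open import Relation.Binary.PropositionalEquality hiding ([_])

  private variable
    A V : Set
    n : ℕ

  opaque
    -- The function is stored as a table, so that the finite check evaluates each entry once.
    memo : (Fin n → A) → Fin n → A
    memo f = lookup (tabulate f)

    memo-≡ : ∀ (f : Fin n → A) i → memo f i ≡ f i
    memo-≡ f i = Vecₚ.lookup∘tabulate f i

  memo₂ : ∀ {m} → (Fin m → Fin n → A) → Fin m → Fin n → A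
  memo₂ f = memo λ i → memo (f i)

  memo₃ : ∀ {l m} → (Fin l → Fin m → Fin n → A) → Fin l → Fin m → Fin n → A
  memo₃ f = memo λ i → memo₂ (f i)

  memo₂-≡ : ∀ {m} (f : Fin m → Fin n → A) i j → memo₂ f i j ≡ f i j
  memo₂-≡ f i j = trans (cong (λ g → g j) (memo-≡ (λ i → memo (f i)) i)) (memo-≡ (f i) j)

  memo₃-≡ : ∀ {l m} (f : Fin l → Fin m → Fin n → A) i j k → memo₃ f i j k ≡ f i j k
  memo₃-≡ f i j k = trans (cong (λ g → g j k) (memo-≡ (λ i → memo₂ (f i)) i)) (memo₂-≡ (f i) j k)

  quadratic : List (Star (Fin 7)) → (Fin 7 → Fin 7 → Bool) → (Fin 7 → Fin 7 → Fin 7 → Bool) → (Fin 12 → Fin 12 → ℤ) → ℤ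
  quadratic ss o c p = ∑ ss λ (v , (x , y , z) , (x′ , y′ , z′)) → p (kindOf o c v x y z) (kindOf o c v x′ y′ z′)

  fanoLines : List Triple′
  fanoLines = (0F , 1F , 3F) ∷ (1F , 2F , 4F) ∷ (2F , 3F , 5F) ∷ (3F , 4F , 6F) ∷ (4F , 5F , 0F) ∷ (5F , 6F , 1F) ∷ (6F , 0F , 2F) ∷ []

  lineCost : (Fin 7 → Fin 7 → Fin 7 → Bool) → List Triple′ → ℤ
  lineCost c ls = ∑ ls λ (x , y , z) → 𝟙 (c x y z)

  image : Perm 7 → List Triple′
  image π = List.map (λ (x , y , z) → to π x , to π y , to π z) fanoLines

  -- One permutation for each of the 30 Fano planes on Fin 7.
  planes : List (Perm 7)
  planes = List.map (λ π → zero , zero , zero , π) (perms 4) ++ List.map (λ π → zero , zero , suc zero , zero , π) (perms 3)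

  Cheap : (Fin 7 → Fin 7 → Fin 7 → Bool) → ℤ → List Triple′ → Set
  Cheap c q ls = lineCost c ls * + 1811 + q ≤ + 1613

  Bounded : List (List Triple′) → (Fin 7 → Fin 7 → Fin 7 → Bool) → ℤ → Set
  Bounded lss c q = Any (Cheap c q) lss

  bounded? : ∀ lss c q → Dec (Bounded lss c q)
  bounded? lss c q = Any.any? (λ ls → lineCost c ls * + 1811 + q ≤? + 1613) lss

  AllBounded : List (List Triple′) → (Fin 12 → Fin 12 → ℤ) → List (Tri 7) → Set
  AllBounded lss p = All λ t → Bounded lss (memo₃ (cyc (beats′ t))) (quadratic allStars (memo₂ (beats′ t)) (memo₃ (cyc (beats′ t))) p)

  allBounded? : ∀ lss p ts → Dec (AllBounded lss p ts)
  allBounded? lss p = All.all? λ t → at (memo₂ (beats′ t)) (memo₃ (cyc (beats′ t)))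
    where
    -- The tables are bound once per tournament and shared by all planes and stars.
    at : ∀ o c → Dec (Bounded lss c (quadratic allStars o c p))
    at o c = bounded? lss c (quadratic allStars o c p)

  fanoTable : Vec (Vec (Fin 7) 7) 7
  fanoTable =
    (0F ∷ 3F ∷ 6F ∷ 1F ∷ 5F ∷ 4F ∷ 2F ∷ []) ∷ (3F ∷ 1F ∷ 4F ∷ 0F ∷ 2F ∷ 6F ∷ 5F ∷ []) ∷
    (6F ∷ 4F ∷ 2F ∷ 5F ∷ 1F ∷ 3F ∷ 0F ∷ []) ∷ (1F ∷ 0F ∷ 5F ∷ 3F ∷ 6F ∷ 2F ∷ 4F ∷ []) ∷
    (5F ∷ 2F ∷ 1F ∷ 6F ∷ 4F ∷ 0F ∷ 3F ∷ []) ∷ (4F ∷ 6F ∷ 3F ∷ 2F ∷ 0F ∷ 5F ∷ 1F ∷ []) ∷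
    (2F ∷ 5F ∷ 0F ∷ 4F ∷ 3F ∷ 1F ∷ 6F ∷ []) ∷ []

  fanoOp : Fin 7 → Fin 7 → Fin 7
  fanoOp x y = lookup (lookup fanoTable x) y

  fano : Steiner (Fin 7)
  fano = record
    { _∙_    = fanoOp
    ; idem   = fromDoes (all? λ x → fanoOp x x Finₚ.≟ x) refl
    ; comm   = fromDoes (all? λ x → all? λ y → fanoOp x y Finₚ.≟ fanoOp y x) refl
    ; cancel = fromDoes (all? λ x → all? λ y → fanoOp x (fanoOp x y) Finₚ.≟ y) refl
    }

  -- The 49 ordered pairs with their third points, once by rows of the table and once as six orders
  -- of each line followed by the diagonal.
  flags₁ flags₂ : List Triple′
  flags₁ = concatMap (λ x → List.map (λ y → x , y , fanoOp x y) (fins 7)) (fins 7)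
  flags₂ = concatMap (λ (x , y , z) → (x , y , z) ∷ (x , z , y) ∷ (y , x , z) ∷ (y , z , x) ∷ (z , x , y) ∷ (z , y , x) ∷ []) fanoLines
    ++ List.map (λ x → x , x , x) (fins 7)

  module TripleSort = MergeSort (λ ((x , y , z) : Triple′) → toℕ x ℕ.* 7 ℕ.+ toℕ y)

  sorted-flags : TripleSort.mergeAll 6 (List.map (_∷ []) flags₂) ≡ flags₁
  sorted-flags = fromDoes (Listₚ.≡-dec (≡-dec Finₚ._≟_ (≡-dec Finₚ._≟_ Finₚ._≟_)) _ _) refl

  -- Each line carries six ordered pairs, on which a symmetric f agrees, and the diagonal
  -- contributes nothing.
  ∑-flags : (f : Triple′ → ℤ) → (∀ x y z → f (x , y , z) ≡ f (x , z , y)) → (∀ x y z → f (x , y , z) ≡ f (y , x , z)) → (∀ x → f (x , x , x) ≡ + 0) →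
    ∑ (fins 7) (λ x → ∑ (fins 7) λ y → f (x , y , fanoOp x y)) ≡ + 6 * ∑ fanoLines f
  ∑-flags f swap₂ swap₁ zero′ = begin
    ∑ (fins 7) (λ x → ∑ (fins 7) λ y → f (x , y , fanoOp x y))
      ≡⟨ ∑-cong (fins 7) (λ x → ∑-map (fins 7) (λ y → x , y , fanoOp x y) f) ⟨
    ∑ (fins 7) (λ x → ∑ (List.map (λ y → x , y , fanoOp x y) (fins 7)) f)
      ≡⟨ ∑-concatMap (fins 7) (λ x → List.map (λ y → x , y , fanoOp x y) (fins 7)) f ⟨
    ∑ flags₁ f
      ≡⟨ cong (λ xs → ∑ xs f) sorted-flags ⟨
    ∑ (TripleSort.mergeAll 6 (List.map (_∷ []) flags₂)) f
      ≡⟨ singletons flags₂ ⟩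
    ∑ flags₂ f
      ≡⟨ trans (∑-++ (concatMap orders fanoLines) diagonal f) (cong₂ _+_ (trans (∑-concatMap fanoLines orders f) (trans (∑-cong fanoLines six) (∑-*ˡ fanoLines (+ 6) f))) (trans (∑-map (fins 7) (λ x → x , x , x) f) (trans (∑-cong (fins 7) zero′) (∑-zero (fins 7))))) ⟩
    + 6 * ∑ fanoLines f + + 0
      ≡⟨ ℤₚ.+-identityʳ _ ⟩
    + 6 * ∑ fanoLines f ∎
    where
    open ≡-Reasoning
    orders : Triple′ → List Triple′
    orders (x , y , z) = (x , y , z) ∷ (x , z , y) ∷ (y , x , z) ∷ (y , z , x) ∷ (z , x , y) ∷ (z , y , x) ∷ []
    diagonal = List.map (λ x → x , x , x) (fins 7)
    singletons : ∀ ts → ∑ (TripleSort.mergeAll 6 (List.map (_∷ []) ts)) f ≡ ∑ ts f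
    singletons ts = trans (TripleSort.∑-mergeAll f 6 (List.map (_∷ []) ts)) (trans (∑-map ts (_∷ []) (λ xs → ∑ xs f)) (∑-cong ts λ t → ℤₚ.+-identityʳ (f t)))
    six : ∀ t → ∑ (orders t) f ≡ + 6 * f t
    six (x , y , z)
      rewrite swap₂ z y x | swap₁ z x y | sym (swap₂ x y z) | swap₂ y z x | sym (swap₁ x y z)
      = sixfold (f (x , y , z))
      where
      sixfold : ∀ a → a + (a + (a + (a + (a + (a + + 0))))) ≡ + 6 * a
      sixfold = solve-∀

  relabelled : Perm 7 → Steiner (Fin 7) → Steiner (Fin 7)
  relabelled π = transport (to π) (from π) (from-to π) (to-from π)

  cyc-refl : ∀ {b : V → V → Bool} → IsTournament b → ∀ x → cyc b x x x ≡ false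
  cyc-refl t x rewrite irr t x = refl

  cyc-cong : ∀ {b b′ : V → V → Bool} → (∀ x y → b x y ≡ b′ x y) → ∀ x y z → cyc b x y z ≡ cyc b′ x y z
  cyc-cong e x y z rewrite e x y | e y z | e z x | e x z | e z y | e y x = refl

  ∑∑-cong : ∀ (xs : List A) (ys : List V) {f g : A → V → ℤ} → (∀ x y → f x y ≡ g x y) → ∑ xs (λ x → ∑ ys (f x)) ≡ ∑ xs (λ x → ∑ ys (g x))
  ∑∑-cong xs ys e = ∑-cong xs λ x → ∑-cong ys (e x)

  opaque
    -- For a tournament this is six times the number of cyclic triples. As a sum over ordered pairs
    -- it involves no choice of representatives, so relabelling is a mere change of variables.
    steinerCost : (Fin 7 → Fin 7 → Bool) → Steiner (Fin 7) → ℤ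
    steinerCost b s = ∑ (fins 7) λ i → ∑ (fins 7) λ j → 𝟙 (cyc b i j (_∙_ s i j))

    steinerCost-def : ∀ b s → steinerCost b s ≡ ∑ (fins 7) λ i → ∑ (fins 7) λ j → 𝟙 (cyc b i j (_∙_ s i j))
    steinerCost-def b s = refl

    steinerCost-cong : ∀ {b b′} → (∀ i j → b i j ≡ b′ i j) → ∀ s → steinerCost b s ≡ steinerCost b′ s
    steinerCost-cong {b} {b′} e s = ∑∑-cong (fins 7) (fins 7) {λ i j → 𝟙 (cyc b i j (_∙_ s i j))} {λ i j → 𝟙 (cyc b′ i j (_∙_ s i j))}
      λ i j → cong 𝟙 (cyc-cong e i j (_∙_ s i j))

    steinerCost-relabelled : ∀ b π s → steinerCost b (relabelled π s) ≡ steinerCost (λ i j → b (to π i) (to π j)) s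
    steinerCost-relabelled b π s = sym (trans (∑-cong (fins 7) λ i → trans (∑-cong (fins 7) λ j → cong₂ (λ x y → 𝟙 (cyc b (to π i) (to π j) (to π (_∙_ s x y)))) (sym (from-to π i)) (sym (from-to π j)))
         (∑-bij (enumFin 7) (enumFin 7) (to π) (from π) (from-to π) (to-from π) λ j → 𝟙 (cyc b (to π i) j (_∙_ (relabelled π s) (to π i) j))))
      (∑-bij (enumFin 7) (enumFin 7) (to π) (from π) (from-to π) (to-from π) λ i → ∑ (fins 7) λ j → 𝟙 (cyc b i j (_∙_ (relabelled π s) i j))))

    steinerCost-fano : ∀ b → IsTournament b → ∀ π → steinerCost b (relabelled π fano) ≡ + 6 * lineCost (cyc b) (image π)
    steinerCost-fano b t π = trans (steinerCost-relabelled b π fano)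
      (trans (∑-flags (λ (x , y , z) → 𝟙 (cyc b (to π x) (to π y) (to π z))) (λ x y z → cong 𝟙 (cyc-swap b (to π x) (to π y) (to π z)))
         (λ x y z → cong 𝟙 (cyc-swap₁ b (to π x) (to π y) (to π z))) (λ x → cong 𝟙 (cyc-refl t (to π x))))
        (cong (λ z → + 6 * z) (sym (∑-map fanoLines (λ (x , y , z) → to π x , to π y , to π z) (λ (x , y , z) → 𝟙 (cyc b x y z))))))

-- The inequality in isomorphism-invariant form

module Certificate where

  open Sums
  open Permutations
  open Kernel
  open Stars
  open Tournaments
  open SevenPoints
  open import Data.Bool using (Bool; true)
  open import Data.Fin using (Fin; zero; suc)
  open import Data.Fin.Patterns
  open import Data.Integer using (ℤ; +_; _+_; _*_; _≤_)
  import Data.Integer.Properties as ℤₚ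
  open import Data.Integer.Tactic.RingSolver using (solve-∀)
  open import Data.List using (List; []; _∷_)
  import Data.List as List
  open import Data.List.Membership.Propositional.Properties using (∈-cartesianProduct⁺)
  open import Data.List.Relation.Unary.All as All using (All; []; _∷_)
  open import Data.List.Relation.Unary.Any using (satisfied)
  import Data.List.Relation.Unary.Any.Properties as Anyₚ
  open import Data.Nat as ℕ using (ℕ; zero; suc; _!)
  open import Data.Product using (_,_; ∃)
  open import Data.Vec using (Vec; []; _∷_; lookup; map)
  open import Function using (_∘_)
  open import Relation.Binary.PropositionalEquality hiding ([_])

  private variable
    A V : Set
    n : ℕ

  kindOf-cong : ∀ {o o′ : V → V → Bool} {c c′ : V → V → V → Bool} → (∀ x y → o x y ≡ o′ x y) → (∀ x y z → c x y z ≡ c′ x y z) →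
    ∀ v x y z → kindOf o c v x y z ≡ kindOf o′ c′ v x y z
  kindOf-cong {o = o} {o′} {c} {c′} eo ec v x y z
    rewrite eo v x | eo v y | eo v z | ec v x y | ec v x z | ec v y z | ec x y z = refl

  opaque
    unfolding term
    term-cong : ∀ {b b′ : V → V → Bool} → (∀ x y → b x y ≡ b′ x y) → ∀ s → term b s ≡ term b′ s
    term-cong e (v , (x , y , z) , (x′ , y′ , z′)) =
      cong₂ kernel (kindOf-cong e (cyc-cong e) v x y z) (kindOf-cong e (cyc-cong e) v x′ y′ z′)

    term-pullback : ∀ {n m} (f : Fin n → Fin m) (b : Fin m → Fin m → Bool) (t : Vec (Fin n) 7) →
      term (λ i j → b (f i) (f j)) (star t) ≡ term b (star (map f t))
    term-pullback f b (v ∷ x ∷ y ∷ z ∷ x′ ∷ y′ ∷ z′ ∷ []) = refl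

  termOf : (Fin n → Fin n → Bool) → Vec (Fin n) 7 → ℤ
  termOf b t = 𝟙 (distinct t) * term b (star t)

  termOf-vanishing : ∀ (b : Fin n → Fin n → Bool) → Vanishing (termOf b)
  termOf-vanishing b t dt = trans (cong (λ d → 𝟙 d * term b (star t)) dt) (ℤₚ.*-zeroˡ (term b (star t)))

  termOf-distinct : ∀ (b : Fin n → Fin n → Bool) t → distinct t ≡ true → termOf b t ≡ term b (star t)
  termOf-distinct b t dt = trans (cong (λ d → 𝟙 d * term b (star t)) dt) (ℤₚ.*-identityˡ (term b (star t)))

  opaque
    permSum : ∀ n → (Perm n → ℤ) → ℤ
    permSum n f = ∑ (perms n) f

    permSum-def : ∀ n f → permSum n f ≡ ∑ (perms n) f
    permSum-def n f = refl

    permSum-cong : ∀ n {f g : Perm n → ℤ} → (∀ π → f π ≡ g π) → permSum n f ≡ permSum n g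
    permSum-cong n e = ∑-cong (perms n) e

  -- The right-hand side does not mention s: under random relabelling all tuples of seven distinct
  -- points are alike.
  permSum-term : ∀ r → n ≡ 7 ℕ.+ r → (b : Fin n → Fin n → Bool) (s : Vec (Fin n) 7) → distinct s ≡ true →
    permSum n (λ π → term b (star (map (to π) s))) ≡ + (r !) * ∑T n 7 (termOf b)
  permSum-term {n} r n≡ b s ds = trans (permSum-def n _) (trans
    (∑-cong (perms n) λ π → sym (termOf-distinct b (map (to π) s) (trans (distinct-map (to π) (to-injective π) s) ds)))
    (∑-perms-uniform n 7 r n≡ s ds (termOf b) (termOf-vanishing b)))

  ∑T-bij : ∀ k (π : Perm n) (h : Vec (Fin n) k → ℤ) → ∑T n k (h ∘ map (to π)) ≡ ∑T n k h
  ∑T-bij zero π h = refl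
  ∑T-bij {n} (suc k) π h = trans (∑-cong (fins n) λ i → ∑T-bij k π (h ∘ (to π i ∷_)))
    (∑-bij (enumFin n) (enumFin n) (to π) (from π) (from-to π) (to-from π) λ i → ∑T n k (h ∘ (i ∷_)))

  termOf-pullback : ∀ (ρ : Perm n) b t → termOf (λ i j → b (to ρ i) (to ρ j)) t ≡ termOf b (map (to ρ) t)
  termOf-pullback ρ b t = cong₂ (λ d x → 𝟙 d * x) (sym (distinct-map (to ρ) (to-injective ρ) t)) (term-pullback (to ρ) b t)

  permSum-pullback : ∀ r → n ≡ 7 ℕ.+ r → (ρ : Perm n) (b : Fin n → Fin n → Bool) (s : Vec (Fin n) 7) → distinct s ≡ true →
    permSum n (λ π → term (λ i j → b (to ρ i) (to ρ j)) (star (map (to π) s))) ≡ permSum n (λ π → term b (star (map (to π) s)))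
  permSum-pullback {n} r n≡ ρ b s ds = trans (permSum-term r n≡ (λ i j → b (to ρ i) (to ρ j)) s ds)
    (trans (cong (λ z → + (r !) * z) (trans (∑T-cong n 7 (termOf-pullback ρ b)) (∑T-bij 7 ρ (termOf b)))) (sym (permSum-term r n≡ b s ds)))

  -- Symmetrised over all labellings and hence an invariant of the isomorphism type; the reduction
  -- to representatives rests on this.
  form : (Fin 7 → Fin 7 → Bool) → ℤ
  form b = permSum 7 λ π → term b (starOf π)

  form-pullback : ∀ (ρ : Perm 7) b → form (λ i j → b (to ρ i) (to ρ j)) ≡ form b
  form-pullback ρ b = permSum-pullback 0 refl ρ b points refl

  form-cong : ∀ {b b′} → (∀ i j → b i j ≡ b′ i j) → form b ≡ form b′
  form-cong e = permSum-cong 7 λ π → term-cong e (starOf π)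

  form-stars : ∀ b → form b ≡ + 72 * ∑ allStars (term b)
  form-stars b = trans (permSum-def 7 λ π → term b (starOf π)) (∑-starOf b)

  -- The inequality 1811 f + Q ≤ 1613 times 72. A star arises from 72 labellings and a line from 6
  -- ordered pairs, so the constants are 12·1811 = 21732 and 72·1613 = 116136.
  Good : (Fin 7 → Fin 7 → Bool) → Set
  Good b = ∃ λ s → steinerCost b s * + 21732 + form b ≤ + 116136

  Good-cong : ∀ {b b′} → (∀ i j → b i j ≡ b′ i j) → Good b → Good b′
  Good-cong {b} {b′} e (s , le) = s , subst₂ (λ c q → c * + 21732 + q ≤ + 116136)
    (steinerCost-cong e s)
    (form-cong e) le

  Good-pullback : ∀ (ρ : Perm 7) b → Good (λ i j → b (to ρ i) (to ρ j)) → Good b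
  Good-pullback ρ b (s , le) = relabelled ρ s ,
    subst₂ (λ c q → c * + 21732 + q ≤ + 116136) (sym (steinerCost-relabelled b ρ s)) (form-pullback ρ b) le

  GoodTri : Tri 7 → Set
  GoodTri t = Good (beats′ t)

  GoodTri-closed : Closed GoodTri
  GoodTri-closed π t = Good-pullback π (beats′ t) ∘ Good-cong (beats-relabel π t)

  opaque
    unfolding term
    quadratic-≡ : ∀ (b : Fin 7 → Fin 7 → Bool) ss → quadratic ss (memo₂ b) (memo₃ (cyc b)) (memo₂ kernel) ≡ ∑ ss (term b)
    quadratic-≡ b ss = ∑-cong ss λ (v , (x , y , z) , (x′ , y′ , z′)) → trans (memo₂-≡ kernel (k v x y z) (k v x′ y′ z′))
      (cong₂ kernel (kindOf-cong (memo₂-≡ b) (memo₃-≡ (cyc b)) v x y z) (kindOf-cong (memo₂-≡ b) (memo₃-≡ (cyc b)) v x′ y′ z′))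
      where
      k : Fin 7 → Fin 7 → Fin 7 → Fin 7 → Fin 12
      k = kindOf (memo₂ b) (memo₃ (cyc b))

  scale : ∀ l q → l * + 1811 + q ≤ + 1613 → (+ 6 * l) * + 21732 + + 72 * q ≤ + 116136
  scale l q le = subst (_≤ + 116136) (distribute l q) (ℤₚ.*-monoʳ-≤-nonNeg (+ 72) le)
    where
    distribute : ∀ l q → (l * + 1811 + q) * + 72 ≡ (+ 6 * l) * + 21732 + + 72 * q
    distribute = solve-∀

  Good-fano : ∀ (b : Fin 7 → Fin 7 → Bool) → IsTournament b → ∀ π → Cheap (cyc b) (∑ allStars (term b)) (image π) → Good b
  Good-fano b tb π le = relabelled π fano ,
    subst₂ (λ c q → c * + 21732 + q ≤ + 116136) (sym (steinerCost-fano b tb π)) (sym (form-stars b))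
      (scale (lineCost (cyc b) (image π)) (∑ allStars (term b)) le)

  lineCost-cong : ∀ {c c′ : Fin 7 → Fin 7 → Fin 7 → Bool} → (∀ x y z → c x y z ≡ c′ x y z) → ∀ ls → lineCost c ls ≡ lineCost c′ ls
  lineCost-cong e ls = ∑-cong ls λ (x , y , z) → cong 𝟙 (e x y z)

  bounded⇒Good : ∀ (b : Fin 7 → Fin 7 → Bool) → IsTournament b → ∀ {c q} → (∀ x y z → c x y z ≡ cyc b x y z) → q ≡ ∑ allStars (term b) →
    ∀ πs → Bounded (List.map image πs) c q → Good b
  bounded⇒Good b tb {c} {q} ec eq πs bd = from-plane (satisfied {P = Cheap c q ∘ image} (Anyₚ.map⁻ bd))
    where
    from-plane : ∃ (Cheap c q ∘ image) → Good b
    from-plane (π , le) = Good-fano b tb π (subst₂ (λ l r → l * + 1811 + r ≤ + 1613) (lineCost-cong ec (image π)) eq le)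

  module Conclusion (allBounded : AllBounded (List.map image planes) (memo₂ kernel) (extensions reps₆)) where

    good : ∀ (b : Fin 7 → Fin 7 → Bool) → IsTournament b → Good b
    good b tb = Good-cong (beats-encode tb) (tri (encode b))
      where
      tri : ∀ t → GoodTri t
      -- Only the six older vertices are normalised; the row of the newest one stays arbitrary.
      tri (t , row) = represents₆ (λ t → ∀ row → GoodTri (t , row))
        (λ π t Pt row → GoodTri-closed (zero , π) (t , row) (Pt _))
        (λ t t∈ row → bounded⇒Good (beats′ (t , row)) (beats-tournament (t , row))
          (memo₃-≡ (cyc (beats′ (t , row)))) (quadratic-≡ (beats′ (t , row)) allStars) planes (All.lookup allBounded (∈-cartesianProduct⁺ t∈ (∈-rows row))))
        t row

-- The finite check

module Check where
  open Kernel
  open Tournaments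
  open SevenPoints
  open SteinerSystems
  import Data.List as List
  open import Relation.Binary.PropositionalEquality
  opaque
    unfolding kernel memo
    -- The check runs over 56·64 = 3584 tournaments, each with up to 30 planes and with 70 stars;
    -- isomorphic copies among them are tolerated.
    allBounded : AllBounded (List.map image planes) (memo₂ kernel) (extensions reps₆)
    allBounded = fromDoes (allBounded? (List.map image planes) (memo₂ kernel) (extensions reps₆)) refl

-- Nonnegativity of the form in the mean

module GramBound where

  open Sums
  open Permutations
  open Kernel
  open Stars
  open SevenPoints
  open Certificate
  open SteinerSystems
  open import Data.Bool using (Bool; true; false; _∧_)
  open import Data.Fin using (Fin; zero; suc)
  open import Data.Fin.Properties using (all?)
  open import Data.Integer as ℤ using (ℤ; +_; _+_; _*_; -_; _-_; _≤_; +≤+)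
  open import Data.Integer.Properties as ℤₚ using (_≤?_)
  open import Data.Integer.Tactic.RingSolver using (solve-∀)
  open import Data.List using (List; _∷_)
  open import Data.Nat as ℕ using (ℕ; zero; suc)
  open import Data.Product using (_×_; _,_)
  open import Data.Vec using (_∷_)
  open import Relation.Binary.PropositionalEquality hiding ([_])

  private variable
    A : Set
    n : ℕ

  ∑-nonneg : ∀ (xs : List A) {f : A → ℤ} → (∀ x → + 0 ≤ f x) → + 0 ≤ ∑ xs f
  ∑-nonneg xs {f} f≥0 = subst (_≤ ∑ xs f) (∑-zero xs) (∑-mono xs f≥0)

  square-nonneg : ∀ z → + 0 ≤ z * z
  square-nonneg (+ zero)  = +≤+ ℕ.z≤n
  square-nonneg (+ suc n) = +≤+ ℕ.z≤n
  square-nonneg ℤ.-[1+ n ] = +≤+ ℕ.z≤n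

  -- For each j the double sum is the square of the sum of the a j x.
  gram-nonneg : ∀ {J : Set} (xs : List A) (js : List J) (a : J → A → ℤ) →
    + 0 ≤ ∑ xs λ x → ∑ xs λ y → ∑ js λ j → a j x * a j y
  gram-nonneg xs js a = subst (+ 0 ≤_) (sym squares) (∑-nonneg js λ j → square-nonneg (∑ xs (a j)))
    where
    open ≡-Reasoning
    squares : ∑ xs (λ x → ∑ xs λ y → ∑ js λ j → a j x * a j y) ≡ ∑ js λ j → ∑ xs (a j) * ∑ xs (a j)
    squares = begin
      ∑ xs (λ x → ∑ xs λ y → ∑ js λ j → a j x * a j y)   ≡⟨ ∑-cong xs (λ x → ∑-swap xs js λ y j → a j x * a j y) ⟩
      ∑ xs (λ x → ∑ js λ j → ∑ xs λ y → a j x * a j y)   ≡⟨ ∑-swap xs js (λ x j → ∑ xs λ y → a j x * a j y) ⟩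
      ∑ js (λ j → ∑ xs λ x → ∑ xs λ y → a j x * a j y)   ≡⟨ ∑-cong js (λ j → trans (∑-cong xs λ x → ∑-*ˡ xs (a j x) (a j)) (∑-*ʳ xs (∑ xs (a j)) (a j))) ⟩
      ∑ js (λ j → ∑ xs (a j) * ∑ xs (a j))               ∎

  enumTriples : ∀ n → Enum (Fin n × Fin n × Fin n)
  enumTriples n = enum× (enumFin n) (enum× (enumFin n) (enumFin n))

  ∑-triples : ∀ n (f : Fin n × Fin n × Fin n → ℤ) →
    ∑ (Enum.list (enumTriples n)) f ≡ ∑ (fins n) λ x → ∑ (fins n) λ y → ∑ (fins n) λ z → f (x , y , z)
  ∑-triples n f = trans (∑× (enumFin n) (enum× (enumFin n) (enumFin n)) f) (∑-cong (fins n) λ x → ∑× (enumFin n) (enumFin n) (λ yz → f (x , yz)))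

  opaque
    unfolding term kernel

    -- A crude bound, which enters only in the error from tuples with a repeated point. The largest
    -- value is 365 = 13² + 12² + 6² + 4², at kind 4.
    kernel≤500 : ∀ f g → kernel f g ≤ + 500
    kernel≤500 = fromDoes (all? λ f → all? λ g → kernel f g ≤? + 500) refl

    term≤500 : ∀ (b : Fin n → Fin n → Bool) t → term b t ≤ + 500
    term≤500 b (v , (x , y , z) , (x′ , y′ , z′)) = kernel≤500 (kindOf b (cyc b) v x y z) (kindOf b (cyc b) v x′ y′ z′)

    -- With v fixed the two triples range independently, so the sum over them is a Gram sum; this is
    -- why tuples with repetitions are included.
    ∑T-term-nonneg : ∀ (b : Fin n → Fin n → Bool) → + 0 ≤ ∑T n 7 λ t → term b (star t)
    ∑T-term-nonneg {n} b = ∑-nonneg (fins n) λ v → subst (+ 0 ≤_) (unfold v)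
      (gram-nonneg (Enum.list (enumTriples n)) (fins 4) λ j (x , y , z) → weight j (kindOf b (cyc b) v x y z))
      where
      unfold : ∀ v → ∑ (Enum.list (enumTriples n)) (λ s → ∑ (Enum.list (enumTriples n)) λ t → term b (v , s , t))
        ≡ ∑T n 6 λ t → term b (star (v ∷ t))
      unfold v = trans (∑-triples n _) (∑-cong (fins n) λ x → ∑-cong (fins n) λ y → ∑-cong (fins n) λ z → ∑-triples n λ t → term b (v , (x , y , z) , t))

  power falling : ℕ → ℕ → ℤ
  power   n k = ∑T n k λ _ → + 1
  falling n k = ∑T n k λ t → 𝟙 (distinct t)

  falling≤power : ∀ n k → falling n k ≤ power n k
  falling≤power n k = ∑T-mono n k λ t → 𝟙≤1 (distinct t)

  power-suc : ∀ n k → power n (suc k) ≡ + n * power n k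
  power-suc n k = trans (∑-const (fins n) (power n k)) (cong (λ m → + m * power n k) (length-fins n))

  falling-suc : ∀ n k → falling n (suc k) ≡ (+ n - + k) * falling n k
  falling-suc n k = begin
    ∑ (fins n) (λ i → ∑T n k λ t → 𝟙 (fresh i t ∧ distinct t))
      ≡⟨ ∑T-swap n k (fins n) (λ i t → 𝟙 (fresh i t ∧ distinct t)) ⟩
    ∑T n k (λ t → ∑ (fins n) λ i → 𝟙 (fresh i t ∧ distinct t))
      ≡⟨ ∑T-cong n k count ⟩
    ∑T n k (λ t → (+ n - + k) * 𝟙 (distinct t))
      ≡⟨ ∑T-*ˡ n k (+ n - + k) (λ t → 𝟙 (distinct t)) ⟩
    (+ n - + k) * falling n k ∎
    where
    open ≡-Reasoning
    count : ∀ t → ∑ (fins n) (λ i → 𝟙 (fresh i t ∧ distinct t)) ≡ (+ n - + k) * 𝟙 (distinct t)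
    count t with distinct t in d
    ... | true  = trans (∑-cong (fins n) λ i → trans (𝟙-∧ (fresh i t) true) (ℤₚ.*-identityʳ (𝟙 (fresh i t)))) (trans (∑-fresh t d) (sym (ℤₚ.*-identityʳ (+ n - + k))))
    ... | false = trans (∑-cong (fins n) λ i → trans (𝟙-∧ (fresh i t) false) (ℤₚ.*-zeroʳ (𝟙 (fresh i t)))) (trans (∑-zero (fins n)) (sym (ℤₚ.*-zeroʳ (+ n - + k))))

  -- Σ_{i<k} i pairs can coincide, each with probability 1/n.
  binom : ℕ → ℤ
  binom zero    = + 0
  binom (suc k) = binom k + + k

  -- With P and F for k entries and P', F' for one more, P' - F' = n (P - F) + k F: either the last
  -- k entries have a repetition, or they are distinct and the new entry equals one of them.
  power-falling : ∀ n k → + n * (power n k - falling n k) ≤ binom k * power n k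
  power-falling n zero = ℤₚ.≤-reflexive (ℤₚ.*-zeroʳ (+ n))
  power-falling n (suc k) = subst₂ _≤_ (sym lhs) (sym rhs)
    (ℤₚ.+-mono-≤ (ℤₚ.*-monoˡ-≤-nonNeg (+ n) (power-falling n k)) (ℤₚ.*-monoˡ-≤-nonNeg (+ n) (ℤₚ.*-monoˡ-≤-nonNeg (+ k) (falling≤power n k))))
    where
    P = power n k
    F = falling n k
    lhs : + n * (power n (suc k) - falling n (suc k)) ≡ + n * (+ n * (P - F)) + + n * (+ k * F)
    lhs = trans (cong₂ (λ p f → + n * (p - f)) (power-suc n k) (falling-suc n k)) (expand (+ n) (+ k) P F)
      where
      expand : ∀ n k p f → n * (n * p - (n - k) * f) ≡ n * (n * (p - f)) + n * (k * f)
      expand = solve-∀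
    rhs : binom (suc k) * power n (suc k) ≡ + n * (binom k * P) + + n * (+ k * P)
    rhs = trans (cong (λ p → (binom k + + k) * p) (power-suc n k)) (expand (+ n) (+ k) (binom k) P)
      where
      expand : ∀ n k b p → (b + k) * (n * p) ≡ n * (b * p) + n * (k * p)
      expand = solve-∀

  -- The sum over all tuples is nonnegative, and a tuple with a repetition accounts for at most 500
  -- of it.
  ∑T-termOf-bound : ∀ (b : Fin n → Fin n → Bool) → - ((power n 7 - falling n 7) * + 500) ≤ ∑T n 7 (termOf b)
  ∑T-termOf-bound {n} b = ℤₚ.≤-trans (subst (_≤ S - D * + 500) (ℤₚ.+-identityˡ (- (D * + 500))) (ℤₚ.+-monoˡ-≤ (- (D * + 500)) (∑T-term-nonneg b)))
    (subst (_≤ ∑T n 7 (termOf b)) total (∑T-mono n 7 λ t → pointwise (distinct t) (term b (star t)) (term≤500 b (star t))))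
    where
    S D : ℤ
    S = ∑T n 7 λ t → term b (star t)
    D = power n 7 - falling n 7
    pointwise : ∀ d x → x ≤ + 500 → x - + 500 * (+ 1 - 𝟙 d) ≤ 𝟙 d * x
    pointwise true  x le = ℤₚ.≤-reflexive (trans (ℤₚ.+-identityʳ x) (sym (ℤₚ.*-identityˡ x)))
    pointwise false x le = subst (x - + 500 ≤_) (sym (ℤₚ.*-zeroˡ x)) (ℤₚ.i≤j⇒i-j≤0 le)
    total : ∑T n 7 (λ t → term b (star t) - + 500 * (+ 1 - 𝟙 (distinct t))) ≡ S - D * + 500
    total = trans (∑T-- n 7 (λ t → term b (star t)) (λ t → + 500 * (+ 1 - 𝟙 (distinct t))))
      (cong (λ z → S - z) (trans (∑T-*ˡ n 7 (+ 500) (λ t → + 1 - 𝟙 (distinct t)))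
        (trans (cong (λ z → + 500 * z) (∑T-- n 7 (λ _ → + 1) (λ t → 𝟙 (distinct t)))) (ℤₚ.*-comm (+ 500) D))))

-- Averaging over relabellings

module Averaging where

  open Sums
  open Permutations
  open Kernel
  open Stars
  open Tournaments
  open SevenPoints
  open Certificate
  open GramBound
  open SteinerSystems
  open import Data.Bool using (Bool; true; false)
  open import Data.Fin using (Fin; zero; suc; _↑ˡ_)
  open import Data.Fin.Properties as Finₚ using (↑ˡ-injective)
  open import Data.Integer as ℤ using (ℤ; +_; _+_; _*_; -_; _-_; _≤_; NonNegative)
  open import Data.Integer.Properties as ℤₚ using (_≤?_)
  open import Data.Integer.Tactic.RingSolver using (solve-∀)
  open import Data.List using (List; []; _∷_)
  open import Data.Nat as ℕ using (ℕ; zero; suc; _!)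
  import Data.Nat.Properties as ℕₚ
  open ℕₚ using (_!≢0)
  open import Data.Product using (_,_; proj₁; proj₂; ∃)
  open import Data.Vec using (Vec; []; _∷_; lookup; map)
  import Data.Vec.Properties as Vecₚ
  open import Function using (_∘_)
  open import Relation.Nullary using (yes; no; contradiction)
  open import Relation.Binary.PropositionalEquality hiding ([_])

  private variable
    A : Set
    n : ℕ

  at : (Fin n → Fin n → Bool) → Perm n → Vec (Fin n) 7 → Fin 7 → Fin 7 → Bool
  at b π s i j = b (to π (lookup s i)) (to π (lookup s j))

  fresh-lookup : ∀ {k} (x : Fin n) (s : Vec (Fin n) k) → fresh x s ≡ true → ∀ i → x ≢ lookup s i
  fresh-lookup x (y ∷ s) f i x≡ with x Finₚ.≟ y
  fresh-lookup x (y ∷ s) () i x≡ | yes _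
  fresh-lookup x (y ∷ s) f zero    x≡ | no x≢y = x≢y x≡
  fresh-lookup x (y ∷ s) f (suc i) x≡ | no x≢y = fresh-lookup x s f i x≡

  lookup-injective : ∀ {k} (s : Vec (Fin n) k) → distinct s ≡ true → ∀ {i j} → lookup s i ≡ lookup s j → i ≡ j
  lookup-injective (x ∷ s) d {i} {j} e with fresh x s in f
  lookup-injective (x ∷ s) d {zero}  {zero}  e | true = refl
  lookup-injective (x ∷ s) d {zero}  {suc j} e | true = contradiction e (fresh-lookup x s f j)
  lookup-injective (x ∷ s) d {suc i} {zero}  e | true = contradiction (sym e) (fresh-lookup x s f i)
  lookup-injective (x ∷ s) d {suc i} {suc j} e | true = cong suc (lookup-injective s d e)

  at-tournament : ∀ {b : Fin n → Fin n → Bool} → IsTournament b → ∀ π s → distinct s ≡ true → IsTournament (at b π s)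
  at-tournament tb π s d = pullback (λ i → to π (lookup s i)) (lookup-injective s d ∘ to-injective π) tb

  opaque
    unfolding permSum
    permSum-swap : ∀ m (xs : List A) (f : A → Perm m → ℤ) → ∑ xs (λ x → permSum m (f x)) ≡ permSum m λ ρ → ∑ xs λ x → f x ρ
    permSum-swap m xs f = ∑-swap xs (perms m) f

    permSum-const : ∀ m c → permSum m (λ _ → c) ≡ + (m !) * c
    permSum-const m c = trans (trans (∑-cong (perms m) λ _ → sym (ℤₚ.*-identityˡ c)) (∑-*ʳ (perms m) c (λ _ → + 1))) (cong (_* c) (length-perms m))

  -- Each of the 7 ! labellings of the block contributes the same sum over relabellings, by
  -- `permSum-term`.
  ∑-form : ∀ r → n ≡ 7 ℕ.+ r → (b : Fin n → Fin n → Bool) (s : Vec (Fin n) 7) → distinct s ≡ true →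
    ∑ (perms n) (λ π → form (at b π s)) ≡ + (7 !) * (+ (r !) * ∑T n 7 (termOf b))
  ∑-form {n} r n≡ b s d = trans (permSum-swap 7 (perms n) λ π ρ → term (at b π s) (starOf ρ))
    (trans (permSum-cong 7 each) (permSum-const 7 (+ (r !) * ∑T n 7 (termOf b))))
    where
    each : ∀ ρ → ∑ (perms n) (λ π → term (at b π s) (starOf ρ)) ≡ + (r !) * ∑T n 7 (termOf b)
    each ρ = trans (∑-cong (perms n) λ π → trans (term-pullback (to π ∘ lookup s) b (map (to ρ) points)) (cong (term b ∘ star) (Vecₚ.map-∘ (to π) (lookup s) (map (to ρ) points))))
      (trans (sym (permSum-def n (λ π → term b (star (map (to π) s′))))) (permSum-term r n≡ b s′
        (trans (distinct-map (lookup s) (lookup-injective s d) (map (to ρ) points)) (trans (distinct-map (to ρ) (to-injective ρ) points) refl))))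
      where s′ = map (lookup s) (map (to ρ) points)

  initial : ∀ {n} r → n ≡ 7 ℕ.+ r → ∃ λ (s : Vec (Fin n) 7) → distinct s ≡ true
  initial r refl = map (_↑ˡ r) points , distinct-map (_↑ˡ r) (↑ˡ-injective r _ _) points

  factorial-falling : ∀ n r → n ≡ 7 ℕ.+ r → + (n !) ≡ + (r !) * falling n 7
  factorial-falling n r n≡ with initial r n≡
  ... | s , s-distinct = trans (sym (length-perms n)) (trans
    (∑-cong (perms n) λ π → cong 𝟙 (sym (trans (distinct-map (to π) (to-injective π) s) s-distinct)))
    (∑-perms-uniform n 7 r n≡ s s-distinct (λ t → 𝟙 (distinct t)) (λ t e → cong 𝟙 e)))

  -- Since `binom` 7 = 21, `power-falling` bounds the repetitions by 1/40001 of all tuples, hence by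
  -- 1/40000 of the distinct ones.
  falling-large : ∀ n → + 40001 * + 21 ≤ + n → (power n 7 - falling n 7) * + 40000 ≤ falling n 7
  falling-large n big = subst₂ _≤_ (minus D F) (drop D F) (ℤₚ.+-monoˡ-≤ (- D) (ℤₚ.*-cancelʳ-≤-pos (D * + 40001) (F + D) (+ 21) chain))
    where
    D F : ℤ
    D = power n 7 - falling n 7
    F = falling n 7
    minus : ∀ D F → D * + 40001 + - D ≡ D * + 40000
    minus = solve-∀
    drop : ∀ D F → F + D + - D ≡ F
    drop = solve-∀
    D≥0 : + 0 ≤ D
    D≥0 = ℤₚ.i≤j⇒0≤j-i (falling≤power n 7)
    instance
      nonneg : NonNegative D
      nonneg = ℤ.nonNegative D≥0
    P≡ : ∀ P F → P ≡ F + (P - F)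
    P≡ = solve-∀
    chain : D * + 40001 * + 21 ≤ (F + D) * + 21
    chain = ℤₚ.≤-trans (ℤₚ.≤-reflexive (ℤₚ.*-assoc D (+ 40001) (+ 21)))
      (ℤₚ.≤-trans (ℤₚ.*-monoˡ-≤-nonNeg D big)
      (ℤₚ.≤-trans (ℤₚ.≤-reflexive (ℤₚ.*-comm D (+ n)))
      (ℤₚ.≤-trans (power-falling n 7) (ℤₚ.≤-reflexive (trans (ℤₚ.*-comm (+ 21) (power n 7)) (cong (_* + 21) (P≡ (power n 7) F)))))))

  -- The error per relabelling is at most 500 · 5040 / 40000 = 63, rounded up to 64; it turns the
  -- constant 116136 into 116200.
  ∑-form-bound : ∀ N r → N ≡ 7 ℕ.+ r → + 40001 * + 21 ≤ + N → (b : Fin N → Fin N → Bool) (s : Vec (Fin N) 7) → distinct s ≡ true →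
    - (+ (N !) * + 64) ≤ ∑ (perms N) λ π → form (at b π s)
  ∑-form-bound N r N≡ big b s d = subst₂ _≤_ (sym (trans (cong (λ z → - (z * + 64)) (factorial-falling N r N≡)) (pull (+ (r !)) F (+ 64))))
      (sym (trans (∑-form r N≡ b s d) (trans (ℤₚ.*-comm (+ (7 !)) _) (ℤₚ.*-assoc (+ (r !)) S (+ (7 !))))))
      (ℤₚ.*-monoˡ-≤-nonNeg (+ (r !)) (ℤₚ.≤-trans fact (ℤₚ.*-monoʳ-≤-nonNeg (+ 5040) (∑T-termOf-bound b))))
    where
    S D F : ℤ
    S = ∑T N 7 (termOf b)
    D = power N 7 - falling N 7
    F = falling N 7
    pull : ∀ r F c → - (r * F * c) ≡ r * - (F * c)
    pull = solve-∀
    instance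
      nonneg : NonNegative D
      nonneg = ℤ.nonNegative (ℤₚ.i≤j⇒0≤j-i (falling≤power N 7))
    fact : - (F * + 64) ≤ - (D * + 500) * + 5040
    fact = subst (- (F * + 64) ≤_) (assoc D (+ 500) (+ 5040)) (ℤₚ.neg-mono-≤
      (ℤₚ.≤-trans (ℤₚ.*-monoˡ-≤-nonNeg D {+ 500 * + 5040} {+ 40000 * + 64} (fromDoes (+ 500 * + 5040 ≤? + 40000 * + 64) refl))
        (ℤₚ.≤-trans (ℤₚ.≤-reflexive (sym (ℤₚ.*-assoc D (+ 40000) (+ 64)))) (ℤₚ.*-monoʳ-≤-nonNeg (+ 64) (falling-large N big)))))
      where
      assoc : ∀ D a b → - (D * (a * b)) ≡ - (D * a) * b
      assoc = solve-∀

  module _ {B : Set} (N r : ℕ) (N≡ : N ≡ 7 ℕ.+ r) (big : + 40001 * + 21 ≤ + N) (good : ∀ (b : Fin 7 → Fin 7 → Bool) → IsTournament b → Good b)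
    (b : Fin N → Fin N → Bool) (tb : IsTournament b)
    (bs : List B) (p : B → Bool) (s : B → Vec (Fin N) 7) (ds : ∀ β → p β ≡ true → distinct (s β) ≡ true) where
    private

      Choice : Perm N → B → Set
      Choice π β = ∃ λ σ → 𝟙 (p β) * (steinerCost (at b π (s β)) σ * + 21732) ≤ 𝟙 (p β) * (+ 116136 - form (at b π (s β)))

      choose : ∀ π β → Choice π β
      choose π β = go (p β) refl
        where
        move : ∀ c f → c * + 21732 + f ≤ + 116136 → c * + 21732 ≤ + 116136 - f
        move c f le = subst (_≤ + 116136 - f) (drop (c * + 21732) f) (ℤₚ.+-monoˡ-≤ (- f) le)
          where
          drop : ∀ a f → a + f + - f ≡ a
          drop = solve-∀
        go : ∀ d → p β ≡ d → ∃ λ σ → 𝟙 d * (steinerCost (at b π (s β)) σ * + 21732) ≤ 𝟙 d * (+ 116136 - form (at b π (s β)))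
        -- An improper block has weight zero, so its plane is a placeholder.
        go false _  = fano , ℤₚ.≤-reflexive (trans (ℤₚ.*-zeroˡ (steinerCost (at b π (s β)) fano * + 21732)) (sym (ℤₚ.*-zeroˡ (+ 116136 - form (at b π (s β))))))
        go true  pβ with good (at b π (s β)) (at-tournament tb π (s β) (ds β pβ))
        ... | σ , le = σ , ℤₚ.*-monoˡ-≤-nonNeg (+ 1) (move (steinerCost (at b π (s β)) σ) (form (at b π (s β))) le)

      cost : Perm N → B → ℤ
      cost π β = 𝟙 (p β) * steinerCost (at b π (s β)) (proj₁ (choose π β))

      W : ℤ
      W = ∑ bs λ β → 𝟙 (p β)

      per-block : ∀ β → ∑ (perms N) (λ π → 𝟙 (p β) * (+ 116136 - form (at b π (s β)))) ≤ 𝟙 (p β) * (+ (N !) * + 116200)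
      per-block β = subst (_≤ 𝟙 (p β) * (+ (N !) * + 116200)) (sym (trans (∑-*ˡ (perms N) (𝟙 (p β)) (λ π → + 116136 - form (at b π (s β))))
          (cong (𝟙 (p β) *_) (trans (∑-- (perms N) (λ _ → + 116136) (λ π → form (at b π (s β)))) (cong (λ z → z - Φ) all))))) (go (p β) refl)
        where
        Φ : ℤ
        Φ = ∑ (perms N) λ π → form (at b π (s β))
        all : ∑ (perms N) (λ _ → + 116136) ≡ + (N !) * + 116136
        all = trans (∑-cong (perms N) λ _ → sym (ℤₚ.*-identityˡ (+ 116136))) (trans (∑-*ʳ (perms N) (+ 116136) (λ _ → + 1)) (cong (_* + 116136) (length-perms N)))
        combine : ∀ m f → m * + 116136 - (- (m * + 64)) ≡ m * + 116200
        combine = solve-∀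
        go : ∀ d → p β ≡ d → 𝟙 d * (+ (N !) * + 116136 - Φ) ≤ 𝟙 d * (+ (N !) * + 116200)
        go false _ = ℤₚ.≤-reflexive (trans (ℤₚ.*-zeroˡ (+ (N !) * + 116136 - Φ)) (sym (ℤₚ.*-zeroˡ (+ (N !) * + 116200))))
        go true pβ = ℤₚ.*-monoˡ-≤-nonNeg (+ 1) (subst (+ (N !) * + 116136 - Φ ≤_) (combine (+ (N !)) Φ)
          (ℤₚ.+-monoʳ-≤ (+ (N !) * + 116136) (ℤₚ.neg-mono-≤ (∑-form-bound N r N≡ big b (s β) (ds β pβ)))))

      total : ∑ (perms N) (λ π → ∑ bs (cost π) * + 21732) ≤ ∑ (perms N) (λ _ → W * + 116200)
      total = ℤₚ.≤-trans (∑-mono (perms N) λ π → subst (_≤ ∑ bs (λ β → 𝟙 (p β) * (+ 116136 - form (at b π (s β)))))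
            (trans (∑-cong bs λ β → sym (ℤₚ.*-assoc (𝟙 (p β)) (steinerCost (at b π (s β)) (proj₁ (choose π β))) (+ 21732))) (∑-*ʳ bs (+ 21732) (cost π)))
            (∑-mono bs λ β → proj₂ (choose π β)))
        (ℤₚ.≤-trans (ℤₚ.≤-reflexive (∑-swap (perms N) bs λ π β → 𝟙 (p β) * (+ 116136 - form (at b π (s β)))))
        (ℤₚ.≤-trans (∑-mono bs per-block) (ℤₚ.≤-reflexive
          (trans (∑-*ʳ bs (+ (N !) * + 116200) (λ β → 𝟙 (p β))) (trans (rearrange W (+ (N !)) (+ 116200))
            (sym (trans (∑-cong (perms N) λ _ → sym (ℤₚ.*-identityˡ (W * + 116200))) (trans (∑-*ʳ (perms N) (W * + 116200) (λ _ → + 1)) (cong (_* (W * + 116200)) (length-perms N))))))))))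
        where
        rearrange : ∀ w m c → w * (m * c) ≡ m * (w * c)
        rearrange = solve-∀

      nonempty : ∀ m → perms m ≢ []
      nonempty m e = ℕ.≢-nonZero⁻¹ (m !) {{m!≢0}} (ℤₚ.+-injective (trans (sym (length-perms m)) (cong (λ ps → ∑ ps (λ _ → + 1)) e)))
        where
        m!≢0 : ℕ.NonZero (m !)
        m!≢0 = m !≢0

    -- The best plane is chosen for every relabelling and block separately. The mean of the total
    -- cost over all relabellings obeys the bound, hence so does the cost of some relabelling.
    good-relabelling : ∃ λ π → ∃ λ (σ : B → Steiner (Fin 7)) →
      ∑ bs (λ β → 𝟙 (p β) * steinerCost (at b π (s β)) (σ β)) * + 21732 ≤ ∑ bs (λ β → 𝟙 (p β)) * + 116200
    good-relabelling = proj₁ best , (λ β → proj₁ (choose (proj₁ best) β)) , proj₂ best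
      where
      best : ∃ λ π → ∑ bs (cost π) * + 21732 ≤ W * + 116200
      best = ∑-exists (perms N) (λ π → ∑ bs (cost π) * + 21732) (W * + 116200) (nonempty N) total

-- The ring of residues modulo m

module Residues where

  open import Algebra.Bundles using (CommutativeRing)
  open import Data.Fin using (Fin; toℕ; fromℕ<)
  open import Data.Fin.Properties using (toℕ<n; toℕ-injective; toℕ-fromℕ<)
  open import Data.Integer as ℤ using (ℤ; +_; _+_; _*_; -_; _-_; ∣_∣)
  open import Data.Integer.DivMod using (_%ℕ_; _/ℕ_; n%ℕd<d; a≡a%ℕn+[a/ℕn]*n)
  import Data.Integer.Properties as ℤₚ
  open import Data.Integer.Tactic.RingSolver using (solve-∀)
  open import Data.Nat as ℕ using (ℕ; zero; suc)
  open import Data.Nat.Divisibility as ℕ∣ using (divides)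
  import Data.Nat.Properties as ℕₚ
  open import Data.Product using (_,_; ∃)
  open import Level using (0ℓ)
  open import Relation.Nullary using (contradiction)
  open import Relation.Binary.PropositionalEquality

  module _ (m : ℕ) .{{_ : ℕ.NonZero m}} where

    infix 4 _≈_
    _≈_ : ℤ → ℤ → Set
    a ≈ b = ∃ λ q → a - b ≡ q * + m

    opaque
      cls : ℤ → Fin m
      cls a = fromℕ< (n%ℕd<d a m)

      rep-cls : ∀ a → + toℕ (cls a) ≈ a
      rep-cls a = - (a /ℕ m) , trans (cong (λ z → + z - a) (toℕ-fromℕ< (n%ℕd<d a m)))
        (trans (cong (λ z → + (a %ℕ m) - z) (a≡a%ℕn+[a/ℕn]*n a m)) (cancel (+ (a %ℕ m)) (a /ℕ m) (+ m)))
        where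
        cancel : ∀ r q m → r - (r + q * m) ≡ - q * m
        cancel = solve-∀

    rep : Fin m → ℤ
    rep x = + toℕ x

    -- Two representatives differ by less than m in absolute value, and the only such multiple of m
    -- is zero.
    rep-unique : ∀ x y → rep x ≈ rep y → x ≡ y
    rep-unique x y (q , e) = toℕ-injective (ℤₚ.+-injective (ℤₚ.i-j≡0⇒i≡j (rep x) (rep y) (ℤₚ.∣i∣≡0⇒i≡0 small)))
      where
      d : ℕ
      d = ∣ rep x - rep y ∣
      d<m : d ℕ.< m
      d<m = subst (ℕ._< m) (sym (trans (cong ∣_∣ (ℤₚ.m-n≡m⊖n (toℕ x) (toℕ y))) refl)) (bound (toℕ x) (toℕ y) (toℕ<n x) (toℕ<n y))
        where
        bound : ∀ a b → a ℕ.< m → b ℕ.< m → ∣ a ℤ.⊖ b ∣ ℕ.< m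
        bound a b a<m b<m = ℕₚ.≤-<-trans (ℤₚ.∣m⊝n∣≤m⊔n a b) (ℕₚ.⊔-lub a<m b<m)
      m∣d : m ℕ∣.∣ d
      m∣d = divides ∣ q ∣ (trans (cong ∣_∣ e) (ℤₚ.abs-* q (+ m)))
      small : d ≡ 0
      small with d in eq
      ... | zero  = refl
      ... | suc k = contradiction (subst (m ℕ∣.∣_) eq m∣d) (ℕ∣.>⇒∤ (subst (ℕ._< m) eq d<m))

    ≈-sym : ∀ {a b} → a ≈ b → b ≈ a
    ≈-sym {a} {b} (q , e) = - q , trans (flip a b) (trans (cong -_ e) (ℤₚ.neg-distribˡ-* q (+ m)))
      where
      flip : ∀ a b → b - a ≡ - (a - b)
      flip = solve-∀

    ≈-trans : ∀ {a b c} → a ≈ b → b ≈ c → a ≈ c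
    ≈-trans {a} {b} {c} (q , e) (r , f) = q + r , trans (split a b c) (trans (cong₂ _+_ e f) (sym (ℤₚ.*-distribʳ-+ (+ m) q r)))
      where
      split : ∀ a b c → a - c ≡ (a - b) + (b - c)
      split = solve-∀

    cls-cong : ∀ {a b} → a ≈ b → cls a ≡ cls b
    cls-cong {a} {b} a≈b = rep-unique (cls a) (cls b)
      (≈-trans {rep (cls a)} {a} {rep (cls b)} (rep-cls a) (≈-trans {a} {b} {rep (cls b)} a≈b (≈-sym {rep (cls b)} {b} (rep-cls b))))

    cls-rep : ∀ x → cls (rep x) ≡ x
    cls-rep x = rep-unique (cls (rep x)) x (rep-cls (rep x))

    infixl 6 _⊞_
    infixl 7 _⊠_
    _⊞_ _⊠_ : Fin m → Fin m → Fin m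
    x ⊞ y = cls (rep x + rep y)
    x ⊠ y = cls (rep x * rep y)

    ⊟_ : Fin m → Fin m
    ⊟ x = cls (- rep x)

    cls-+ : ∀ a b → cls a ⊞ cls b ≡ cls (a + b)
    cls-+ a b with rep-cls a | rep-cls b
    ... | q , e | r , f = cls-cong (q + r , trans (split (rep (cls a)) a (rep (cls b)) b) (trans (cong₂ _+_ e f) (sym (ℤₚ.*-distribʳ-+ (+ m) q r))))
      where
      split : ∀ a′ a b′ b → (a′ + b′) - (a + b) ≡ (a′ - a) + (b′ - b)
      split = solve-∀

    cls-* : ∀ a b → cls a ⊠ cls b ≡ cls (a * b)
    cls-* a b with rep-cls a | rep-cls b
    ... | q , e | r , f = cls-cong (q * rep (cls b) + a * r , trans (split (rep (cls a)) a (rep (cls b)) b)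
        (trans (cong₂ (λ s t → s * rep (cls b) + a * t) e f) (collect q (rep (cls b)) a r (+ m))))
      where
      split : ∀ a′ a b′ b → a′ * b′ - a * b ≡ (a′ - a) * b′ + a * (b′ - b)
      split = solve-∀
      collect : ∀ q b a r m → q * m * b + a * (r * m) ≡ (q * b + a * r) * m
      collect = solve-∀

    cls-neg : ∀ a → ⊟ cls a ≡ cls (- a)
    cls-neg a with rep-cls a
    ... | q , e = cls-cong (- q , trans (flip (rep (cls a)) a) (trans (cong -_ e) (ℤₚ.neg-distribˡ-* q (+ m))))
      where
      flip : ∀ a b → - a - (- b) ≡ - (a - b)
      flip = solve-∀

    -- Each law is a law of ℤ applied to representatives and pushed through `cls`.
    ring : CommutativeRing 0ℓ 0ℓ
    ring = record
      { Carrier = Fin m ; _≈_ = _≡_ ; _+_ = _⊞_ ; _*_ = _⊠_ ; -_ = ⊟_ ; 0# = cls (+ 0) ; 1# = cls (+ 1)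
      ; isCommutativeRing = record
        { isRing = record
          { +-isAbelianGroup = record
            { isGroup = record
              { isMonoid = record
                { isSemigroup = record
                  { isMagma = record { isEquivalence = isEquivalence ; ∙-cong = cong₂ _⊞_ }
                  ; assoc = λ x y z → trans (cong (cls (rep x + rep y) ⊞_) (sym (cls-rep z))) (trans (cls-+ (rep x + rep y) (rep z))
                      (trans (cong cls (ℤₚ.+-assoc (rep x) (rep y) (rep z))) (trans (sym (cls-+ (rep x) (rep y + rep z))) (cong (_⊞ cls (rep y + rep z)) (cls-rep x)))))
                  }
                ; identity = (λ x → trans (comm⊞ (cls (+ 0)) x) (idʳ x)) , idʳ
                }
              ; inverse = (λ x → trans (comm⊞ (⊟ x) x) (invʳ x)) , invʳ
              ; ⁻¹-cong = cong ⊟_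
              }
            ; comm = comm⊞
            }
          ; *-cong = cong₂ _⊠_
          ; *-assoc = λ x y z → trans (cong (cls (rep x * rep y) ⊠_) (sym (cls-rep z))) (trans (cls-* (rep x * rep y) (rep z))
              (trans (cong cls (ℤₚ.*-assoc (rep x) (rep y) (rep z))) (trans (sym (cls-* (rep x) (rep y * rep z))) (cong (_⊠ cls (rep y * rep z)) (cls-rep x)))))
          ; *-identity = (λ x → trans (comm⊠ (cls (+ 1)) x) (oneʳ x)) , oneʳ
          ; distrib = distribˡ , λ x y z → trans (comm⊠ (y ⊞ z) x) (trans (distribˡ x y z) (cong₂ _⊞_ (comm⊠ x y) (comm⊠ x z)))
          }
        ; *-comm = comm⊠
        }
      }
      where
      comm⊞ : ∀ x y → x ⊞ y ≡ y ⊞ x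
      comm⊞ x y = cong cls (ℤₚ.+-comm (rep x) (rep y))
      comm⊠ : ∀ x y → x ⊠ y ≡ y ⊠ x
      comm⊠ x y = cong cls (ℤₚ.*-comm (rep x) (rep y))
      idʳ : ∀ x → x ⊞ cls (+ 0) ≡ x
      idʳ x = trans (cong (_⊞ cls (+ 0)) (sym (cls-rep x))) (trans (cls-+ (rep x) (+ 0)) (trans (cong cls (ℤₚ.+-identityʳ (rep x))) (cls-rep x)))
      invʳ : ∀ x → x ⊞ (⊟ x) ≡ cls (+ 0)
      invʳ x = trans (cong (_⊞ (⊟ x)) (sym (cls-rep x))) (trans (cls-+ (rep x) (- rep x)) (cong cls (ℤₚ.+-inverseʳ (rep x))))
      oneʳ : ∀ x → x ⊠ cls (+ 1) ≡ x
      oneʳ x = trans (cong (_⊠ cls (+ 1)) (sym (cls-rep x))) (trans (cls-* (rep x) (+ 1)) (trans (cong cls (ℤₚ.*-identityʳ (rep x))) (cls-rep x)))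
      distribˡ : ∀ x y z → x ⊠ (y ⊞ z) ≡ (x ⊠ y) ⊞ (x ⊠ z)
      distribˡ x y z = trans (cong (_⊠ (y ⊞ z)) (sym (cls-rep x))) (trans (cls-* (rep x) (rep y + rep z))
        (trans (cong cls (ℤₚ.*-distribˡ-+ (rep x) (rep y) (rep z))) (sym (cls-+ (rep x * rep y) (rep x * rep z)))))

-- The constructions of Bose and Skolem

module BoseSkolem where

  open SteinerSystems
  open import Data.Bool using (Bool; true; false)
  open import Data.Fin using (Fin)
  open import Data.Fin.Patterns
  open import Data.Product using (_×_; _,_; proj₁)
  open import Data.Sum using (_⊎_; inj₁; inj₂)
  open import Data.Unit using (⊤; tt)
  open import Relation.Binary using (DecidableEquality)
  open import Relation.Nullary using (yes; no; contradiction)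
  open import Relation.Binary.PropositionalEquality

  record CommutativeQuasigroup (Q : Set) : Set where
    infixl 7 _·_ _\\_
    infix 4 _≟_
    field
      _≟_    : DecidableEquality Q
      _·_    : Q → Q → Q
      _\\_   : Q → Q → Q
      ·-comm : ∀ x y → x · y ≡ y · x
      \\-·   : ∀ x y → x \\ (x · y) ≡ y
      ·-\\   : ∀ x y → x · (x \\ y) ≡ y

    swap-\\ : ∀ x y → (x \\ y) \\ y ≡ x
    swap-\\ x y = trans (cong ((x \\ y) \\_) (trans (sym (·-\\ x y)) (·-comm x (x \\ y)))) (\\-· (x \\ y) x)

  next third : Fin 3 → Fin 3
  next 0F = 1F
  next 1F = 2F
  next 2F = 0F
  third i = next (next i)

  next³ : ∀ i → next (third i) ≡ i
  next³ 0F = refl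
  next³ 1F = refl
  next³ 2F = refl

  third² : ∀ i → third (third i) ≡ next i
  third² i = cong next (next³ i)

  data Levels : Fin 3 → Fin 3 → Set where
    level : ∀ i → Levels i i
    up    : ∀ i → Levels i (next i)
    down  : ∀ i → Levels (next i) i

  levels : ∀ i j → Levels i j
  levels 0F 0F = level 0F
  levels 0F 1F = up 0F
  levels 0F 2F = down 2F
  levels 1F 0F = down 0F
  levels 1F 1F = level 1F
  levels 1F 2F = up 1F
  levels 2F 0F = up 2F
  levels 2F 1F = down 1F
  levels 2F 2F = level 2F

  thirdLevel : ∀ {i j} → Levels i j → Fin 3
  thirdLevel (level i) = i
  thirdLevel (up i)    = third i
  thirdLevel (down i)  = third i

  -- Bose's construction, from an idempotent commutative quasigroup.
  module Bose {Q : Set} (quasi : CommutativeQuasigroup Q) (·-idem : ∀ x → CommutativeQuasigroup._·_ quasi x x ≡ x) where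
    open CommutativeQuasigroup quasi

    Pt : Set
    Pt = Q × Fin 3

    -- The triples are (x,i), (y,i), (x·y,i+1) for x ≠ y, and the fibres (x,0), (x,1), (x,2). `flat`
    -- completes a pair on one level, `rise` a pair whose second point lies one level higher.
    flat rise : Fin 3 → Q → Q → Pt
    flat i x y with x ≟ y
    ... | yes _ = x , i
    ... | no _  = x · y , next i
    rise i x y with x ≟ y
    ... | yes _ = x , third i
    ... | no _  = x \\ y , i

    opAt : ∀ {i j} → Levels i j → Q → Q → Pt
    opAt (level i) x y = flat i x y
    opAt (up i)    x y = rise i x y
    opAt (down i)  x y = rise i y x

    op : Pt → Pt → Pt
    op (x , i) (y , j) = opAt (levels i j) x y

    op-level : ∀ i x y → op (x , i) (y , i) ≡ flat i x y
    op-level 0F x y = refl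
    op-level 1F x y = refl
    op-level 2F x y = refl
    op-up : ∀ i x y → op (x , i) (y , next i) ≡ rise i x y
    op-up 0F x y = refl
    op-up 1F x y = refl
    op-up 2F x y = refl
    op-down : ∀ i x y → op (x , next i) (y , i) ≡ rise i y x
    op-down 0F x y = refl
    op-down 1F x y = refl
    op-down 2F x y = refl
    op-third : ∀ i x y → op (x , i) (y , third i) ≡ rise (third i) y x
    op-third 0F x y = refl
    op-third 1F x y = refl
    op-third 2F x y = refl

    flat-≢ : ∀ i {x y} → x ≢ y → flat i x y ≡ (x · y , next i)
    flat-≢ i {x} {y} x≢y with x ≟ y
    ... | yes x≡y = contradiction x≡y x≢y
    ... | no _    = refl
    rise-≢ : ∀ i {x y} → x ≢ y → rise i x y ≡ (x \\ y , i)
    rise-≢ i {x} {y} x≢y with x ≟ y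
    ... | yes x≡y = contradiction x≡y x≢y
    ... | no _    = refl
    rise-≡ : ∀ i x → rise i x x ≡ (x , third i)
    rise-≡ i x with x ≟ x
    ... | yes _  = refl
    ... | no x≢x = contradiction refl x≢x

    ≡-·⇒≡ : ∀ {x y} → x ≡ x · y → x ≡ y
    ≡-·⇒≡ {x} {y} e = trans (sym (\\-· x x)) (trans (cong (x \\_) (trans (·-idem x) e)) (\\-· x y))

    ≡-\\⇒≡ : ∀ {x y} → x ≡ x \\ y → x ≡ y
    ≡-\\⇒≡ {x} {y} e = trans (sym (·-idem x)) (trans (cong (x ·_) e) (·-\\ x y))

    \\-≡⇒≡ : ∀ {x y} → x \\ y ≡ y → x ≡ y
    \\-≡⇒≡ {x} {y} e = trans (trans (sym (\\-· y x)) (cong (y \\_) (trans (·-comm y x) (trans (cong (x ·_) (sym e)) (trans (·-\\ x y) (sym (·-idem y))))))) (\\-· y y)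

    op-idem : ∀ p → op p p ≡ p
    op-idem (x , i) rewrite op-level i x x with x ≟ x
    ... | yes _  = refl
    ... | no x≢x = contradiction refl x≢x

    flat-comm : ∀ i x y → flat i x y ≡ flat i y x
    flat-comm i x y with x ≟ y | y ≟ x
    ... | yes x≡y | yes _  = cong (_, i) x≡y
    ... | yes x≡y | no y≢x = contradiction (sym x≡y) y≢x
    ... | no x≢y  | yes y≡x = contradiction (sym y≡x) x≢y
    ... | no _    | no _   = cong (_, next i) (·-comm x y)

    op-comm : ∀ p q → op p q ≡ op q p
    op-comm (x , i) (y , j) with levels i j
    ... | level .i = trans (flat-comm i x y) (sym (op-level i y x))
    ... | up .i    = sym (op-down i y x)
    ... | down .j  = sym (op-up j y x)

    op-cancel : ∀ p q → op p (op p q) ≡ q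
    op-cancel (x , i) (y , j) with levels i j
    op-cancel (x , i) (y , .i) | level .i with x ≟ y
    ... | yes refl = op-idem (x , i)
    ... | no x≢y   = trans (op-up i x (x · y)) (trans (rise-≢ i (λ e → x≢y (≡-·⇒≡ e))) (cong (_, i) (\\-· x y)))
    op-cancel (x , i) (y , .(next i)) | up .i with x ≟ y
    ... | yes refl = trans (op-third i x x) (trans (rise-≡ (third i) x) (cong (x ,_) (third² i)))
    ... | no x≢y   = trans (op-level i x (x \\ y)) (trans (flat-≢ i (λ e → x≢y (≡-\\⇒≡ e))) (cong (_, next i) (·-\\ x y)))
    op-cancel (x , .(next j)) (y , j) | down .j with y ≟ x
    ... | yes refl = trans (op-up (next j) x x) (trans (rise-≡ (next j) x) (cong (x ,_) (next³ j)))
    ... | no y≢x   = trans (op-down j x (y \\ x)) (trans (rise-≢ j (λ e → y≢x (\\-≡⇒≡ e))) (cong (_, j) (swap-\\ y x)))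

    steiner : Steiner Pt
    steiner = record { _∙_ = op ; idem = op-idem ; comm = op-comm ; cancel = op-cancel }

    -- Hence a triple that meets two fibres meets three, so that after doubling the fibres can serve
    -- as groups.
    op-apart : ∀ {x y} i j → x ≢ y → proj₁ (op (x , i) (y , j)) ≢ x
    op-apart {x} {y} i j x≢y e with levels i j
    ... | level .i = x≢y (≡-·⇒≡ (sym (trans (sym (cong proj₁ (flat-≢ i x≢y))) e)))
    ... | up .i    = x≢y (≡-\\⇒≡ (sym (trans (sym (cong proj₁ (rise-≢ i x≢y))) e)))
    ... | down .j  = x≢y (sym (\\-≡⇒≡ (trans (sym (cong proj₁ (rise-≢ j (λ y≡x → x≢y (sym y≡x))))) e)))

    -- A fibre is a subsystem whose product depends on the levels only; `tailed₃` takes one fibre as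
    -- the tail common to all orders.
    op-fibre : ∀ x i j → op (x , i) (x , j) ≡ (x , thirdLevel (levels i j))
    op-fibre x i j with levels i j
    op-fibre x i .i | level .i with x ≟ x
    ... | yes _  = refl
    ... | no x≢x = contradiction refl x≢x
    op-fibre x i .(next i) | up .i = rise-≡ i x
    op-fibre x .(next j) j | down .j = rise-≡ j x

  -- Skolem's construction, from a half-idempotent commutative quasigroup on
  -- Bool × J, in which (b , j) · (b , j) = (false , j).
  module Skolem {J : Set} (quasi : CommutativeQuasigroup (Bool × J))
    (·-half : ∀ b j → CommutativeQuasigroup._·_ quasi (b , j) (b , j) ≡ (false , j)) where
    open CommutativeQuasigroup quasi

    Q Pt : Set
    Q  = Bool × J
    Pt = (Q × Fin 3) ⊎ ⊤

    pt : Q → Fin 3 → Pt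
    pt x i = inj₁ (x , i)

    -- The pair (x,i), (x·x,i+1) lies on no triple of `flat`. In the lower half x·x = x and a fibre
    -- is its triple; in the upper half the third point of (true,j) at level i and (false,j) at
    -- level i+1 is the point at infinity.
    apex : Fin 3 → Q → Pt
    apex i (false , j) = pt (false , j) (third i)
    apex i (true  , j) = inj₂ tt

    flat rise : Fin 3 → Q → Q → Pt
    flat i x y with x ≟ y
    ... | yes _ = pt x i
    ... | no _  = pt (x · y) (next i)
    rise i x y with x \\ y ≟ x
    ... | yes _ = apex i x
    ... | no _  = pt (x \\ y) i

    opAt : ∀ {i j} → Levels i j → Q → Q → Pt
    opAt (level i) x y = flat i x y
    opAt (up i)    x y = rise i x y
    opAt (down i)  x y = rise i y x

    with∞ : Q → Fin 3 → Pt
    with∞ (false , j) i = pt (true , j) (third i)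
    with∞ (true  , j) i = pt (false , j) (next i)

    op : Pt → Pt → Pt
    op (inj₁ (x , i)) (inj₁ (y , j)) = opAt (levels i j) x y
    op (inj₁ (x , i)) (inj₂ _)       = with∞ x i
    op (inj₂ _)       (inj₁ (y , j)) = with∞ y j
    op (inj₂ _)       (inj₂ _)       = inj₂ tt

    op-level : ∀ i x y → op (pt x i) (pt y i) ≡ flat i x y
    op-level 0F x y = refl
    op-level 1F x y = refl
    op-level 2F x y = refl
    op-up : ∀ i x y → op (pt x i) (pt y (next i)) ≡ rise i x y
    op-up 0F x y = refl
    op-up 1F x y = refl
    op-up 2F x y = refl
    op-down : ∀ i x y → op (pt x (next i)) (pt y i) ≡ rise i y x
    op-down 0F x y = refl
    op-down 1F x y = refl
    op-down 2F x y = refl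
    op-third : ∀ i x y → op (pt x i) (pt y (third i)) ≡ rise (third i) y x
    op-third 0F x y = refl
    op-third 1F x y = refl
    op-third 2F x y = refl

    flat-≢ : ∀ i {x y} → x ≢ y → flat i x y ≡ pt (x · y) (next i)
    flat-≢ i {x} {y} x≢y with x ≟ y
    ... | yes x≡y = contradiction x≡y x≢y
    ... | no _    = refl
    rise-≢ : ∀ i {x y} → x \\ y ≢ x → rise i x y ≡ pt (x \\ y) i
    rise-≢ i {x} {y} ne with x \\ y ≟ x
    ... | yes e = contradiction e ne
    ... | no _  = refl
    rise-low : ∀ i j → rise i (false , j) (false , j) ≡ pt (false , j) (third i)
    rise-low i j with (false , j) \\ (false , j) ≟ (false , j)
    ... | yes _ = refl
    ... | no ne = contradiction (trans (cong ((false , j) \\_) (sym (·-half false j))) (\\-· (false , j) (false , j))) ne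

    square : ∀ {b j y} → (b , j) \\ y ≡ (b , j) → y ≡ (false , j)
    square {b} {j} {y} e = trans (sym (·-\\ (b , j) y)) (trans (cong ((b , j) ·_) e) (·-half b j))

    op-idem : ∀ p → op p p ≡ p
    op-idem (inj₂ _) = refl
    op-idem (inj₁ (x , i)) rewrite op-level i x x with x ≟ x
    ... | yes _  = refl
    ... | no x≢x = contradiction refl x≢x

    flat-comm : ∀ i x y → flat i x y ≡ flat i y x
    flat-comm i x y with x ≟ y | y ≟ x
    ... | yes x≡y | yes _  = cong (λ z → pt z i) x≡y
    ... | yes x≡y | no y≢x = contradiction (sym x≡y) y≢x
    ... | no x≢y  | yes y≡x = contradiction (sym y≡x) x≢y
    ... | no _    | no _   = cong (λ z → pt z (next i)) (·-comm x y)

    op-comm : ∀ p q → op p q ≡ op q p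
    op-comm (inj₂ _) (inj₂ _) = refl
    op-comm (inj₂ _) (inj₁ _) = refl
    op-comm (inj₁ _) (inj₂ _) = refl
    op-comm (inj₁ (x , i)) (inj₁ (y , j)) with levels i j
    ... | level .i = trans (flat-comm i x y) (sym (op-level i y x))
    ... | up .i    = sym (op-down i y x)
    ... | down .j  = sym (op-up j y x)

    op-cancel : ∀ p q → op p (op p q) ≡ q
    op-cancel (inj₂ _) (inj₂ _) = refl
    op-cancel (inj₂ _) (inj₁ ((false , j) , i)) = cong (pt (false , j)) (next³ i)
    op-cancel (inj₂ _) (inj₁ ((true  , j) , i)) = cong (pt (true , j)) (next³ i)
    op-cancel (inj₁ ((false , j) , i)) (inj₂ _) rewrite op-third i (false , j) (true , j)
      with (true , j) \\ (false , j) ≟ (true , j)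
    ... | yes _ = refl
    ... | no ne = contradiction (trans (cong ((true , j) \\_) (sym (·-half true j))) (\\-· (true , j) (true , j))) ne
    op-cancel (inj₁ ((true , j) , i)) (inj₂ _) rewrite op-up i (true , j) (false , j)
      with (true , j) \\ (false , j) ≟ (true , j)
    ... | yes _ = refl
    ... | no ne = contradiction (trans (cong ((true , j) \\_) (sym (·-half true j))) (\\-· (true , j) (true , j))) ne
    op-cancel (inj₁ (x , i)) (inj₁ (y , j)) with levels i j
    op-cancel (inj₁ (x , i)) (inj₁ (y , .i)) | level .i with x ≟ y
    ... | yes refl = op-idem (pt x i)
    ... | no x≢y   = trans (op-up i x (x · y)) (trans (rise-≢ i (λ e → x≢y (trans (sym e) (\\-· x y)))) (cong (λ z → pt z i) (\\-· x y)))
    op-cancel (inj₁ (x , i)) (inj₁ (y , .(next i))) | up .i with x \\ y ≟ x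
    op-cancel (inj₁ ((false , j) , i)) (inj₁ (y , .(next i))) | up .i | yes e with refl ← square e =
      trans (op-third i (false , j) (false , j)) (trans (rise-low (third i) j) (cong (pt (false , j)) (third² i)))
    op-cancel (inj₁ ((true , j) , i)) (inj₁ (y , .(next i))) | up .i | yes e = cong (λ z → pt z (next i)) (sym (square e))
    op-cancel (inj₁ (x , i)) (inj₁ (y , .(next i))) | up .i | no ne =
      trans (op-level i x (x \\ y)) (trans (flat-≢ i (λ e → ne (sym e))) (cong (λ z → pt z (next i)) (·-\\ x y)))
    op-cancel (inj₁ (x , .(next j))) (inj₁ (y , j)) | down .j with y \\ x ≟ y
    op-cancel (inj₁ (x , .(next j))) (inj₁ ((false , k) , j)) | down .j | yes e with refl ← square e =
      trans (op-up (next j) (false , k) (false , k)) (trans (rise-low (next j) k) (cong (pt (false , k)) (next³ j)))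
    op-cancel (inj₁ (x , .(next j))) (inj₁ ((true , k) , j)) | down .j | yes e with refl ← square e =
      cong (pt (true , k)) (next³ j)
    op-cancel (inj₁ (x , .(next j))) (inj₁ (y , j)) | down .j | no ne =
      trans (op-down j x (y \\ x)) (trans (rise-≢ j (λ e → ne (trans (sym e) (swap-\\ y x)))) (cong (λ z → pt z j) (swap-\\ y x)))

    steiner : Steiner Pt
    steiner = record { _∙_ = op ; idem = op-idem ; comm = op-comm ; cancel = op-cancel }

-- Commutative quasigroups from residues

module Quasigroups where

  open BoseSkolem
  open Residues
  open import Algebra.Bundles using (CommutativeRing)
  open import Data.Bool using (Bool; true; false)
  import Data.Bool.Properties as Boolₚ
  open import Data.Fin using (Fin; suc; toℕ; combine; remQuot; cast)
  open import Data.Fin.Patterns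
  import Data.Fin.Properties as Finₚ
  open import Data.Integer as ℤ using (ℤ; +_)
  import Data.Integer.Properties as ℤₚ
  import Data.Integer.Tactic.RingSolver as ℤSolver
  open import Data.Nat as ℕ using (ℕ; suc)
  import Data.Nat.Properties as ℕₚ
  open import Data.Product using (_×_; _,_; proj₁; proj₂)
  open import Data.Product.Properties using (≡-dec)
  open import Data.Vec using (Vec; []; _∷_; lookup; map)
  import Data.Vec.Properties as Vecₚ
  open import Relation.Binary.PropositionalEquality

  -- A polynomial identity over ℤ holds modulo every m. Reflecting both sides lets `identity` carry
  -- it over from the representatives.
  data Expr (n : ℕ) : Set where
    var        : Fin n → Expr n
    _:+_ _:*_  : Expr n → Expr n → Expr n
    :-_        : Expr n → Expr n

  infixl 6 _:+_
  infixl 7 _:*_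
  infix 8 :-_

  ⟦_⟧ℤ : ∀ {n} → Expr n → Vec ℤ n → ℤ
  ⟦ var i ⟧ℤ  ρ = lookup ρ i
  ⟦ e :+ f ⟧ℤ ρ = ⟦ e ⟧ℤ ρ ℤ.+ ⟦ f ⟧ℤ ρ
  ⟦ e :* f ⟧ℤ ρ = ⟦ e ⟧ℤ ρ ℤ.* ⟦ f ⟧ℤ ρ
  ⟦ :- e ⟧ℤ   ρ = ℤ.- ⟦ e ⟧ℤ ρ

  module RingIdentities (m : ℕ) .{{_ : ℕ.NonZero m}} where
    infixl 6 _+ᵣ_
    infixl 7 _*ᵣ_
    infix 8 -ᵣ_
    _+ᵣ_ _*ᵣ_ : Fin m → Fin m → Fin m
    _+ᵣ_ = _⊞_ m
    _*ᵣ_ = _⊠_ m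
    -ᵣ_ : Fin m → Fin m
    -ᵣ_ = ⊟_ m

    ⟦_⟧ : ∀ {n} → Expr n → Vec (Fin m) n → Fin m
    ⟦ var i ⟧  ρ = lookup ρ i
    ⟦ e :+ f ⟧ ρ = ⟦ e ⟧ ρ +ᵣ ⟦ f ⟧ ρ
    ⟦ e :* f ⟧ ρ = ⟦ e ⟧ ρ *ᵣ ⟦ f ⟧ ρ
    ⟦ :- e ⟧   ρ = -ᵣ ⟦ e ⟧ ρ

    ⟦⟧-cls : ∀ {n} (e : Expr n) ρ → ⟦ e ⟧ ρ ≡ cls m (⟦ e ⟧ℤ (map (rep m) ρ))
    ⟦⟧-cls (var i)  ρ = trans (sym (cls-rep m (lookup ρ i))) (cong (cls m) (sym (Vecₚ.lookup-map i (rep m) ρ)))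
    ⟦⟧-cls (e :+ f) ρ = trans (cong₂ _+ᵣ_ (⟦⟧-cls e ρ) (⟦⟧-cls f ρ)) (cls-+ m _ _)
    ⟦⟧-cls (e :* f) ρ = trans (cong₂ _*ᵣ_ (⟦⟧-cls e ρ) (⟦⟧-cls f ρ)) (cls-* m _ _)
    ⟦⟧-cls (:- e)   ρ = trans (cong -ᵣ_ (⟦⟧-cls e ρ)) (cls-neg m _)

    identity : ∀ {n} (e f : Expr n) ρ → ⟦ e ⟧ℤ (map (rep m) ρ) ≡ ⟦ f ⟧ℤ (map (rep m) ρ) → ⟦ e ⟧ ρ ≡ ⟦ f ⟧ ρ
    identity e f ρ eq = trans (⟦⟧-cls e ρ) (trans (cong (cls m) eq) (sym (⟦⟧-cls f ρ)))

    cancel-right : ∀ x y → (x +ᵣ y) +ᵣ -ᵣ x ≡ y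
    cancel-right x y = identity ((var 0F :+ var 1F) :+ :- var 0F) (var 1F) (x ∷ y ∷ []) (integer (rep m x) (rep m y))
      where
      integer : ∀ x y → (x ℤ.+ y) ℤ.+ ℤ.- x ≡ y
      integer = ℤSolver.solve-∀

    cancel-left : ∀ x y → x +ᵣ (y +ᵣ -ᵣ x) ≡ y
    cancel-left x y = identity (var 0F :+ (var 1F :+ :- var 0F)) (var 1F) (x ∷ y ∷ []) (integer (rep m x) (rep m y))
      where
      integer : ∀ x y → x ℤ.+ (y ℤ.+ ℤ.- x) ≡ y
      integer = ℤSolver.solve-∀

  -- x · y is the mean of x and y modulo the odd number 2 t + 1.
  module Odd (t : ℕ) where
    m : ℕ
    m = suc (t ℕ.+ t)
    open RingIdentities m

    half : Fin m
    half = cls m (+ suc t)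

    half-double : half +ᵣ half ≡ cls m (+ 1)
    -- Twice t + 1 exceeds 1 by exactly the modulus.
    half-double = trans (cls-+ m (+ suc t) (+ suc t)) (cls-cong m (+ 1 , integer (+ t)))
      where
      integer : ∀ t → (+ 1 ℤ.+ t) ℤ.+ (+ 1 ℤ.+ t) ℤ.- + 1 ≡ + 1 ℤ.* (+ 1 ℤ.+ (t ℤ.+ t))
      integer = ℤSolver.solve-∀

    private
      module R = CommutativeRing (ring m)

      double-mean : ∀ x → half *ᵣ x +ᵣ half *ᵣ x ≡ x
      double-mean x = trans (sym (R.distribʳ x half half)) (trans (cong (_*ᵣ x) half-double) (R.*-identityˡ x))

      mean-double : ∀ x → half *ᵣ (x +ᵣ x) ≡ x
      mean-double x = trans (R.distribˡ half x x) (double-mean x)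

    quasigroup : CommutativeQuasigroup (Fin m)
    quasigroup = record
      { _≟_    = Finₚ._≟_
      ; _·_    = λ x y → half *ᵣ (x +ᵣ y)
      ; _\\_   = λ x y → (y +ᵣ y) +ᵣ -ᵣ x
      ; ·-comm = λ x y → cong (half *ᵣ_) (R.+-comm x y)
      ; \\-·   = λ x y → trans (cong (_+ᵣ -ᵣ x) (double-mean (x +ᵣ y))) (cancel-right x y)
      ; ·-\\   = λ x y → trans (cong (half *ᵣ_) (cancel-left x (y +ᵣ y))) (mean-double y)
      }

    ·-idem : ∀ x → CommutativeQuasigroup._·_ quasigroup x x ≡ x
    ·-idem = mean-double

  bit : Bool → Fin 2
  bit false = 0F
  bit true  = 1F

  unbit : Fin 2 → Bool
  unbit 0F = false
  unbit 1F = true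

  bit-unbit : ∀ i → bit (unbit i) ≡ i
  bit-unbit 0F = refl
  bit-unbit 1F = refl

  unbit-bit : ∀ b → unbit (bit b) ≡ b
  unbit-bit false = refl
  unbit-bit true  = refl

  -- (b , j) stands for b t + j modulo 2 t, and x · y is the image of x + y under
  -- the permutation 2 j + b ↦ b t + j.
  module Even (t : ℕ) .{{_ : ℕ.NonZero t}} where
    m : ℕ
    m = 2 ℕ.* t

    instance
      m≢0 : ℕ.NonZero m
      m≢0 = ℕₚ.m*n≢0 2 t
    open RingIdentities m

    Q : Set
    Q = Bool × Fin t

    val : Q → Fin m
    val (b , j) = combine (bit b) j

    unval : Fin m → Q
    unval z = unbit (proj₁ (remQuot {2} t z)) , proj₂ (remQuot {2} t z)

    unval-val : ∀ q → unval (val q) ≡ q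
    unval-val (b , j) = trans (cong (λ p → unbit (proj₁ p) , proj₂ p) (Finₚ.remQuot-combine {2} (bit b) j)) (cong (_, j) (unbit-bit b))

    val-unval : ∀ z → val (unval z) ≡ z
    val-unval z = trans (cong (λ i → combine i (proj₂ (remQuot {2} t z))) (bit-unbit (proj₁ (remQuot {2} t z)))) (Finₚ.combine-remQuot {2} t z)

    swapped : t ℕ.* 2 ≡ m
    swapped = ℕₚ.*-comm t 2

    unshuffle : Q → Fin m
    unshuffle (b , j) = cast swapped (combine j (bit b))

    shuffle : Fin m → Q
    shuffle z = unbit (proj₂ (remQuot {t} 2 (cast (sym swapped) z))) , proj₁ (remQuot {t} 2 (cast (sym swapped) z))

    shuffle-unshuffle : ∀ q → shuffle (unshuffle q) ≡ q
    shuffle-unshuffle (b , j) = trans (cong (λ z → unbit (proj₂ (remQuot {t} 2 z)) , proj₁ (remQuot {t} 2 z)) (Finₚ.cast-involutive (sym swapped) swapped (combine j (bit b))))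
      (trans (cong (λ p → unbit (proj₂ p) , proj₁ p) (Finₚ.remQuot-combine {t} {2} j (bit b))) (cong (_, j) (unbit-bit b)))

    unshuffle-shuffle : ∀ z → unshuffle (shuffle z) ≡ z
    unshuffle-shuffle z = trans (cong (cast swapped) (trans (cong (combine (proj₁ (remQuot {t} 2 z′))) (bit-unbit (proj₂ (remQuot {t} 2 z′)))) (Finₚ.combine-remQuot {t} 2 z′)))
      (Finₚ.cast-involutive swapped (sym swapped) z)
      where z′ = cast (sym swapped) z

    private
      module R = CommutativeRing (ring m)

    quasigroup : CommutativeQuasigroup Q
    quasigroup = record
      { _≟_    = ≡-dec Boolₚ._≟_ Finₚ._≟_
      ; _·_    = λ x y → shuffle (val x +ᵣ val y)
      ; _\\_   = λ x y → unval (unshuffle y +ᵣ -ᵣ val x)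
      ; ·-comm = λ x y → cong shuffle (R.+-comm (val x) (val y))
      ; \\-·   = λ x y → trans (cong unval (trans (cong (_+ᵣ -ᵣ val x) (unshuffle-shuffle (val x +ᵣ val y))) (cancel-right (val x) (val y)))) (unval-val y)
      ; ·-\\   = λ x y → trans (cong shuffle (trans (cong (val x +ᵣ_) (val-unval (unshuffle y +ᵣ -ᵣ val x))) (cancel-left (val x) (unshuffle y)))) (shuffle-unshuffle y)
      }

    -- Doubling b t + j gives 2 j modulo 2 t, and the permutation sends 2 j to (false , j).
    ·-half : ∀ b j → CommutativeQuasigroup._·_ quasigroup (b , j) (b , j) ≡ (false , j)
    ·-half b j = trans (cong shuffle doubled) (shuffle-unshuffle (false , j))
      where
      v : ℕ
      v = toℕ (bit b)
      doubled : val (b , j) +ᵣ val (b , j) ≡ unshuffle (false , j)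
      doubled = trans (cls-cong m (+ v , trans
          (cong₂ (λ x y → (+ x ℤ.+ + x) ℤ.- + y) (Finₚ.toℕ-combine (bit b) j) (trans (Finₚ.toℕ-cast swapped (combine j 0F)) (Finₚ.toℕ-combine j 0F)))
          (trans (cong (λ z → z ℤ.+ z ℤ.- + (2 ℕ.* toℕ j ℕ.+ 0)) (trans (ℤₚ.pos-+ (t ℕ.* v) (toℕ j)) (cong (ℤ._+ + toℕ j) (ℤₚ.pos-* t v))))
            (trans (cong₂ (λ z w → + t ℤ.* + v ℤ.+ + toℕ j ℤ.+ (+ t ℤ.* + v ℤ.+ + toℕ j) ℤ.- z) (trans (cong +_ (ℕₚ.+-identityʳ (2 ℕ.* toℕ j))) (ℤₚ.pos-* 2 (toℕ j))) (refl {x = m}))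
              (trans (integer (+ t) (+ v) (+ toℕ j)) (cong (+ v ℤ.*_) (sym (ℤₚ.pos-* 2 t))))))))
        (cls-rep m (unshuffle (false , j)))
        where
        integer : ∀ t v j → t ℤ.* v ℤ.+ j ℤ.+ (t ℤ.* v ℤ.+ j) ℤ.- + 2 ℤ.* j ≡ v ℤ.* (+ 2 ℤ.* t)
        integer = ℤSolver.solve-∀

-- Directions and affine lines over F₇

module Lines where

  open SteinerSystems
  open Residues
  open Quasigroups
  open import Algebra.Bundles using (CommutativeRing)
  open import Data.Bool using (Bool; true; false)
  open import Data.Empty using (⊥)
  open import Data.Fin using (Fin; zero; suc)
  open import Data.Fin.Patterns
  open import Data.Fin.Properties using (_≟_; all?)
  open import Data.Integer as ℤ using (ℤ; +_)
  import Data.Integer.Tactic.RingSolver as ℤSolver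
  open import Data.Maybe as Maybe using (Maybe; just; nothing)
  open import Data.Nat using (ℕ; zero; suc)
  open import Data.Product using (_×_; _,_; proj₁; proj₂)
  open import Data.Sum using (_⊎_; inj₁; inj₂)
  open import Data.Vec using (Vec; []; _∷_; map; zipWith; replicate)
  import Data.Vec.Properties as Vecₚ
  open import Function using (_∘_)
  open import Relation.Nullary using (yes; no; contradiction)
  open import Relation.Nullary.Decidable using (_→-dec_; ¬?)
  open import Relation.Binary.PropositionalEquality

  open RingIdentities 7
  private
    module R = CommutativeRing (ring 7)

  F : Set
  F = Fin 7

  0ᵣ 1ᵣ : F
  0ᵣ = cls 7 (+ 0)
  1ᵣ = cls 7 (+ 1)

  Λ : Set
  Λ = Fin 3 × Bool

  -- The six nonzero residues.
  unit : Λ → F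
  unit (0F , false) = 1F
  unit (0F , true)  = 2F
  unit (1F , false) = 3F
  unit (1F , true)  = 4F
  unit (2F , false) = 5F
  unit (2F , true)  = 6F

  log : F → Λ
  log 0F = 0F , false
  log 1F = 0F , false
  log 2F = 0F , true
  log 3F = 1F , false
  log 4F = 1F , true
  log 5F = 2F , false
  log 6F = 2F , true

  inverse : F → F
  inverse 0F = 0F
  inverse 1F = 1F
  inverse 2F = 4F
  inverse 3F = 5F
  inverse 4F = 2F
  inverse 5F = 3F
  inverse 6F = 6F

  opaque
    unfolding cls

    inverse-* : ∀ x → x ≢ 0ᵣ → inverse x *ᵣ x ≡ 1ᵣ
    inverse-* = fromDoes (all? λ x → ¬? (x ≟ 0ᵣ) →-dec (inverse x *ᵣ x ≟ 1ᵣ)) refl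

    unit-log : ∀ x → x ≢ 0ᵣ → unit (log x) ≡ x
    unit-log = fromDoes (all? λ x → ¬? (x ≟ 0ᵣ) →-dec (unit (log x) ≟ x)) refl

    unit≢0 : ∀ l → unit l ≢ 0ᵣ
    unit≢0 (0F , false) ()
    unit≢0 (0F , true)  ()
    unit≢0 (1F , false) ()
    unit≢0 (1F , true)  ()
    unit≢0 (2F , false) ()
    unit≢0 (2F , true)  ()

  log-unit : ∀ l → log (unit l) ≡ l
  log-unit (0F , false) = refl
  log-unit (0F , true)  = refl
  log-unit (1F , false) = refl
  log-unit (1F , true)  = refl
  log-unit (2F , false) = refl
  log-unit (2F , true)  = refl

  infixl 6 _-ᵣ′_
  _-ᵣ′_ : F → F → F
  a -ᵣ′ b = a +ᵣ -ᵣ b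

  difference-zero : ∀ {a b} → a -ᵣ′ b ≡ 0ᵣ → a ≡ b
  difference-zero {a} {b} e = trans (sym (restore a b)) (trans (cong (_+ᵣ b) e) (R.+-identityˡ b))
    where
    restore : ∀ a b → (a -ᵣ′ b) +ᵣ b ≡ a
    restore a b = identity ((var 0F :+ :- var 1F) :+ var 1F) (var 0F) (a ∷ b ∷ []) (integer (rep 7 a) (rep 7 b))
      where
      integer : ∀ a b → (a ℤ.+ ℤ.- b) ℤ.+ b ≡ a
      integer = ℤSolver.solve-∀

  private variable
    j : ℕ

  shift : Vec F j → F → Vec F j → Vec F j
  shift v c D = zipWith (λ x y → x +ᵣ c *ᵣ y) v D

  scale : F → Vec F j → Vec F j
  scale c = map (c *ᵣ_)

  diff : Vec F j → Vec F j → Vec F j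
  diff = zipWith _-ᵣ′_

  origin : Vec F j
  origin = replicate _ 0ᵣ

  shift-shift : ∀ (v : Vec F j) a b D → shift (shift v a D) b D ≡ shift v (a +ᵣ b) D
  shift-shift []      a b []      = refl
  shift-shift (x ∷ v) a b (y ∷ D) = cong₂ _∷_
    (identity ((var 0F :+ var 1F :* var 3F) :+ var 2F :* var 3F) (var 0F :+ (var 1F :+ var 2F) :* var 3F) (x ∷ a ∷ b ∷ y ∷ []) (integer (rep 7 x) (rep 7 a) (rep 7 b) (rep 7 y)))
    (shift-shift v a b D)
    where
    integer : ∀ x a b y → (x ℤ.+ a ℤ.* y) ℤ.+ b ℤ.* y ≡ x ℤ.+ (a ℤ.+ b) ℤ.* y
    integer = ℤSolver.solve-∀

  shift-0 : ∀ (v : Vec F j) D → shift v 0ᵣ D ≡ v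
  shift-0 []      []      = refl
  shift-0 (x ∷ v) (y ∷ D) = cong₂ _∷_ (trans (cong (x +ᵣ_) (R.zeroˡ y)) (R.+-identityʳ x)) (shift-0 v D)

  shift-scale : ∀ a b (D : Vec F j) → shift (scale a D) b D ≡ scale (a +ᵣ b) D
  shift-scale a b []      = refl
  shift-scale a b (y ∷ D) = cong₂ _∷_ (sym (R.distribʳ y a b)) (shift-scale a b D)

  diff-shift : ∀ (v : Vec F j) a b D → diff (shift v a D) (shift v b D) ≡ scale (a -ᵣ′ b) D
  diff-shift []      a b []      = refl
  diff-shift (x ∷ v) a b (y ∷ D) = cong₂ _∷_
    (identity ((var 0F :+ var 1F :* var 3F) :+ :- (var 0F :+ var 2F :* var 3F)) ((var 1F :+ :- var 2F) :* var 3F) (x ∷ a ∷ b ∷ y ∷ []) (integer (rep 7 x) (rep 7 a) (rep 7 b) (rep 7 y)))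
    (diff-shift v a b D)
    where
    integer : ∀ x a b y → (x ℤ.+ a ℤ.* y) ℤ.+ ℤ.- (x ℤ.+ b ℤ.* y) ≡ (a ℤ.+ ℤ.- b) ℤ.* y
    integer = ℤSolver.solve-∀

  diff-scale : ∀ a b (D : Vec F j) → diff (scale a D) (scale b D) ≡ scale (a -ᵣ′ b) D
  diff-scale a b []      = refl
  diff-scale a b (y ∷ D) = cong₂ _∷_
    (identity (var 0F :* var 2F :+ :- (var 1F :* var 2F)) ((var 0F :+ :- var 1F) :* var 2F) (a ∷ b ∷ y ∷ []) (integer (rep 7 a) (rep 7 b) (rep 7 y)))
    (diff-scale a b D)
    where
    integer : ∀ a b y → a ℤ.* y ℤ.+ ℤ.- (b ℤ.* y) ≡ (a ℤ.+ ℤ.- b) ℤ.* y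
    integer = ℤSolver.solve-∀

  diff≡scale⇒shift : ∀ (w v : Vec F j) s D → diff w v ≡ scale s D → w ≡ shift v s D
  diff≡scale⇒shift []      []      s []      e = refl
  diff≡scale⇒shift (x ∷ w) (y ∷ v) s (z ∷ D) e = cong₂ _∷_
    (trans (sym (restore x y)) (cong (y +ᵣ_) (Vecₚ.∷-injectiveˡ e))) (diff≡scale⇒shift w v s D (Vecₚ.∷-injectiveʳ e))
    where
    restore : ∀ x y → y +ᵣ (x -ᵣ′ y) ≡ x
    restore x y = cancel-left y x

  diff-origin : ∀ (w v : Vec F j) → diff w v ≡ origin → w ≡ v
  diff-origin []      []      e = refl
  diff-origin (x ∷ w) (y ∷ v) e = cong₂ _∷_ (difference-zero (Vecₚ.∷-injectiveˡ e)) (diff-origin w v (Vecₚ.∷-injectiveʳ e))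

  scale-0 : ∀ (D : Vec F j) → scale 0ᵣ D ≡ origin
  scale-0 []      = refl
  scale-0 (y ∷ D) = cong₂ _∷_ (R.zeroˡ y) (scale-0 D)

  scale-1 : ∀ (D : Vec F j) → scale 1ᵣ D ≡ D
  scale-1 []      = refl
  scale-1 (y ∷ D) = cong₂ _∷_ (R.*-identityˡ y) (scale-1 D)

  scale-scale : ∀ a b (D : Vec F j) → scale a (scale b D) ≡ scale (a *ᵣ b) D
  scale-scale a b []      = refl
  scale-scale a b (y ∷ D) = cong₂ _∷_ (sym (R.*-assoc a b y)) (scale-scale a b D)

  -- The directions of F₇ʲ, by their vectors with leading coordinate 1.
  Dir : ℕ → Set
  Dir zero    = ⊥
  Dir (suc j) = Vec F j ⊎ Dir j

  vec : Dir j → Vec F j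
  vec {suc j} (inj₁ r) = 1ᵣ ∷ r
  vec {suc j} (inj₂ g) = 0ᵣ ∷ vec g

  -- A linear functional with value 1 on `vec g`: it gives the coordinate along g, and its kernel
  -- parametrises the lines in direction g.
  lead : Dir j → Vec F j → F
  lead {suc j} (inj₁ r) (x ∷ v) = x
  lead {suc j} (inj₂ g) (x ∷ v) = lead g v

  lead-vec : ∀ (g : Dir j) → lead g (vec g) ≡ 1ᵣ
  lead-vec {suc j} (inj₁ r) = refl
  lead-vec {suc j} (inj₂ g) = lead-vec g

  lead-scale : ∀ (g : Dir j) c v → lead g (scale c v) ≡ c *ᵣ lead g v
  lead-scale {suc j} (inj₁ r) c (x ∷ v) = refl
  lead-scale {suc j} (inj₂ g) c (x ∷ v) = lead-scale g c v

  lead-shift : ∀ (g : Dir j) v c D → lead g (shift v c D) ≡ lead g v +ᵣ c *ᵣ lead g D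
  lead-shift {suc j} (inj₁ r) (x ∷ v) c (y ∷ D) = refl
  lead-shift {suc j} (inj₂ g) (x ∷ v) c (y ∷ D) = lead-shift g v c D

  lead-diff : ∀ (g : Dir j) w v → lead g (diff w v) ≡ lead g w -ᵣ′ lead g v
  lead-diff {suc j} (inj₁ r) (x ∷ v) (y ∷ D) = refl
  lead-diff {suc j} (inj₂ g) (x ∷ v) (y ∷ D) = lead-diff g v D

  lead-scale-vec : ∀ (g : Dir j) c → lead g (scale c (vec g)) ≡ c
  lead-scale-vec g c = trans (lead-scale g c (vec g)) (trans (cong (c *ᵣ_) (lead-vec g)) (R.*-identityʳ c))

  lead-shift-vec : ∀ (g : Dir j) v c → lead g (shift v c (vec g)) ≡ lead g v +ᵣ c
  lead-shift-vec g v c = trans (lead-shift g v c (vec g)) (cong (lead g v +ᵣ_) (trans (cong (c *ᵣ_) (lead-vec g)) (R.*-identityʳ c)))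

  dir? : Vec F j → Maybe (Dir j)
  dir? [] = nothing
  dir? (x ∷ v) with x ≟ 0ᵣ
  ... | no _  = just (inj₁ (scale (inverse x) v))
  ... | yes _ = Maybe.map inj₂ (dir? v)

  dir?-scale : ∀ (g : Dir j) {c} → c ≢ 0ᵣ → dir? (scale c (vec g)) ≡ just g
  dir?-scale {suc j} (inj₁ r) {c} c≢0 with c *ᵣ 1ᵣ ≟ 0ᵣ
  ... | yes e = contradiction (trans (sym (R.*-identityʳ c)) e) c≢0
  ... | no _  = cong (just ∘ inj₁) (trans (scale-scale (inverse (c *ᵣ 1ᵣ)) c r)
    (trans (cong (λ z → scale z r) (trans (cong (λ z → inverse z *ᵣ c) (R.*-identityʳ c)) (inverse-* c c≢0))) (scale-1 r)))
  dir?-scale {suc j} (inj₂ g) {c} c≢0 with c *ᵣ 0ᵣ ≟ 0ᵣ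
  ... | yes _ = cong (Maybe.map inj₂) (dir?-scale g c≢0)
  ... | no ne = contradiction (R.zeroʳ c) ne

  dir?-just : ∀ (v : Vec F j) {g} → dir? v ≡ just g → v ≡ scale (lead g v) (vec g)
  dir?-just (x ∷ v) e with x ≟ 0ᵣ
  dir?-just (x ∷ v) refl | no x≢0 = cong₂ _∷_ (sym (R.*-identityʳ x)) (sym (trans (scale-scale x (inverse x) v)
    (trans (cong (λ z → scale z v) (trans (R.*-comm x (inverse x)) (inverse-* x x≢0))) (scale-1 v))))
  dir?-just (x ∷ v) e | yes x≡0 with dir? v in eq
  dir?-just (x ∷ v) refl | yes x≡0 | just g = cong₂ _∷_ (trans x≡0 (sym (R.zeroʳ (lead g v)))) (dir?-just v eq)

  dir?-nothing : ∀ (v : Vec F j) → dir? v ≡ nothing → v ≡ origin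
  dir?-nothing [] e = refl
  dir?-nothing (x ∷ v) e with x ≟ 0ᵣ
  dir?-nothing (x ∷ v) () | no _
  dir?-nothing (x ∷ v) e  | yes x≡0 with dir? v in eq
  dir?-nothing (x ∷ v) e  | yes x≡0 | nothing = cong₂ _∷_ x≡0 (dir?-nothing v eq)

  -- `g₀` is the default value of `direction` at the origin.
  module Affine {j : ℕ} (g₀ : Dir j) where

    Point : Set
    Point = Dir j × Λ

    direction : Vec F j → Dir j
    direction v = Maybe.fromMaybe g₀ (dir? v)

    direction-scale : ∀ g {c} → c ≢ 0ᵣ → direction (scale c (vec g)) ≡ g
    direction-scale g c≢0 = cong (Maybe.fromMaybe g₀) (dir?-scale g c≢0)

    along : ∀ v → v ≢ origin → v ≡ scale (lead (direction v) v) (vec (direction v))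
    along v v≢0 with dir? v in eq
    ... | just g  = dir?-just v eq
    ... | nothing = contradiction (dir?-nothing v eq) v≢0

    lead≢0 : ∀ v → v ≢ origin → lead (direction v) v ≢ 0ᵣ
    lead≢0 v v≢0 e = v≢0 (trans (along v v≢0) (trans (cong (λ c → scale c (vec (direction v))) e) (scale-0 (vec (direction v)))))

    toVec : Point → Vec F j
    toVec (g , l) = scale (unit l) (vec g)

    fromVec : Vec F j → Point
    fromVec v = direction v , log (lead (direction v) v)

    fromVec-toVec : ∀ p → fromVec (toVec p) ≡ p
    fromVec-toVec (g , l) = trans (cong (λ k → k , log (lead k (toVec (g , l)))) (direction-scale g (unit≢0 l)))
      (cong (g ,_) (trans (cong log (lead-scale-vec g (unit l))) (log-unit l)))

    toVec-fromVec : ∀ v → v ≢ origin → toVec (fromVec v) ≡ v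
    toVec-fromVec v v≢0 = trans (cong (λ c → scale c (vec (direction v))) (unit-log _ (lead≢0 v v≢0))) (sym (along v v≢0))

    toVec≢origin : ∀ p → toVec p ≢ origin
    toVec≢origin (g , l) e = unit≢0 l (trans (sym (lead-scale-vec g (unit l))) (trans (cong (lead g) e) (trans (cong (lead g) (sym (scale-0 (vec g)))) (lead-scale-vec g 0ᵣ))))

    -- A line is given by its direction and its point with vanishing leading coordinate.
    Line : Set
    Line = Dir j × Vec F j

    on : Line → F → Vec F j
    on (g , u) c = shift u c (vec g)

    -- The first condition makes the base point of a line unique. The second excludes the lines
    -- through the origin, which meet a single group.
    Valid : Line → Set
    Valid (g , u) = lead g u ≡ 0ᵣ × u ≢ origin

    lead-on : ∀ {g u} → Valid (g , u) → ∀ c → lead g (on (g , u) c) ≡ c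
    lead-on {g} {u} (z , _) c = trans (lead-shift-vec g u c) (trans (cong (_+ᵣ c) z) (R.+-identityˡ c))

    foot : ∀ g (u : Vec F j) c → shift (on (g , u) c) (-ᵣ c) (vec g) ≡ u
    foot g u c = trans (shift-shift u c (-ᵣ c) (vec g)) (trans (cong (λ z → shift u z (vec g)) (R.-‿inverseʳ c)) (shift-0 u (vec g)))

    off-direction : ∀ {g u} → Valid (g , u) → ∀ c a → on (g , u) c ≢ scale a (vec g)
    off-direction {g} {u} (z , u≢0) c a e = u≢0 (trans u≡ (trans (cong (λ k → scale k (vec g)) k≡0) (scale-0 (vec g))))
      where
      u≡ : u ≡ scale (a +ᵣ -ᵣ c) (vec g)
      u≡ = trans (sym (foot g u c)) (trans (cong (λ w → shift w (-ᵣ c) (vec g)) e) (shift-scale a (-ᵣ c) (vec g)))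
      k≡0 : a +ᵣ -ᵣ c ≡ 0ᵣ
      k≡0 = trans (sym (lead-scale-vec g (a +ᵣ -ᵣ c))) (trans (cong (lead g) (sym u≡)) z)

    on≢origin : ∀ {ℓ} → Valid ℓ → ∀ c → on ℓ c ≢ origin
    on≢origin {g , u} val c e = off-direction val c 0ᵣ (trans e (sym (scale-0 (vec g))))

    -- The coordinates of both points are returned too, so that pairs of points correspond to lines
    -- with pairs of coordinates.
    lineThrough : Vec F j → Vec F j → Line × F × F
    lineThrough v w = (g , shift v (-ᵣ lead g v) (vec g)) , lead g v , lead g w
      where g = direction (diff w v)

    lineThrough-on : ∀ {ℓ} → Valid ℓ → ∀ {c c′} → c ≢ c′ → lineThrough (on ℓ c) (on ℓ c′) ≡ (ℓ , c , c′)
    lineThrough-on {ℓ@(g , u)} val {c} {c′} c≢c′ = trans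
      (cong (λ k → (k , shift v (-ᵣ lead k v) (vec k)) , lead k v , lead k w)
        (trans (cong direction (diff-shift u c′ c (vec g))) (direction-scale g (λ e → c≢c′ (sym (difference-zero e))))))
      (trans (cong₂ (λ a b → (g , shift v (-ᵣ a) (vec g)) , a , b) (lead-on val c) (lead-on val c′)) (cong (λ z → (g , z) , c , c′) (foot g u c)))
      where
      v w : Vec F j
      v = on ℓ c
      w = on ℓ c′

    module Through (v w : Vec F j) (v≢w : v ≢ w) where
      g : Dir j
      g = direction (diff w v)

      s : F
      s = lead g (diff w v)

      ℓ : Line
      ℓ = proj₁ (lineThrough v w)

      diff≡ : diff w v ≡ scale s (vec g)
      diff≡ = along (diff w v) (λ e → v≢w (sym (diff-origin w v e)))

      w≡ : w ≡ shift v s (vec g)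
      w≡ = diff≡scale⇒shift w v s (vec g) diff≡

      on-v : on ℓ (lead g v) ≡ v
      on-v = trans (shift-shift v (-ᵣ lead g v) (lead g v) (vec g)) (trans (cong (λ z → shift v z (vec g)) (R.-‿inverseˡ (lead g v))) (shift-0 v (vec g)))

      on-w : on ℓ (lead g w) ≡ w
      on-w = trans (shift-shift v (-ᵣ lead g v) (lead g w) (vec g)) (trans (cong (λ z → shift v z (vec g)) s≡) (sym w≡))
        where
        s≡ : -ᵣ lead g v +ᵣ lead g w ≡ s
        s≡ = trans (R.+-comm (-ᵣ lead g v) (lead g w)) (sym (lead-diff g w v))

      distinct-coordinates : lead g v ≢ lead g w
      distinct-coordinates e = v≢w (trans (sym on-v) (trans (cong (on ℓ) e) on-w))

      lead-base : lead g (proj₂ ℓ) ≡ 0ᵣ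
      lead-base = trans (lead-shift-vec g v (-ᵣ lead g v)) (R.-‿inverseʳ (lead g v))

      through-origin : proj₂ ℓ ≡ origin → ∀ c → on ℓ c ≡ scale c (vec g)
      through-origin e c = trans (cong (λ u → shift u c (vec g)) (trans e (sym (scale-0 (vec g)))))
        (trans (shift-scale 0ᵣ c (vec g)) (cong (λ z → scale z (vec g)) (R.+-identityˡ c)))

    toVec-injective : ∀ {p q} → toVec p ≡ toVec q → p ≡ q
    toVec-injective {p} {q} e = trans (sym (fromVec-toVec p)) (trans (cong fromVec e) (fromVec-toVec q))

    -- On a line through the origin all nonzero points belong to one group, so points from different
    -- groups cannot span it.
    through-valid : ∀ p q → proj₁ p ≢ proj₁ q → Valid (proj₁ (lineThrough (toVec p) (toVec q)))
    through-valid p q p≢q = lead-base , λ e → p≢q (trans (group p {lead g (toVec p)} (trans (sym on-v) (through-origin e (lead g (toVec p)))))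
        (sym (group q {lead g (toVec q)} (trans (sym on-w) (through-origin e (lead g (toVec q)))))))
      where
      open Through (toVec p) (toVec q) (λ e → p≢q (cong proj₁ (toVec-injective {p} {q} e)))
      group : ∀ r {a} → toVec r ≡ scale a (vec g) → proj₁ r ≡ g
      group r {a} e = trans (sym (cong proj₁ (fromVec-toVec r))) (trans (cong direction e) (direction-scale g a≢0))
        where
        a≢0 : a ≢ 0ᵣ
        a≢0 a≡0 = toVec≢origin r (trans e (trans (cong (λ z → scale z (vec g)) a≡0) (scale-0 (vec g))))

    -- Two points of the line in one group h differ by a multiple of `vec h`, so h is the direction
    -- g of the line; but a line in direction g with a point in the group g passes through the
    -- origin.
    groups-distinct : ∀ {ℓ} → Valid ℓ → ∀ {c c′} → c ≢ c′ → direction (on ℓ c) ≢ direction (on ℓ c′)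
    groups-distinct {ℓ@(g , u)} val {c} {c′} c≢c′ e = off-direction val c (lead h (on ℓ c)) (trans on-c (cong (λ k → scale (lead h (on ℓ c)) (vec k)) (sym g≡h)))
      where
      h : Dir j
      h = direction (on ℓ c)
      a a′ : F
      a  = lead h (on ℓ c)
      a′ = lead h (on ℓ c′)
      on-c : on ℓ c ≡ scale a (vec h)
      on-c = along (on ℓ c) (on≢origin val c)
      on-c′ : on ℓ c′ ≡ scale a′ (vec h)
      on-c′ = trans (along (on ℓ c′) (on≢origin val c′)) (cong (λ k → scale (lead k (on ℓ c′)) (vec k)) (sym e))
      same : scale (c -ᵣ′ c′) (vec g) ≡ scale (a -ᵣ′ a′) (vec h)
      same = trans (sym (diff-shift u c c′ (vec g))) (trans (cong₂ diff on-c on-c′) (diff-scale a a′ (vec h)))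
      a≢a′ : a -ᵣ′ a′ ≢ 0ᵣ
      a≢a′ z = c≢c′ (difference-zero (trans (sym (lead-scale-vec g (c -ᵣ′ c′)))
        (trans (cong (lead g) (trans same (trans (cong (λ k → scale k (vec h)) z) (trans (scale-0 (vec h)) (sym (scale-0 (vec g))))))) (lead-scale-vec g 0ᵣ))))
      g≡h : g ≡ h
      g≡h = trans (sym (direction-scale g (λ z → c≢c′ (difference-zero z)))) (trans (cong direction same) (direction-scale h a≢a′))

-- Systems that fill the groups

module TailedSystems where

  open SteinerSystems
  open BoseSkolem
  open Quasigroups
  open Lines using (Λ)
  open import Data.Bool using (Bool; true; false)
  open import Data.Fin using (Fin; zero; suc; join; splitAt)
  open import Data.Fin.Patterns
  open import Data.Fin.Properties using (join-splitAt; splitAt-join)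
  open import Data.Nat as ℕ using (ℕ; zero; suc)
  open import Data.Product using (_×_; _,_)
  open import Data.Sum using (_⊎_; inj₁; inj₂)
  open import Data.Unit using (⊤; tt)
  open import Relation.Binary.PropositionalEquality

  -- Steiner systems on 6 m points and a common tail E, on which they all agree.
  record Tailed (E : Set) : Set where
    field
      tail   : E → E → E
      system : ∀ m .{{_ : ℕ.NonZero m}} → Steiner ((Λ × Fin m) ⊎ E)
      agree  : ∀ m .{{_ : ℕ.NonZero m}} i j → _∙_ (system m) (inj₂ i) (inj₂ j) ≡ inj₂ (tail i j)

  tailed₁ : Tailed ⊤
  tailed₁ = record
    { tail   = λ _ _ → tt
    ; system = λ m → transport φ ψ ψφ φψ (Skolem.steiner (Even.quasigroup m) (Even.·-half m))
    ; agree  = λ _ _ _ → refl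
    }
    where
    φ : ∀ {m} → ((Bool × Fin m) × Fin 3) ⊎ ⊤ → (Λ × Fin m) ⊎ ⊤
    φ (inj₁ ((b , x) , i)) = inj₁ ((i , b) , x)
    φ (inj₂ t) = inj₂ t
    ψ : ∀ {m} → (Λ × Fin m) ⊎ ⊤ → ((Bool × Fin m) × Fin 3) ⊎ ⊤
    ψ (inj₁ ((i , b) , x)) = inj₁ ((b , x) , i)
    ψ (inj₂ t) = inj₂ t
    ψφ : ∀ {m} a → ψ {m} (φ a) ≡ a
    ψφ (inj₁ _) = refl
    ψφ (inj₂ _) = refl
    φψ : ∀ {m} a → φ {m} (ψ a) ≡ a
    φψ (inj₁ _) = refl
    φψ (inj₂ _) = refl

  -- Bose's system over 2m + 1 residues: the fibre of `zero` is the tail, and the other 2m residues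
  -- form two halves, told apart by the bit in `Λ`.
  tailed₃ : Tailed (Fin 3)
  tailed₃ = record
    { tail   = λ i j → thirdLevel (levels i j)
    ; system = λ m → transport (φ m) (ψ m) (ψφ m) (φψ m) (bose m)
    ; agree  = λ m i j → cong (φ m) (Bose.op-fibre (Odd.quasigroup m) (Odd.·-idem m) zero i j)
    }
    where
    bose : ∀ m → Steiner (Fin (suc (m ℕ.+ m)) × Fin 3)
    bose m = Bose.steiner (Odd.quasigroup m) (Odd.·-idem m)
    pick : ∀ {m} → Bool → Fin m → Fin m ⊎ Fin m
    pick false = inj₁
    pick true  = inj₂
    unpick : ∀ {m} → Fin 3 → Fin m ⊎ Fin m → (Λ × Fin m) ⊎ Fin 3
    unpick i (inj₁ x) = inj₁ ((i , false) , x)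
    unpick i (inj₂ x) = inj₁ ((i , true) , x)
    φ : ∀ m → Fin (suc (m ℕ.+ m)) × Fin 3 → (Λ × Fin m) ⊎ Fin 3
    φ m (zero  , i) = inj₂ i
    φ m (suc q , i) = unpick i (splitAt m q)
    ψ : ∀ m → (Λ × Fin m) ⊎ Fin 3 → Fin (suc (m ℕ.+ m)) × Fin 3
    ψ m (inj₁ ((i , b) , x)) = suc (join m m (pick b x)) , i
    ψ m (inj₂ i)             = zero , i
    ψφ : ∀ m a → ψ m (φ m a) ≡ a
    ψφ m (zero  , i) = refl
    ψφ m (suc q , i) with splitAt m q in eq
    ... | inj₁ x = cong (λ z → suc z , i) (trans (cong (join m m) (sym eq)) (join-splitAt m m q))
    ... | inj₂ x = cong (λ z → suc z , i) (trans (cong (join m m) (sym eq)) (join-splitAt m m q))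
    φψ : ∀ m a → φ m (ψ m a) ≡ a
    φψ m (inj₁ ((i , false) , x)) = cong (unpick i) (splitAt-join m m (inj₁ x))
    φψ m (inj₁ ((i , true)  , x)) = cong (unpick i) (splitAt-join m m (inj₂ x))
    φψ m (inj₂ i) = refl

-- Group divisible designs on one layer

module Layers where

  open SteinerSystems
  open BoseSkolem
  open Quasigroups
  open Lines
  open import Data.Bool using (_xor_)
  open import Data.Bool.Properties using (xor-comm; xor-assoc; xor-same)
  open import Data.Fin using (Fin)
  open import Data.Nat using (ℕ)
  open import Data.Product using (_×_; _,_; proj₁; proj₂)
  open import Relation.Binary.PropositionalEquality

  -- Triangle decompositions of complete multipartite graphs.
  record GroupDivisible {X Γ : Set} (grp : X → Γ) : Set where
    field
      op     : X → X → X
      comm   : ∀ {p q} → grp p ≢ grp q → op p q ≡ op q p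
      apart  : ∀ {p q} → grp p ≢ grp q → grp (op p q) ≢ grp p
      cancel : ∀ {p q} → grp p ≢ grp q → op p (op p q) ≡ q

  steiner-apart : ∀ {A : Set} (s : Steiner A) {x y} → x ≢ y → _∙_ s x y ≢ x
  steiner-apart s {x} {y} x≢y e = x≢y (trans (sym (idem s x)) (trans (cong (_∙_ s x) (sym e)) (cancel s x y)))

  xor-cancel : ∀ b c → b xor (b xor c) ≡ c
  xor-cancel b c = trans (sym (xor-assoc b b c)) (cong (_xor c) (xor-same b))

  -- Bose's system has triples meeting one or three groups, and doubling its points
  -- gives groups of six.
  module Doubled {Γ Q : Set} (quasi : CommutativeQuasigroup Q) (·-idem : ∀ x → CommutativeQuasigroup._·_ quasi x x ≡ x)
    (e : Γ → Q) (d : Q → Γ) (de : ∀ x → d (e x) ≡ x) (ed : ∀ y → e (d y) ≡ y) where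
    private
      module B = Bose quasi ·-idem

    doubled : GroupDivisible {Γ × Λ} proj₁
    doubled = record { op = op ; comm = λ {p} {q} _ → op-comm p q ; apart = λ {p} {q} → op-apart p q ; cancel = λ {p} {q} _ → op-cancel p q }
      where
      base : Γ × Λ → Γ × Λ → Q × Fin 3
      base (g , i , b) (h , k , c) = B.op (e g , i) (e h , k)
      op : Γ × Λ → Γ × Λ → Γ × Λ
      -- The bits on a triple sum to zero, so any two of them determine the third.
      op p@(g , i , b) q@(h , k , c) = d (proj₁ (base p q)) , proj₂ (base p q) , b xor c
      op-comm : ∀ p q → op p q ≡ op q p
      op-comm (g , i , b) (h , k , c) = cong₂ (λ z a → d (proj₁ z) , proj₂ z , a) (B.op-comm (e g , i) (e h , k)) (xor-comm b c)
      op-apart : ∀ p q → proj₁ p ≢ proj₁ q → proj₁ (op p q) ≢ proj₁ p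
      op-apart (g , i , b) (h , k , c) g≢h eq = B.op-apart i k (λ e≡ → g≢h (trans (sym (de g)) (trans (cong d e≡) (de h)))) (trans (sym (ed _)) (cong e eq))
      op-cancel : ∀ p q → op p (op p q) ≡ q
      op-cancel p@(g , i , b) q@(h , k , c) = trans (cong₂ (λ z a → d (proj₁ z) , proj₂ z , a)
        (trans (cong (λ z → B.op (e g , i) (z , proj₂ (base p q))) (ed (proj₁ (base p q)))) (B.op-cancel (e g , i) (e h , k))) (xor-cancel b c))
        (cong (_, k , c) (de h))

  module LineLayer {j : ℕ} (g₀ : Dir j) where
    open Affine g₀

    thirdPoint : (Line → Steiner F) → Line × F × F → Point
    thirdPoint σ (ℓ , c , c′) = fromVec (on ℓ (_∙_ (σ ℓ) c c′))

    opaque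
      lineOp : (Line → Steiner F) → Point → Point → Point
      lineOp σ p q = thirdPoint σ (lineThrough (toVec p) (toVec q))

      lineOp-on : ∀ σ {ℓ} → Valid ℓ → ∀ {c c′} → c ≢ c′ → lineOp σ (fromVec (on ℓ c)) (fromVec (on ℓ c′)) ≡ fromVec (on ℓ (_∙_ (σ ℓ) c c′))
      lineOp-on σ {ℓ} val {c} {c′} c≢c′ = cong (thirdPoint σ) (trans
        (cong₂ lineThrough (toVec-fromVec (on ℓ c) (on≢origin val c)) (toVec-fromVec (on ℓ c′) (on≢origin val c′)))
        (lineThrough-on val c≢c′))

    record OnLine (p q : Point) : Set where
      field
        ℓ      : Line
        c c′   : F
        valid  : Valid ℓ
        c≢c′   : c ≢ c′
        p≡     : fromVec (on ℓ c) ≡ p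
        q≡     : fromVec (on ℓ c′) ≡ q

    onLine : ∀ p q → proj₁ p ≢ proj₁ q → OnLine p q
    onLine p q p≢q = record
      { ℓ = ℓ ; c = lead g (toVec p) ; c′ = lead g (toVec q)
      ; valid = through-valid p q p≢q ; c≢c′ = distinct-coordinates
      ; p≡ = trans (cong fromVec on-v) (fromVec-toVec p) ; q≡ = trans (cong fromVec on-w) (fromVec-toVec q) }
      where open Through (toVec p) (toVec q) (λ e → p≢q (cong proj₁ (toVec-injective {p} {q} e)))

    -- Points of different groups always lie on a valid line, so each law can be checked in the
    -- coordinates of one line.
    by-line : (P : Point → Point → Set) → (∀ {ℓ} → Valid ℓ → ∀ {c c′} → c ≢ c′ → P (fromVec (on ℓ c)) (fromVec (on ℓ c′))) →
      ∀ p q → proj₁ p ≢ proj₁ q → P p q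
    by-line P f p q p≢q = subst₂ P p≡ q≡ (f valid c≢c′)
      where open OnLine (onLine p q p≢q)

    module _ (σ : Line → Steiner F) where
      on-comm : ∀ {ℓ} → Valid ℓ → ∀ {c c′} → c ≢ c′ → lineOp σ (fromVec (on ℓ c)) (fromVec (on ℓ c′)) ≡ lineOp σ (fromVec (on ℓ c′)) (fromVec (on ℓ c))
      on-comm {ℓ} val {c} {c′} c≢c′ = trans (lineOp-on σ val c≢c′)
        (trans (cong (λ k → fromVec (on ℓ k)) (comm (σ ℓ) c c′)) (sym (lineOp-on σ val (λ e → c≢c′ (sym e)))))

      on-apart : ∀ {ℓ} → Valid ℓ → ∀ {c c′} → c ≢ c′ → proj₁ (lineOp σ (fromVec (on ℓ c)) (fromVec (on ℓ c′))) ≢ proj₁ (fromVec (on ℓ c))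
      on-apart {ℓ} val {c} {c′} c≢c′ e = groups-distinct val (steiner-apart (σ ℓ) c≢c′) (trans (sym (cong proj₁ (lineOp-on σ val c≢c′))) e)

      on-cancel : ∀ {ℓ} → Valid ℓ → ∀ {c c′} → c ≢ c′ →
        lineOp σ (fromVec (on ℓ c)) (lineOp σ (fromVec (on ℓ c)) (fromVec (on ℓ c′))) ≡ fromVec (on ℓ c′)
      on-cancel {ℓ} val {c} {c′} c≢c′ = trans (cong (lineOp σ (fromVec (on ℓ c))) (lineOp-on σ val c≢c′))
        (trans (lineOp-on σ val (λ e → steiner-apart (σ ℓ) c≢c′ (sym e))) (cong (λ k → fromVec (on ℓ k)) (cancel (σ ℓ) c c′)))

      lines : GroupDivisible {Point} proj₁
      lines = record
        { op     = lineOp σ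
        ; comm   = λ {p} {q} → by-line (λ p q → lineOp σ p q ≡ lineOp σ q p) on-comm p q
        ; apart  = λ {p} {q} → by-line (λ p q → proj₁ (lineOp σ p q) ≢ proj₁ p) on-apart p q
        ; cancel = λ {p} {q} → by-line (λ p q → lineOp σ p (lineOp σ p q) ≡ q) on-cancel p q
        }

-- The transversal design and its completion

module TransversalDesign where

  open SteinerSystems
  open Residues
  open Quasigroups
  open Lines using (Λ)
  open TailedSystems
  open Layers using (GroupDivisible)
  open import Algebra.Bundles using (CommutativeRing)
  open import Data.Fin using (Fin)
  open import Data.Fin.Patterns
  open import Data.Integer as ℤ using (ℤ; +_)
  import Data.Integer.Tactic.RingSolver as ℤSolver
  open import Data.Maybe using (Maybe; just; nothing)
  open import Data.Nat as ℕ using (ℕ)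
  open import Data.Product using (_×_; _,_; proj₁)
  open import Data.Sum using (_⊎_; inj₁; inj₂)
  open import Data.Vec using ([]; _∷_)
  open import Relation.Binary using (DecidableEquality)
  open import Relation.Nullary using (yes; no; contradiction)
  open import Relation.Binary.PropositionalEquality

  data Pt (D E : Set) (m t : ℕ) : Set where
    reg : D → Λ → Fin m → Pt D E m t
    inf : Λ → Fin t → Pt D E m t
    ext : E → Pt D E m t

  -- A transversal design with groups D of size m whose blocks are the graphs of the
  -- functions g ↦ a ρ(g) + b. Blocks of the first t slopes a receive a point at infinity.
  module Design {D E : Set} (_≟_ : DecidableEquality D) (m t : ℕ) .{{m≢0 : ℕ.NonZero m}} .{{t≢0 : ℕ.NonZero t}}
    (ρ : D → Fin m) (recip : D → D → Fin m)
    (recip-law : ∀ {g h} → g ≢ h → RingIdentities._*ᵣ_ m (RingIdentities._+ᵣ_ m (ρ g) (RingIdentities.-ᵣ_ m (ρ h))) (recip g h) ≡ cls m (+ 1))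
    (small : Fin m → Maybe (Fin t)) (big : Fin t → Fin m)
    (small-big : ∀ a → small (big a) ≡ just a) (big-small : ∀ {a a′} → small a ≡ just a′ → a ≡ big a′)
    (T : Tailed E) (S : GroupDivisible {Maybe D × Λ} proj₁) (L : Fin m → Fin m → GroupDivisible {D × Λ} proj₁) where

    open RingIdentities m
    open Tailed T
    private
      module R = CommutativeRing (ring m)

    value : Fin m → Fin m → D → Fin m
    value a b g = a *ᵣ ρ g +ᵣ b

    -- The graph through (g,x) and (h,y) has slope (x - y) / (ρ g - ρ h), and `recip g h` inverts
    -- the denominator.
    slope : D → D → Fin m → Fin m → Fin m
    slope g h x y = (x +ᵣ -ᵣ y) *ᵣ recip g h

    intercept : Fin m → D → Fin m → Fin m
    intercept a g x = x +ᵣ -ᵣ (a *ᵣ ρ g)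

    value-intercept : ∀ a g x → value a (intercept a g x) g ≡ x
    value-intercept a g x = cancel-left (a *ᵣ ρ g) x

    intercept-value : ∀ a b g → intercept a g (value a b g) ≡ b
    intercept-value a b g = cancel-right (a *ᵣ ρ g) b

    value-slope : ∀ {g h} → g ≢ h → ∀ x y → value (slope g h x y) (intercept (slope g h x y) g x) h ≡ y
    value-slope {g} {h} g≢h x y = trans
      (identity (((var 0F :+ :- var 1F) :* var 2F) :* var 4F :+ (var 0F :+ :- (((var 0F :+ :- var 1F) :* var 2F) :* var 3F)))
                (var 0F :+ :- ((var 0F :+ :- var 1F) :* ((var 3F :+ :- var 4F) :* var 2F)))
                (x ∷ y ∷ recip g h ∷ ρ g ∷ ρ h ∷ []) (integer (rep m x) (rep m y) (rep m (recip g h)) (rep m (ρ g)) (rep m (ρ h))))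
      (trans (cong (λ z → x +ᵣ -ᵣ ((x +ᵣ -ᵣ y) *ᵣ z)) (recip-law g≢h))
      (trans (cong (λ z → x +ᵣ -ᵣ z) (R.*-identityʳ (x +ᵣ -ᵣ y)))
        (identity (var 0F :+ :- (var 0F :+ :- var 1F)) (var 1F) (x ∷ y ∷ []) (integer′ (rep m x) (rep m y)))))
      where
      integer : ∀ x y r g h → ((x ℤ.+ ℤ.- y) ℤ.* r) ℤ.* h ℤ.+ (x ℤ.+ ℤ.- (((x ℤ.+ ℤ.- y) ℤ.* r) ℤ.* g))
        ≡ x ℤ.+ ℤ.- ((x ℤ.+ ℤ.- y) ℤ.* ((g ℤ.+ ℤ.- h) ℤ.* r))
      integer = ℤSolver.solve-∀
      integer′ : ∀ x y → x ℤ.+ ℤ.- (x ℤ.+ ℤ.- y) ≡ y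
      integer′ = ℤSolver.solve-∀

    slope-value : ∀ {g h} → g ≢ h → ∀ a b → slope g h (value a b g) (value a b h) ≡ a
    slope-value {g} {h} g≢h a b = trans
      (identity (((var 0F :* var 3F :+ var 1F) :+ :- (var 0F :* var 4F :+ var 1F)) :* var 2F) (var 0F :* ((var 3F :+ :- var 4F) :* var 2F))
        (a ∷ b ∷ recip g h ∷ ρ g ∷ ρ h ∷ []) (integer (rep m a) (rep m b) (rep m (recip g h)) (rep m (ρ g)) (rep m (ρ h))))
      (trans (cong (a *ᵣ_) (recip-law g≢h)) (R.*-identityʳ a))
      where
      integer : ∀ a b r g h → ((a ℤ.* g ℤ.+ b) ℤ.+ ℤ.- (a ℤ.* h ℤ.+ b)) ℤ.* r ≡ a ℤ.* ((g ℤ.+ ℤ.- h) ℤ.* r)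
      integer = ℤSolver.solve-∀

    private
      Point′ : Set
      Point′ = Pt D E m t

    inReg : D → (Λ × Fin m) ⊎ E → Point′
    inReg g (inj₁ (l , x)) = reg g l x
    inReg g (inj₂ e)       = ext e

    inInf : (Λ × Fin t) ⊎ E → Point′
    inInf (inj₁ (l , a)) = inf l a
    inInf (inj₂ e)       = ext e

    -- The graph with slope `big a` and intercept b, together with the sextuple at infinity of a,
    -- which all graphs of this slope share.
    inSmall : Fin t → Fin m → Maybe D × Λ → Point′
    inSmall a b (just g , l)  = reg g l (value (big a) b g)
    inSmall a b (nothing , l) = inf l a

    inLarge : Fin m → Fin m → D × Λ → Point′
    inLarge a b (g , l) = reg g l (value a b g)

    S∙ : Maybe D × Λ → Maybe D × Λ → Maybe D × Λ
    S∙ = GroupDivisible.op S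

    L∙ : Fin m → Fin m → D × Λ → D × Λ → D × Λ
    L∙ a b = GroupDivisible.op (L a b)

    M∙ : (Λ × Fin m) ⊎ E → (Λ × Fin m) ⊎ E → (Λ × Fin m) ⊎ E
    M∙ = _∙_ (system m)

    T∙ : (Λ × Fin t) ⊎ E → (Λ × Fin t) ⊎ E → (Λ × Fin t) ⊎ E
    T∙ = _∙_ (system t)

    cross : Fin m → Fin m → Maybe (Fin t) → D × Λ → D × Λ → Point′
    cross a b (just a′) (g , l) (h , k) = inSmall a′ b (S∙ (just g , l) (just h , k))
    cross a b nothing   p       q       = inLarge a b (L∙ a b p q)

    op : Point′ → Point′ → Point′
    op (reg g l x) (reg h k y) with g ≟ h
    ... | yes _ = inReg g (M∙ (inj₁ (l , x)) (inj₁ (k , y)))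
    ... | no _  = cross (slope g h x y) (intercept (slope g h x y) g x) (small (slope g h x y)) (g , l) (h , k)
    op (reg g l x) (inf k a)   = inSmall a (intercept (big a) g x) (S∙ (just g , l) (nothing , k))
    op (inf k a)   (reg g l x) = inSmall a (intercept (big a) g x) (S∙ (nothing , k) (just g , l))
    op (reg g l x) (ext e)     = inReg g (M∙ (inj₁ (l , x)) (inj₂ e))
    op (ext e)     (reg g l x) = inReg g (M∙ (inj₂ e) (inj₁ (l , x)))
    op (inf k a)   (inf l b)   = inInf (T∙ (inj₁ (k , a)) (inj₁ (l , b)))
    op (inf k a)   (ext e)     = inInf (T∙ (inj₁ (k , a)) (inj₂ e))
    op (ext e)     (inf k a)   = inInf (T∙ (inj₂ e) (inj₁ (k , a)))
    op (ext e)     (ext f)     = ext (tail e f)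

    op-reg : ∀ g u v → op (inReg g u) (inReg g v) ≡ inReg g (M∙ u v)
    op-reg g (inj₁ (l , x)) (inj₁ (k , y)) with g ≟ g
    ... | yes _  = refl
    ... | no g≢g = contradiction refl g≢g
    op-reg g (inj₁ _) (inj₂ _) = refl
    op-reg g (inj₂ _) (inj₁ _) = refl
    op-reg g (inj₂ e) (inj₂ f) = cong (inReg g) (sym (agree m e f))

    op-inf : ∀ u v → op (inInf u) (inInf v) ≡ inInf (T∙ u v)
    op-inf (inj₁ _) (inj₁ _) = refl
    op-inf (inj₁ _) (inj₂ _) = refl
    op-inf (inj₂ _) (inj₁ _) = refl
    op-inf (inj₂ e) (inj₂ f) = cong inInf (sym (agree t e f))

    op-cross : ∀ a b {g h} l k → g ≢ h → op (reg g l (value a b g)) (reg h k (value a b h)) ≡ cross a b (small a) (g , l) (h , k)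
    op-cross a b {g} {h} l k g≢h with g ≟ h
    ... | yes g≡h = contradiction g≡h g≢h
    ... | no _    = cong₂ (λ a′ b′ → cross a′ b′ (small a′) (g , l) (h , k)) (slope-value g≢h a b)
      (trans (cong (λ z → intercept z g (value a b g)) (slope-value g≢h a b)) (intercept-value a b g))

    op-small : ∀ a b P Q → proj₁ P ≢ proj₁ Q → op (inSmall a b P) (inSmall a b Q) ≡ inSmall a b (S∙ P Q)
    op-small a b (just g , l) (just h , k) ne = trans (op-cross (big a) b l k (λ e → ne (cong just e)))
      (cong (λ s → cross (big a) b s (g , l) (h , k)) (small-big a))
    op-small a b (just g , l)  (nothing , k) ne = cong (λ z → inSmall a z (S∙ (just g , l) (nothing , k))) (intercept-value (big a) b g)
    op-small a b (nothing , k) (just g , l)  ne = cong (λ z → inSmall a z (S∙ (nothing , k) (just g , l))) (intercept-value (big a) b g)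
    op-small a b (nothing , k) (nothing , l) ne = contradiction refl ne

    op-large : ∀ a b p q → small a ≡ nothing → proj₁ p ≢ proj₁ q → op (inLarge a b p) (inLarge a b q) ≡ inLarge a b (L∙ a b p q)
    op-large a b (g , l) (h , k) sm ne = trans (op-cross a b l k ne) (cong (λ s → cross a b s (g , l) (h , k)) sm)

    -- Any two points lie in a group with the tail, in infinity with the tail, in a block completed
    -- at infinity, or in an ordinary block. `op` maps each of these into itself, so its laws are
    -- inherited without unfolding nested products.
    data Position : Point′ → Point′ → Set where
      in-reg   : ∀ g u v → Position (inReg g u) (inReg g v)
      in-inf   : ∀ u v → Position (inInf u) (inInf v)
      in-small : ∀ a b P Q → proj₁ P ≢ proj₁ Q → Position (inSmall a b P) (inSmall a b Q)
      in-large : ∀ a b p q → small a ≡ nothing → proj₁ p ≢ proj₁ q → Position (inLarge a b p) (inLarge a b q)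

    position : ∀ p q → Position p q
    position (reg g l x) (ext e)     = in-reg g (inj₁ (l , x)) (inj₂ e)
    position (ext e)     (reg g l x) = in-reg g (inj₂ e) (inj₁ (l , x))
    position (inf k a)   (inf l b)   = in-inf (inj₁ (k , a)) (inj₁ (l , b))
    position (inf k a)   (ext e)     = in-inf (inj₁ (k , a)) (inj₂ e)
    position (ext e)     (inf k a)   = in-inf (inj₂ e) (inj₁ (k , a))
    position (ext e)     (ext f)     = in-inf (inj₂ e) (inj₂ f)
    position (reg g l x) (inf k a)   = subst (λ z → Position (reg g l z) (inf k a)) (value-intercept (big a) g x)
      (in-small a (intercept (big a) g x) (just g , l) (nothing , k) λ ())
    position (inf k a)   (reg g l x) = subst (λ z → Position (inf k a) (reg g l z)) (value-intercept (big a) g x)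
      (in-small a (intercept (big a) g x) (nothing , k) (just g , l) λ ())
    position (reg g l x) (reg h k y) with g ≟ h
    ... | yes refl = in-reg g (inj₁ (l , x)) (inj₁ (k , y))
    ... | no g≢h   = subst₂ (λ x y → Position (reg g l x) (reg h k y)) (value-intercept a g x) (value-slope g≢h x y) (by-size (small a) refl)
      where
      a b : Fin m
      a = slope g h x y
      b = intercept a g x
      by-size : ∀ s → small a ≡ s → Position (reg g l (value a b g)) (reg h k (value a b h))
      by-size nothing   sm = in-large a b (g , l) (h , k) sm g≢h
      by-size (just a′) sm = subst (λ c → Position (reg g l (value c b g)) (reg h k (value c b h))) (sym (big-small sm))
        (in-small a′ b (just g , l) (just h , k) λ { refl → g≢h refl })

    op-idem : ∀ p → op p p ≡ p
    op-idem (reg g l x) = trans (op-reg g (inj₁ (l , x)) (inj₁ (l , x))) (cong (inReg g) (idem (system m) (inj₁ (l , x))))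
    op-idem (inf l a)   = cong inInf (idem (system t) (inj₁ (l , a)))
    op-idem (ext e)     = trans (op-inf (inj₂ e) (inj₂ e)) (cong inInf (idem (system t) (inj₂ e)))

    op-comm : ∀ p q → op p q ≡ op q p
    op-comm p q with position p q
    ... | in-reg g u v = trans (op-reg g u v) (trans (cong (inReg g) (comm (system m) u v)) (sym (op-reg g v u)))
    ... | in-inf u v   = trans (op-inf u v) (trans (cong inInf (comm (system t) u v)) (sym (op-inf v u)))
    ... | in-small a b P Q ne = trans (op-small a b P Q ne) (trans (cong (inSmall a b) (GroupDivisible.comm S ne)) (sym (op-small a b Q P λ e → ne (sym e))))
    ... | in-large a b p q sm ne = trans (op-large a b p q sm ne) (trans (cong (inLarge a b) (GroupDivisible.comm (L a b) ne)) (sym (op-large a b q p sm λ e → ne (sym e))))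

    op-cancel : ∀ p q → op p (op p q) ≡ q
    op-cancel p q with position p q
    ... | in-reg g u v = trans (cong (op (inReg g u)) (op-reg g u v)) (trans (op-reg g u (M∙ u v)) (cong (inReg g) (cancel (system m) u v)))
    ... | in-inf u v   = trans (cong (op (inInf u)) (op-inf u v)) (trans (op-inf u (T∙ u v)) (cong inInf (cancel (system t) u v)))
    ... | in-small a b P Q ne = trans (cong (op (inSmall a b P)) (op-small a b P Q ne))
      (trans (op-small a b P (S∙ P Q) λ e → GroupDivisible.apart S ne (sym e)) (cong (inSmall a b) (GroupDivisible.cancel S ne)))
    ... | in-large a b p q sm ne = trans (cong (op (inLarge a b p)) (op-large a b p q sm ne))
      (trans (op-large a b p (L∙ a b p q) sm λ e → GroupDivisible.apart (L a b) ne (sym e)) (cong (inLarge a b) (GroupDivisible.cancel (L a b) ne)))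

    steiner : Steiner Point′
    steiner = record { _∙_ = op ; idem = op-idem ; comm = op-comm ; cancel = op-cancel }

-- From Steiner quasigroups to lists of triples

module Triples where

  open import Defs
  open Sums
  open SteinerSystems using (fromDoes; Steiner; _∙_; idem; comm; cancel)
  open Permutations using (≟-does-comm)
  open import Data.Bool using (Bool; true; false; _∧_; _∨_)
  open import Data.Bool.Properties using (∨-comm)
  open import Data.Fin using (Fin; _<_)
  open import Data.Fin.Properties using (_≟_; _<?_; <-cmp; <-trans; <-asym; <-irrefl)
  open import Data.Integer using (ℤ; +_; _+_; _*_; -_; _-_)
  import Data.Integer.Properties as ℤₚ
  open import Data.Integer.Tactic.RingSolver using (solve-∀)
  open import Data.List using (List; []; _∷_; concatMap)
  open import Data.List.Relation.Unary.All using (All; []; _∷_)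
  open import Data.List.Relation.Unary.All.Properties using (++⁺)
  open import Data.Nat using (ℕ)
  import Data.Nat.Properties as ℕₚ
  open import Data.Product using (_×_; _,_; proj₁; proj₂)
  open import Function using (_∘_)
  open import Relation.Binary using (tri<; tri≈; tri>)
  open import Relation.Nullary using (Dec; yes; no; ¬_; does; contradiction)
  open import Relation.Nullary.Decidable using (dec-true; dec-false)
  open import Relation.Binary.PropositionalEquality hiding ([_])

  module _ {n : ℕ} (s : Steiner (Fin n)) where
    private
      V = Fin n
      infixl 7 _∘′_
      _∘′_ : V → V → V
      _∘′_ = _∙_ s

    ∑∑ : (V → V → V → ℤ) → ℤ
    ∑∑ g = ∑ (fins n) λ a → ∑ (fins n) λ b → g a b (a ∘′ b)

    ∑∑-cong : ∀ g h → (∀ a b → g a b (a ∘′ b) ≡ h a b (a ∘′ b)) → ∑∑ g ≡ ∑∑ h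
    ∑∑-cong g h e = ∑-cong (fins n) λ a → ∑-cong (fins n) λ b → e a b

    -- For fixed a the product with a is an involution, so the second and third points may be
    -- exchanged. Together with `∑∑-swap₁` this gives all six orders.
    ∑∑-swap₂ : ∀ g → ∑∑ (λ a b c → g a c b) ≡ ∑∑ g
    ∑∑-swap₂ g = ∑-cong (fins n) λ a → trans (∑-cong (fins n) λ b → cong (g a (a ∘′ b)) (sym (cancel s a b)))
      (∑-bij (enumFin n) (enumFin n) (a ∘′_) (a ∘′_) (cancel s a) (cancel s a) λ b → g a b (a ∘′ b))

    ∑∑-swap₁ : ∀ g → ∑∑ (λ a b c → g b a c) ≡ ∑∑ g
    ∑∑-swap₁ g = trans (∑-swap (fins n) (fins n) λ a b → g b a (a ∘′ b)) (∑∑-cong (λ a b c → g a b (b ∘′ a)) g λ a b → cong (g a b) (comm s b a))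

    ∑∑-+ : ∀ g h → ∑∑ (λ a b c → g a b c + h a b c) ≡ ∑∑ g + ∑∑ h
    ∑∑-+ g h = trans (∑-cong (fins n) λ a → ∑-+ (fins n) (λ b → g a b (a ∘′ b)) λ b → h a b (a ∘′ b))
      (∑-+ (fins n) (λ a → ∑ (fins n) λ b → g a b (a ∘′ b)) λ a → ∑ (fins n) λ b → h a b (a ∘′ b))

    lt : V → V → Bool
    lt a b = does (a <? b)

    sorted : V → V → V → Bool
    sorted a b c = lt a b ∧ lt b c

    δ : V → V → ℤ
    δ a b = 𝟙 (does (a ≟ b))

    ≠ : V → V → ℤ
    ≠ a b = + 1 - δ a b

    third-≢ : ∀ {a b} → a ≢ b → a ≢ a ∘′ b
    third-≢ {a} {b} a≢b e = a≢b (trans (sym (idem s a)) (trans (cong (a ∘′_) e) (cancel s a b)))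

    third-≢′ : ∀ {a b} → a ≢ b → b ≢ a ∘′ b
    third-≢′ {a} {b} a≢b e = third-≢ {b} {a} (λ e′ → a≢b (sym e′)) (trans e (comm s a b))

    lt-yes : ∀ {a b} → a < b → lt a b ≡ true
    lt-yes {a} {b} = dec-true (a <? b)
    lt-no : ∀ {a b} → ¬ a < b → lt a b ≡ false
    lt-no {a} {b} = dec-false (a <? b)

    orders : V → V → V → ℤ
    orders a b c = 𝟙 (sorted a b c) + (𝟙 (sorted a c b) + (𝟙 (sorted b a c) + (𝟙 (sorted b c a) + (𝟙 (sorted c a b) + 𝟙 (sorted c b a)))))

    one-order : ∀ a b c → a ≢ b → a ≢ c → b ≢ c → orders a b c ≡ + 1
    one-order a b c a≢b a≢c b≢c with <-cmp a b | <-cmp a c | <-cmp b c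
    ... | tri≈ _ e _ | _ | _ = contradiction e a≢b
    ... | _ | tri≈ _ e _ | _ = contradiction e a≢c
    ... | _ | _ | tri≈ _ e _ = contradiction e b≢c
    ... | tri< p _ p′ | tri< q _ q′ | tri< r _ r′ rewrite lt-yes p | lt-yes q | lt-yes r | lt-no p′ | lt-no q′ | lt-no r′ = refl
    ... | tri< p _ p′ | tri< q _ q′ | tri> r _ r′ rewrite lt-yes p | lt-yes q | lt-no r | lt-no p′ | lt-no q′ | lt-yes r′ = refl
    ... | tri< p _ p′ | tri> q _ q′ | tri< r _ r′ = contradiction (<-trans p r) q
    ... | tri< p _ p′ | tri> q _ q′ | tri> r _ r′ rewrite lt-yes p | lt-no q | lt-no r | lt-no p′ | lt-yes q′ | lt-yes r′ = refl
    ... | tri> p _ p′ | tri< q _ q′ | tri< r _ r′ rewrite lt-no p | lt-yes q | lt-yes r | lt-yes p′ | lt-no q′ | lt-no r′ = refl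
    ... | tri> p _ p′ | tri< q _ q′ | tri> r _ r′ = contradiction (<-trans r′ p′) (<-asym q)
    ... | tri> p _ p′ | tri> q _ q′ | tri< r _ r′ rewrite lt-no p | lt-no q | lt-yes r | lt-yes p′ | lt-yes q′ | lt-no r′ = refl
    ... | tri> p _ p′ | tri> q _ q′ | tri> r _ r′ rewrite lt-no p | lt-no q | lt-no r | lt-yes p′ | lt-yes q′ | lt-yes r′ = refl

    sorted-≠ : ∀ a → sorted a a a ≡ false
    sorted-≠ a = cong (_∧ lt a a) (lt-no {a} {a} (λ p → ℕₚ.<-irrefl refl p))

    order-≠ : ∀ a b → orders a b (a ∘′ b) ≡ ≠ a b
    order-≠ a b with a ≟ b
    ... | no a≢b   = trans (one-order a b (a ∘′ b) a≢b (third-≢ a≢b) (third-≢′ a≢b)) refl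
    ... | yes refl rewrite idem s a | sorted-≠ a = refl

    all-orders : (V → V → V → ℤ) → V → V → V → ℤ
    all-orders g a b c = g a b c + (g a c b + (g b a c + (g b c a + (g c a b + g c b a))))

    ∑∑-all-orders : ∀ g → ∑∑ (all-orders g) ≡ ∑∑ g * + 6
    ∑∑-all-orders g = trans (∑∑-+ g r₂) (trans (cong (λ z → S + z) (trans (∑∑-+ k₂ r₃) (cong₂ _+_ (∑∑-swap₂ g)
        (trans (∑∑-+ k₃ r₄) (cong₂ _+_ (∑∑-swap₁ g) (trans (∑∑-+ k₄ r₅) (cong₂ _+_ g₄ (trans (∑∑-+ k₅ k₆) (cong₂ _+_ g₅ g₆)))))))))
      (sixfold S))
      where
      k₂ k₃ k₄ k₅ k₆ r₂ r₃ r₄ r₅ : V → V → V → ℤ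
      k₂ a b c = g a c b
      k₃ a b c = g b a c
      k₄ a b c = g b c a
      k₅ a b c = g c a b
      k₆ a b c = g c b a
      r₅ a b c = k₅ a b c + k₆ a b c
      r₄ a b c = k₄ a b c + r₅ a b c
      r₃ a b c = k₃ a b c + r₄ a b c
      r₂ a b c = k₂ a b c + r₃ a b c
      S : ℤ
      S = ∑∑ g
      g₄ : ∑∑ k₄ ≡ S
      g₄ = trans (∑∑-swap₁ k₂) (∑∑-swap₂ g)
      g₅ : ∑∑ k₅ ≡ S
      g₅ = trans (∑∑-swap₂ k₃) (∑∑-swap₁ g)
      g₆ : ∑∑ k₆ ≡ S
      g₆ = trans (∑∑-swap₁ k₅) g₅
      sixfold : ∀ x → x + (x + (x + (x + (x + x)))) ≡ x * + 6
      sixfold = solve-∀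

    Symmetric : (V → V → V → ℤ) → Set
    Symmetric f = (∀ a b c → f a b c ≡ f b a c) × (∀ a b c → f a b c ≡ f a c b)

    -- Off the diagonal exactly one order of each triple is sorted. Spreading this indicator over
    -- the six orders, all with the same sum, converts ordered pairs into sorted triples.
    six : ∀ f → Symmetric f → ∑∑ (λ a b c → ≠ a b * f a b c) ≡ ∑∑ (λ a b c → 𝟙 (sorted a b c) * f a b c) * + 6
    six f (f₁ , f₂) = trans (∑∑-cong (λ a b c → ≠ a b * f a b c) (all-orders g)
        λ a b → trans (cong (_* f a b (a ∘′ b)) (sym (order-≠ a b))) (spread a b (a ∘′ b)))
      (∑∑-all-orders g)
      where
      g : V → V → V → ℤ
      g a b c = 𝟙 (sorted a b c) * f a b c
      distribute : ∀ o₁ o₂ o₃ o₄ o₅ o₆ x → (o₁ + (o₂ + (o₃ + (o₄ + (o₅ + o₆))))) * x ≡ o₁ * x + (o₂ * x + (o₃ * x + (o₄ * x + (o₅ * x + o₆ * x))))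
      distribute = solve-∀
      spread : ∀ a b c → orders a b c * f a b c ≡ all-orders g a b c
      spread a b c = trans (distribute (𝟙 (sorted a b c)) (𝟙 (sorted a c b)) (𝟙 (sorted b a c)) (𝟙 (sorted b c a)) (𝟙 (sorted c a b)) (𝟙 (sorted c b a)) (f a b c))
        (+ˡ (g a b c) (cong₂ _+_ (cong (𝟙 (sorted a c b) *_) (f₂ a b c)) (cong₂ _+_ (cong (𝟙 (sorted b a c) *_) (f₁ a b c))
          (cong₂ _+_ (cong (𝟙 (sorted b c a) *_) (trans (f₁ a b c) (f₂ b a c))) (cong₂ _+_ (cong (𝟙 (sorted c a b) *_) (trans (f₂ a b c) (f₁ a c b)))
            (cong (𝟙 (sorted c b a) *_) (trans (trans (f₁ a b c) (f₂ b a c)) (f₁ b c a))))))))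

    -- A triple is listed only at its two smallest points, hence once.
    entry : V × V → List (Triple n)
    entry (a , b) = entryIf (sorted a b (a ∘′ b))
      where
      entryIf : Bool → List (Triple n)
      entryIf true  = triple a b (a ∘′ b) ∷ []
      entryIf false = []

    pairs : List (V × V)
    pairs = Enum.list (enum× (enumFin n) (enumFin n))

    triples : List (Triple n)
    triples = concatMap entry pairs

    ∑-triples′ : (f : Triple n → ℤ) → ∑ triples f ≡ ∑∑ λ a b c → 𝟙 (sorted a b c) * f (triple a b c)
    ∑-triples′ f = trans (∑-concatMap pairs entry f) (trans (∑-cong pairs each) (∑× (enumFin n) (enumFin n) λ (a , b) → 𝟙 (sorted a b (a ∘′ b)) * f (triple a b (a ∘′ b))))
      where
      each : ∀ ab → ∑ (entry ab) f ≡ 𝟙 (sorted (proj₁ ab) (proj₂ ab) (proj₁ ab ∘′ proj₂ ab)) * f (triple (proj₁ ab) (proj₂ ab) (proj₁ ab ∘′ proj₂ ab))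
      each (a , b) with sorted a b (a ∘′ b)
      ... | true  = trans (ℤₚ.+-identityʳ (f (triple a b (a ∘′ b)))) (sym (ℤₚ.*-identityˡ (f (triple a b (a ∘′ b)))))
      ... | false = sym (ℤₚ.*-zeroˡ (f (triple a b (a ∘′ b))))

    ∑-triples-six : (f : Triple n → ℤ) → Symmetric (λ a b c → f (triple a b c)) → ∑∑ (λ a b c → ≠ a b * f (triple a b c)) ≡ ∑ triples f * + 6
    ∑-triples-six f fs = trans (six (λ a b c → f (triple a b c)) fs) (cong (_* + 6) (sym (∑-triples′ f)))

    triples-distinct : All distinct3 triples
    triples-distinct = all-concat pairs λ (a , b) → each a b
      where
      all-concat : ∀ ps → (∀ p → All distinct3 (entry p)) → All distinct3 (concatMap entry ps)
      all-concat []       h = []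
      all-concat (p ∷ ps) h = ++⁺ (h p) (all-concat ps h)
      lt-sound : ∀ {a b : V} → lt a b ≡ true → a < b
      lt-sound {a} {b} = fromDoes (a <? b)
      each : ∀ a b → All distinct3 (entry (a , b))
      each a b with lt a b in p | lt b (a ∘′ b) in q
      ... | true  | true  = ((λ e → <-irrefl e (lt-sound p)) , (λ e → <-irrefl e (<-trans (lt-sound p) (lt-sound q))) , (λ e → <-irrefl e (lt-sound q))) ∷ []
      ... | true  | false = []
      ... | false | true  = []
      ... | false | false = []

    exclusive : ∀ i a b c → a ≢ b → a ≢ c → b ≢ c → 𝟙 (inTriple i (triple a b c)) ≡ δ i a + (δ i b + δ i c)
    exclusive i a b c a≢b a≢c b≢c with i ≟ a | i ≟ b | i ≟ c
    ... | yes p | yes q | _     = contradiction (trans (sym p) q) a≢b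
    ... | yes p | no _  | yes r = contradiction (trans (sym p) r) a≢c
    ... | _     | yes q | yes r = contradiction (trans (sym q) r) b≢c
    ... | yes _ | no _  | no _  = refl
    ... | no _  | yes _ | no _  = refl
    ... | no _  | no _  | yes _ = refl
    ... | no _  | no _  | no _  = refl

    δδ : ∀ {i j} → i ≢ j → ∀ a → δ i a * δ j a ≡ + 0
    δδ {i} {j} i≢j a with i ≟ a | j ≟ a
    ... | yes p | yes q = contradiction (trans p (sym q)) i≢j
    ... | yes _ | no _  = refl
    ... | no _  | yes _ = refl
    ... | no _  | no _  = refl

    module _ {i j : V} (i≢j : i ≢ j) where
      private
        cover : Triple n → ℤ
        cover t = 𝟙 (coversPair i j t)

        h : V → V → V → ℤ
        h a b c = δ i a * δ j b

      -- Both i and j lie in the triple exactly when one of its orders begins with i, j, and that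
      -- order is unique; products that put both at one place vanish as i ≠ j.
      cover-all-orders : ∀ a b → ≠ a b * cover (triple a b (a ∘′ b)) ≡ all-orders h a b (a ∘′ b)
      cover-all-orders a b = go (a ≟ b)
        where
        go : Dec (a ≡ b) → ≠ a b * cover (triple a b (a ∘′ b)) ≡ all-orders h a b (a ∘′ b)
        go (yes refl) rewrite idem s a | dec-true (a ≟ a) refl | δδ i≢j a = ℤₚ.*-zeroˡ (cover (triple a a a))
        go (no a≢b) = trans (cong₂ _*_ (cong (λ d → + 1 - 𝟙 d) (dec-false (a ≟ b) a≢b))
            (trans (𝟙-∧ (inTriple i (triple a b ab)) (inTriple j (triple a b ab)))
              (cong₂ _*_ (exclusive i a b ab a≢b (third-≢ a≢b) (third-≢′ a≢b)) (exclusive j a b ab a≢b (third-≢ a≢b) (third-≢′ a≢b)))))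
          (trans (ℤₚ.*-identityˡ ((δ i a + (δ i b + δ i ab)) * (δ j a + (δ j b + δ j ab))))
          (trans (expand (δ i a) (δ i b) (δ i ab) (δ j a) (δ j b) (δ j ab))
          (trans (cong (λ z → R + z) (cong₂ _+_ (δδ i≢j a) (cong₂ _+_ (δδ i≢j b) (δδ i≢j ab)))) (ℤₚ.+-identityʳ R))))
          where
          ab : V
          ab = a ∘′ b
          R : ℤ
          R = all-orders h a b ab
          expand : ∀ a b c a′ b′ c′ → (a + (b + c)) * (a′ + (b′ + c′))
            ≡ (a * b′ + (a * c′ + (b * a′ + (b * c′ + (c * a′ + c * b′))))) + (a * a′ + (b * b′ + c * c′))
          expand = solve-∀

      ∑∑-h : ∑∑ h ≡ + 1
      ∑∑-h = trans (∑-cong (fins n) λ a → trans (∑-*ˡ (fins n) (δ i a) (δ j)) (trans (cong (δ i a *_) (total j)) (ℤₚ.*-identityʳ (δ i a)))) (total i)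
        where
        total : ∀ i → ∑ (fins n) (δ i) ≡ + 1
        total i = trans (∑-cong (fins n) λ a → cong 𝟙 (≟-does-comm i a)) (Enum.once (enumFin n) i)

      -- Only the ordered pair (i , j) begins with i, j. Both sides are counted over six orders, and
      -- the factor 6 cancels.
      covered-once : ∑ triples cover ≡ + 1
      covered-once = ℤₚ.*-cancelʳ-≡ (∑ triples cover) (+ 1) (+ 6) (trans (sym (∑-triples-six cover cover-symmetric))
        (trans (∑∑-cong (λ a b c → ≠ a b * cover (triple a b c)) (all-orders h) cover-all-orders) (trans (∑∑-all-orders h) (cong (_* + 6) ∑∑-h))))
        where
        or-swap₁ : ∀ x y z → x ∨ (y ∨ z) ≡ y ∨ (x ∨ z)
        or-swap₁ true  true  z = refl
        or-swap₁ true  false z = refl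
        or-swap₁ false y     z = refl
        in₁ : ∀ k a b c → inTriple k (triple a b c) ≡ inTriple k (triple b a c)
        in₁ k a b c = or-swap₁ (k == a) (k == b) (k == c)
        in₂ : ∀ k a b c → inTriple k (triple a b c) ≡ inTriple k (triple a c b)
        in₂ k a b c = cong ((k == a) ∨_) (∨-comm (k == b) (k == c))
        cover-symmetric : Symmetric (λ a b c → cover (triple a b c))
        cover-symmetric = (λ a b c → cong₂ (λ x y → 𝟙 (x ∧ y)) (in₁ i a b c) (in₁ j a b c)) , (λ a b c → cong₂ (λ x y → 𝟙 (x ∧ y)) (in₂ i a b c) (in₂ j a b c))

    count-∑ : ∀ {A : Set} (p : A → Bool) xs → + count p xs ≡ ∑ xs (λ x → 𝟙 (p x))
    count-∑ p [] = refl
    count-∑ p (x ∷ xs) with p x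
    ... | true  = cong (λ z → + 1 + z) (count-∑ p xs)
    ... | false = trans (count-∑ p xs) (sym (ℤₚ.+-identityˡ (∑ xs (λ x → 𝟙 (p x)))))

    triples-decomposition : IsTriangleDecomposition triples
    triples-decomposition = triples-distinct , λ i j i≢j → ℤₚ.+-injective (trans (count-∑ (coversPair i j) triples) (covered-once i≢j))

-- Enumeration of points, directions and slopes

module Points where

  open Sums
  open Permutations
  open SevenPoints
  open Certificate
  open Residues
  open Quasigroups
  open Lines
  open Layers
  open TransversalDesign
  open import Data.Bool using (Bool; true; false)
  open import Data.Fin using (Fin; zero; suc; splitAt; _↑ˡ_; join)
  open import Data.Fin.Properties as Finₚ using (splitAt-↑ˡ; splitAt⁻¹-↑ˡ; join-splitAt; splitAt-join; +↔⊎; *↔×; 2↔Bool; 0↔⊥)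
  open import Data.Integer using (ℤ; +_; _+_; _*_)
  import Data.Integer.Properties as ℤₚ
  open import Data.List using (List; []; _∷_)
  import Data.List as List
  open import Data.Maybe using (Maybe; just; nothing)
  open import Data.Nat as ℕ using (ℕ; zero; suc)
  open import Data.Product using (_×_; _,_)
  open import Data.Product.Function.NonDependent.Propositional using (_×-↔_)
  open import Data.Sum using (_⊎_; inj₁; inj₂; [_,_]′)
  open import Data.Sum.Function.Propositional using (_⊎-↔_)
  open import Data.Vec using (Vec; []; _∷_)
  open import Function using (_∘_; _↔_; Inverse; mk↔ₛ′)
  open import Function.Construct.Symmetry using (↔-sym)
  open import Function.Construct.Identity using (↔-id)
  open import Relation.Binary using (DecidableEquality)
  open import Relation.Nullary using (does)
  open import Relation.Nullary.Decidable using (map′)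
  open import Relation.Binary.PropositionalEquality hiding ([_])

  private variable
    A B : Set

  infixr 5 _⨾_
  _⨾_ : ∀ {A B C : Set} → A ↔ B → B ↔ C → A ↔ C
  f ⨾ g = mk↔ₛ′ (Inverse.to g ∘ Inverse.to f) (Inverse.from f ∘ Inverse.from g)
    (λ z → trans (cong (Inverse.to g) (Inverse.strictlyInverseˡ f (Inverse.from g z))) (Inverse.strictlyInverseˡ g z))
    (λ x → trans (cong (Inverse.from f) (Inverse.strictlyInverseʳ g (Inverse.to f x))) (Inverse.strictlyInverseʳ f x))

  enum-↔ : ∀ {n} → A ↔ Fin n → Enum A
  enum-↔ {A} {n} iso = record { list = List.map from′ (fins n) ; _≟_ = _≟′_ ; once = λ a → trans (∑-map (fins n) from′ _)
      (trans (∑-cong (fins n) λ x → cong 𝟙 (same x a)) (Enum.once (enumFin n) (to′ a))) }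
    where
    to′ = Inverse.to iso
    from′ = Inverse.from iso
    _≟′_ : DecidableEquality A
    a ≟′ b = map′ (λ e → trans (sym (Inverse.strictlyInverseʳ iso a)) (trans (cong from′ e) (Inverse.strictlyInverseʳ iso b))) (cong to′) (to′ a Finₚ.≟ to′ b)
    same : ∀ x a → does (from′ x ≟′ a) ≡ does (x Finₚ.≟ to′ a)
    same x a = cong (λ y → does (y Finₚ.≟ to′ a)) (Inverse.strictlyInverseˡ iso x)

  ∑-enum-↔ : ∀ {n} (iso : A ↔ Fin n) c → ∑ (Enum.list (enum-↔ iso)) (λ _ → c) ≡ + n * c
  ∑-enum-↔ {n = n} iso c = trans (∑-map (fins n) (Inverse.from iso) (λ _ → c)) (trans (∑-const (fins n) c) (cong (λ k → + k * c) (length-fins n)))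

  vec↔ : ∀ {q} (iso : A ↔ Fin q) j → Vec A j ↔ Fin (q ℕ.^ j)
  vec↔ iso zero    = mk↔ₛ′ (λ _ → zero) (λ _ → []) (λ { zero → refl }) (λ { [] → refl })
  vec↔ {A} {q} iso (suc j) = uncons ⨾ (iso ×-↔ vec↔ iso j) ⨾ ↔-sym (*↔× {q} {q ℕ.^ j})
    where
    uncons : Vec A (suc j) ↔ (A × Vec A j)
    uncons = mk↔ₛ′ (λ { (x ∷ v) → x , v }) (λ (x , v) → x ∷ v) (λ _ → refl) (λ { (_ ∷ _) → refl })

  -- This is (7^j - 1)/6, hence 400 for j = 4, as a sum that follows the decomposition of `Dir`.
  dirs : ℕ → ℕ
  dirs zero    = 0
  dirs (suc j) = 7 ℕ.^ j ℕ.+ dirs j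

  dir↔ : ∀ j → Dir j ↔ Fin (dirs j)
  dir↔ zero    = ↔-sym 0↔⊥
  dir↔ (suc j) = (vec↔ (↔-id F) j ⊎-↔ dir↔ j) ⨾ ↔-sym (+↔⊎ {7 ℕ.^ j} {dirs j})

  label↔ : Λ ↔ Fin 6
  label↔ = (↔-id (Fin 3) ×-↔ ↔-sym 2↔Bool) ⨾ ↔-sym (*↔× {3} {2})

  point↔ : ∀ {D E d e m t} → D ↔ Fin d → E ↔ Fin e → Pt D E m t ↔ Fin (d ℕ.* 6 ℕ.* m ℕ.+ (6 ℕ.* t ℕ.+ e))
  point↔ {D} {E} {d} {e} {m} {t} isoD isoE = split ⨾ (regular ⊎-↔ rest) ⨾ ↔-sym (+↔⊎ {d ℕ.* 6 ℕ.* m})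
    where
    regular : ((D × Λ) × Fin m) ↔ Fin (d ℕ.* 6 ℕ.* m)
    regular = (((isoD ×-↔ label↔) ⨾ ↔-sym (*↔× {d} {6})) ×-↔ ↔-id (Fin m)) ⨾ ↔-sym (*↔× {d ℕ.* 6} {m})
    rest : ((Λ × Fin t) ⊎ E) ↔ Fin (6 ℕ.* t ℕ.+ e)
    rest = (((label↔ ×-↔ ↔-id (Fin t)) ⨾ ↔-sym (*↔× {6} {t})) ⊎-↔ isoE) ⨾ ↔-sym (+↔⊎ {6 ℕ.* t})
    split : Pt D E m t ↔ (((D × Λ) × Fin m) ⊎ ((Λ × Fin t) ⊎ E))
    split = mk↔ₛ′ f g fg gf
      where
      f : Pt D E m t → ((D × Λ) × Fin m) ⊎ ((Λ × Fin t) ⊎ E)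
      f (reg g l x) = inj₁ ((g , l) , x)
      f (inf l a)   = inj₂ (inj₁ (l , a))
      f (ext e)     = inj₂ (inj₂ e)
      g : ((D × Λ) × Fin m) ⊎ ((Λ × Fin t) ⊎ E) → Pt D E m t
      g (inj₁ ((d , l) , x))   = reg d l x
      g (inj₂ (inj₁ (l , a))) = inf l a
      g (inj₂ (inj₂ e))       = ext e
      fg : ∀ x → f (g x) ≡ x
      fg (inj₁ _)        = refl
      fg (inj₂ (inj₁ _)) = refl
      fg (inj₂ (inj₂ _)) = refl
      gf : ∀ x → g (f x) ≡ x
      gf (reg _ _ _) = refl
      gf (inf _ _)   = refl
      gf (ext _)     = refl

  isNothing : Maybe A → Bool
  isNothing nothing  = true
  isNothing (just _) = false

  isNothing-sound : ∀ {x : Maybe A} → isNothing x ≡ true → x ≡ nothing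
  isNothing-sound {x = nothing} _ = refl

  small : ∀ {t r} → Fin (t ℕ.+ r) → Maybe (Fin t)
  small {t} a = [ just , (λ _ → nothing) ]′ (splitAt t a)

  small-big : ∀ {t r} (a : Fin t) → small {t} {r} (a ↑ˡ r) ≡ just a
  small-big {t} {r} a = cong [ just , (λ _ → nothing) ]′ (splitAt-↑ˡ t a r)

  big-small : ∀ {t r} {a : Fin (t ℕ.+ r)} {a′} → small a ≡ just a′ → a ≡ a′ ↑ˡ r
  big-small {t} {r} {a} e with splitAt t a in eq
  big-small {t} {r} {a} refl | inj₁ a′ = sym (splitAt⁻¹-↑ˡ {t} {r} {a} eq)

  ∑-large : ∀ t r → ∑ (fins (t ℕ.+ r)) (λ a → 𝟙 (isNothing (small {t} {r} a))) ≡ + r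
  ∑-large t r = trans (∑-bij (enumFin (t ℕ.+ r)) (enum⊎ (enumFin t) (enumFin r)) (splitAt t) (join t r) (join-splitAt t r) (splitAt-join t r)
      (λ c → 𝟙 (isNothing ([ just , (λ _ → nothing) ]′ c))))
    (trans (∑⊎ (enumFin t) (enumFin r) _) (trans (cong₂ _+_ (∑-zero (fins t)) (trans (∑-const (fins r) (+ 1)) (trans (ℤₚ.*-identityʳ _) (cong +_ (length-fins r)))))
      (ℤₚ.+-identityˡ (+ r))))

  enumVec : ∀ j → Enum (Vec F j)
  enumVec j = enum-↔ (vec↔ (↔-id F) j)

  enumVec-suc : ∀ j (f : Vec F (suc j) → ℤ) → ∑ (Enum.list (enumVec (suc j))) f ≡ ∑ (fins 7) λ x → ∑ (Enum.list (enumVec j)) λ v → f (x ∷ v)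
  enumVec-suc j f = trans (sym (∑-bij (enum× (enumFin 7) (enumVec j)) (enumVec (suc j)) (λ (x , v) → x ∷ v) (λ { (x ∷ v) → x , v }) (λ _ → refl) (λ { (_ ∷ _) → refl }) f))
    (∑× (enumFin 7) (enumVec j) λ (x , v) → f (x ∷ v))

  -- The condition fixes one of the j + 1 coordinates.
  ∑-lead : ∀ j (g : Dir (suc j)) → ∑ (Enum.list (enumVec (suc j))) (λ u → 𝟙 (does (lead g u Finₚ.≟ 0ᵣ))) ≡ + (7 ℕ.^ j)
  ∑-lead j (inj₁ r) = trans (enumVec-suc j _) (trans (∑-cong (fins 7) λ x → trans (∑-enum-↔ (vec↔ (↔-id F) j) (𝟙 (does (x Finₚ.≟ 0ᵣ)))) refl)
    (trans (∑-*ˡ (fins 7) (+ (7 ℕ.^ j)) (λ x → 𝟙 (does (x Finₚ.≟ 0ᵣ)))) (trans (cong (λ z → + (7 ℕ.^ j) * z) (Enum.once (enumFin 7) 0ᵣ)) (ℤₚ.*-identityʳ _))))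
  ∑-lead (suc j) (inj₂ g) = trans (enumVec-suc (suc j) _) (trans (∑-cong (fins 7) λ _ → ∑-lead j g)
    (trans (∑-const (fins 7) (+ (7 ℕ.^ j))) (sym (ℤₚ.pos-* 7 (7 ℕ.^ j)))))

-- Counting cyclic pairs in the design

module FewCyclic where

  open Sums
  open Permutations
  open Kernel using (cyc)
  open Tournaments
  open SevenPoints
  open Certificate
  open Averaging
  open SteinerSystems using (Steiner; _∙_; transport; fromDoes)
  open Residues
  open Quasigroups
  open Lines
  open TailedSystems
  open Layers
  open TransversalDesign
  open Points
  open import Data.Bool using (Bool; true; false; _∧_; not)
  open import Data.Fin using (Fin; zero; suc; toℕ; _↑ˡ_)
  import Data.Fin.Properties as Finₚ
  open import Data.Integer using (ℤ; +_; _+_; _*_; -_; _-_; _≤_; +≤+)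
  import Data.Integer.Properties as ℤₚ
  open import Data.Integer.Tactic.RingSolver using (solve-∀)
  open import Data.List using (List)
  open import Data.Maybe using (Maybe; just; nothing)
  open import Data.Nat as ℕ using (ℕ; zero; suc)
  open import Data.Product using (_×_; _,_; proj₁; proj₂; ∃)
  open import Data.Vec using (Vec; tabulate)
  import Data.Vec.Properties as Vecₚ
  open import Function using (_∘_; _↔_; Inverse)
  open import Relation.Binary using (DecidableEquality)
  open import Data.Sum using (inj₁; inj₂)
  open import Relation.Nullary using (Dec; yes; no; does; contradiction)
  open import Relation.Nullary.Decidable using (dec-true; dec-false)
  open import Relation.Binary.PropositionalEquality hiding ([_])

  ∧-true : ∀ {a b} → a ∧ b ≡ true → a ≡ true × b ≡ true
  ∧-true {true} {true} _ = refl , refl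

  true-∧ : ∀ {a b} → a ≡ true → b ≡ true → a ∧ b ≡ true
  true-∧ refl refl = refl

  not-does : ∀ {P : Set} (d : Dec P) → not (does d) ≡ true → P → false ≡ true
  not-does (yes _) () _
  not-does (no ¬p) _ p = contradiction p ¬p

  fresh-tabulate : ∀ {n k} (x : Fin n) (f : Fin k → Fin n) → (∀ i → x ≢ f i) → fresh x (tabulate f) ≡ true
  fresh-tabulate {k = zero}  x f ne = refl
  fresh-tabulate {k = suc k} x f ne = true-∧ (cong not (dec-false (x Finₚ.≟ f zero) (ne zero))) (fresh-tabulate x (f ∘ suc) (ne ∘ suc))

  distinct-tabulate : ∀ {n k} (f : Fin k → Fin n) → (∀ {i j} → f i ≡ f j → i ≡ j) → distinct (tabulate f) ≡ true
  distinct-tabulate {k = zero}  f inj = refl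
  distinct-tabulate {k = suc k} f inj = true-∧ (fresh-tabulate (f zero) (f ∘ suc) λ i e → contradiction (inj e) λ ())
    (distinct-tabulate (f ∘ suc) λ e → Finₚ.suc-injective (inj e))

  module _ (m : ℕ) .{{_ : ℕ.NonZero m}} where
    open RingIdentities m

    -- Since m = 1 + P s, one has P s ≡ -1 modulo m; with P = q (a - b) this says that - q s inverts
    -- a - b.
    reciprocal : ∀ {P s} → m ≡ suc (P ℕ.* s) → ∀ a b q → + P ≡ q * (a - b) → (cls m a +ᵣ -ᵣ cls m b) *ᵣ cls m (- (q * + s)) ≡ cls m (+ 1)
    reciprocal {P} {s} m≡ a b q P≡ = trans (cong (λ z → (cls m a +ᵣ z) *ᵣ cls m (- (q * + s))) (cls-neg m b))
      (trans (cong (λ z → z *ᵣ cls m (- (q * + s))) (cls-+ m a (- b))) (trans (cls-* m (a - b) (- (q * + s)))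
        (cls-cong m (- (+ 1) , trans (regroup a b q (+ s)) (trans (cong (λ z → - (+ 1 + z * + s)) (sym P≡))
          (trans (cong (λ z → - (+ 1 + z)) (sym (ℤₚ.pos-* P s))) (trans (cong (λ z → - + z) (sym m≡)) (sym (ℤₚ.-1*i≡-i (+ m))))))))))
      where
      regroup : ∀ a b q s → (a - b) * (- (q * s)) - + 1 ≡ - (+ 1 + q * (a - b) * s)
      regroup = solve-∀

  -- The number h + h of directions is even, because the sextuple at infinity adds a group and the
  -- idempotent quasigroup of means needs an odd number of them.
  module _ {E : Set} {e j h : ℕ} (isoE : E ↔ Fin e) (tailed : Tailed E) (isoD : Dir (suc j) ↔ Fin (h ℕ.+ h)) (g₀ : Dir (suc j))
    (t r P s n : ℕ) {{t≢0 : ℕ.NonZero t}} (m≡ : t ℕ.+ r ≡ suc (P ℕ.* s))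
    (multiple : ∀ (i k : Fin (h ℕ.+ h)) → i ≢ k → ∃ λ q → + P ≡ q * (+ toℕ i - + toℕ k))
    (isoP : Pt (Dir (suc j)) E (t ℕ.+ r) t ↔ Fin n) where

    private
      D = Dir (suc j)
      m = t ℕ.+ r
      Point′ = Pt D E m t

      instance
        m≢0 : ℕ.NonZero m
        m≢0 = subst ℕ.NonZero (sym m≡) _

      index : D → Fin (h ℕ.+ h)
      index = Inverse.to isoD

      index-injective : ∀ {g k} → index g ≡ index k → g ≡ k
      index-injective {g} {k} eq = trans (sym (Inverse.strictlyInverseʳ isoD g)) (trans (cong (Inverse.from isoD) eq) (Inverse.strictlyInverseʳ isoD k))

      ED : Enum D
      ED = enum-↔ isoD

      _≟D_ : DecidableEquality D
      _≟D_ = Enum._≟_ ED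

      open RingIdentities m

      ρ : D → Fin m
      ρ g = cls m (+ toℕ (index g))

      recip : D → D → Fin m
      recip g k with index g Finₚ.≟ index k
      -- A default value; `recip-law` speaks of distinct directions.
      ... | yes _ = cls m (+ 0)
      ... | no ne = cls m (- (proj₁ (multiple (index g) (index k) ne) * + s))

      recip-law : ∀ {g k} → g ≢ k → (ρ g +ᵣ -ᵣ ρ k) *ᵣ recip g k ≡ cls m (+ 1)
      recip-law {g} {k} g≢k with index g Finₚ.≟ index k
      ... | yes eq = contradiction (index-injective eq) g≢k
      ... | no ne = reciprocal m m≡ (+ toℕ (index g)) (+ toℕ (index k)) (proj₁ (multiple (index g) (index k) ne)) (proj₂ (multiple (index g) (index k) ne))

      toLevel : Maybe D → Fin (suc (h ℕ.+ h))
      toLevel nothing  = zero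
      toLevel (just g) = suc (index g)

      fromLevel : Fin (suc (h ℕ.+ h)) → Maybe D
      fromLevel zero    = nothing
      fromLevel (suc i) = just (Inverse.from isoD i)

      from-toLevel : ∀ x → fromLevel (toLevel x) ≡ x
      from-toLevel nothing  = refl
      from-toLevel (just g) = cong just (Inverse.strictlyInverseʳ isoD g)

      to-fromLevel : ∀ i → toLevel (fromLevel i) ≡ i
      to-fromLevel zero    = refl
      to-fromLevel (suc i) = cong suc (Inverse.strictlyInverseˡ isoD i)

      smallLayer : GroupDivisible {Maybe D × Λ} proj₁
      smallLayer = Doubled.doubled (Odd.quasigroup h) (Odd.·-idem h) toLevel fromLevel from-toLevel to-fromLevel

      open Affine g₀
      open LineLayer g₀

      Block : Set
      Block = (Fin m × Fin m) × Line

      _≟V_ : DecidableEquality (Vec F (suc j))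
      _≟V_ = Enum._≟_ (enumVec (suc j))

      opaque
        isOrigin : Vec F (suc j) → Bool
        isOrigin u = does (u ≟V origin)

        isOrigin-origin : isOrigin origin ≡ true
        isOrigin-origin = dec-true (origin ≟V origin) refl

        isOrigin-no : ∀ {u} → u ≢ origin → isOrigin u ≡ false
        isOrigin-no {u} = dec-false (u ≟V origin)

        ∑-isOrigin : ∀ (f : Vec F (suc j) → ℤ) → ∑ (Enum.list (enumVec (suc j))) (λ u → 𝟙 (isOrigin u) * f u) ≡ f origin
        ∑-isOrigin f = Enum.pick (enumVec (suc j)) f origin

      validᵇ : Line → Bool
      validᵇ (g , u) = does (lead g u Finₚ.≟ 0ᵣ) ∧ not (isOrigin u)

      valid-sound : ∀ ℓ → validᵇ ℓ ≡ true → Valid ℓ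
      valid-sound (g , u) v with ∧-true {does (lead g u Finₚ.≟ 0ᵣ)} {not (isOrigin u)} v
      ... | p , q = fromDoes (lead g u Finₚ.≟ 0ᵣ) p , λ e → contradiction (trans (sym q) (cong not (trans (cong isOrigin e) isOrigin-origin))) λ ()

      valid-complete : ∀ ℓ → Valid ℓ → validᵇ ℓ ≡ true
      valid-complete (g , u) (p , q) = true-∧ (dec-true (lead g u Finₚ.≟ 0ᵣ) p) (cong not (isOrigin-no q))

      large : Fin m → Bool
      large a = isNothing (small {t} {r} a)

      -- `Block` is a full product and so easily enumerated; this indicator removes small slopes,
      -- lines through the origin and repeated descriptions of one line.
      proper : Block → Bool
      proper ((a , b) , ℓ) = large a ∧ validᵇ ℓ

      enumBlock : Enum Block
      enumBlock = enum× (enum× (enumFin m) (enumFin m)) (enum× ED (enumVec (suc j)))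

      blocks : List Block
      blocks = Enum.list enumBlock

      EP : Enum Point′
      EP = enum-↔ isoP

      φ : Point′ → Fin n
      φ = Inverse.to isoP

      ψ : Fin n → Point′
      ψ = Inverse.from isoP

      at-layer : Fin m → Fin m → Point → Point′
      at-layer a b (g , l) = reg g l (a *ᵣ ρ g +ᵣ b)

      pos : Block → F → Point′
      pos ((a , b) , ℓ) c = at-layer a b (fromVec (on ℓ c))

      at-layer-group : ∀ {a b p q} → at-layer a b p ≡ at-layer a b q → proj₁ p ≡ proj₁ q
      at-layer-group refl = refl

      pos-injective : ∀ β → proper β ≡ true → ∀ {c c′} → pos β c ≡ pos β c′ → c ≡ c′
      pos-injective ((a , b) , ℓ) pr {c} {c′} eq with c Finₚ.≟ c′
      ... | yes c≡c′ = c≡c′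
      ... | no c≢c′  = contradiction (at-layer-group {a} {b} {fromVec (on ℓ c)} {fromVec (on ℓ c′)} eq)
        (groups-distinct {ℓ} (valid-sound ℓ (proj₂ (∧-true {large a} {validᵇ ℓ} pr))) c≢c′)

      tuple : Block → Vec (Fin n) 7
      tuple β = tabulate (φ ∘ pos β)

      φ-injective : ∀ {x y} → φ x ≡ φ y → x ≡ y
      φ-injective {x} {y} eq = trans (sym (Inverse.strictlyInverseʳ isoP x)) (trans (cong ψ eq) (Inverse.strictlyInverseʳ isoP y))

      tuple-distinct : ∀ β → proper β ≡ true → distinct (tuple β) ≡ true
      tuple-distinct β pr = distinct-tabulate (φ ∘ pos β) λ eq → pos-injective β pr (φ-injective eq)

    -- `pos` and `tuple` are fixed before σ: the planes can be chosen after a relabelling without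
    -- moving any block.
    module WithChoice (σ : Block → Steiner F) where
      open Design _≟D_ m t ρ recip recip-law (small {t} {r}) (_↑ˡ r) (small-big {t} {r}) (λ {a} {a′} → big-small {t} {r} {a} {a′}) tailed smallLayer
        (λ a b → lines (λ ℓ → σ ((a , b) , ℓ))) public

      op-pos : ∀ β → proper β ≡ true → ∀ {c c′} → c ≢ c′ → op (pos β c) (pos β c′) ≡ pos β (_∙_ (σ β) c c′)
      op-pos β@((a , b) , ℓ) pr {c} {c′} c≢c′ = trans
        (op-large a b (fromVec (on ℓ c)) (fromVec (on ℓ c′)) (isNothing-sound (proj₁ (∧-true {large a} {validᵇ ℓ} pr))) (groups-distinct {ℓ} val c≢c′))
        (cong (inLarge a b) (lineOp-on (λ ℓ → σ ((a , b) , ℓ)) {ℓ} val c≢c′))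
        where
        val : Valid ℓ
        val = valid-sound ℓ (proj₂ (∧-true {large a} {validᵇ ℓ} pr))

      good : Point′ × Point′ → Bool
      good (reg g l x , reg k l′ y) = not (does (g ≟D k)) ∧ large (slope g k x y)
      good _ = false

      -- Two points in different groups determine a graph by slope and intercept; within it, their
      -- vectors determine an affine line and two coordinates.
      locate : Point′ × Point′ → Block × (F × F)
      locate (reg g l x , reg k l′ y) = ((slope g k x y , intercept (slope g k x y) g x) , proj₁ w) , proj₂ w
        where w = lineThrough (toVec (g , l)) (toVec (k , l′))
      -- A placeholder outside the good pairs.
      locate _ = ((cls m (+ 0) , cls m (+ 0)) , (g₀ , origin)) , (0ᵣ , 0ᵣ)

      proper₂ : Block × (F × F) → Bool
      proper₂ (β , (c , c′)) = proper β ∧ not (does (c Finₚ.≟ c′))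

      place : Block × (F × F) → Point′ × Point′
      place (β , (c , c′)) = pos β c , pos β c′

      locate-proper : ∀ pq → good pq ≡ true → proper₂ (locate pq) ≡ true
      locate-proper (reg g l x , reg k l′ y) gd with ∧-true {not (does (g ≟D k))} gd
      ... | ne , lg = true-∧ (true-∧ lg (valid-complete (proj₁ (lineThrough (toVec (g , l)) (toVec (k , l′)))) (through-valid (g , l) (k , l′) g≢k)))
            (cong not (dec-false (_ Finₚ.≟ _) (Through.distinct-coordinates (toVec (g , l)) (toVec (k , l′)) λ e → g≢k (cong proj₁ (toVec-injective {g , l} {k , l′} e)))))
        where
        g≢k : g ≢ k
        g≢k e = contradiction (not-does (g ≟D k) ne e) λ ()
      locate-proper (reg _ _ _ , inf _ _) ()
      locate-proper (reg _ _ _ , ext _) ()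
      locate-proper (inf _ _ , _) ()
      locate-proper (ext _ , _) ()

      place-locate : ∀ pq → good pq ≡ true → place (locate pq) ≡ pq
      place-locate (reg g l x , reg k l′ y) gd with ∧-true {not (does (g ≟D k))} gd
      ... | ne , lg = cong₂ _,_
          (trans (cong (at-layer a b) (trans (cong fromVec (Through.on-v v w v≢w)) (fromVec-toVec (g , l)))) (cong (reg g l) (value-intercept a g x)))
          (trans (cong (at-layer a b) (trans (cong fromVec (Through.on-w v w v≢w)) (fromVec-toVec (k , l′)))) (cong (reg k l′) (value-slope g≢k x y)))
        where
        a b : Fin m
        a = slope g k x y
        b = intercept a g x
        v w : Vec F (suc j)
        v = toVec (g , l)
        w = toVec (k , l′)
        g≢k : g ≢ k
        g≢k e = contradiction (not-does (g ≟D k) ne e) λ ()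
        v≢w : v ≢ w
        v≢w e = g≢k (cong proj₁ (toVec-injective {g , l} {k , l′} e))
      place-locate (reg _ _ _ , inf _ _) ()
      place-locate (reg _ _ _ , ext _) ()
      place-locate (inf _ _ , _) ()
      place-locate (ext _ , _) ()

      module _ (y : Block × (F × F)) (pr : proper₂ y ≡ true) where
        private
          a b : Fin m
          a = proj₁ (proj₁ (proj₁ y))
          b = proj₂ (proj₁ (proj₁ y))
          ℓ : Line
          ℓ = proj₂ (proj₁ y)
          c c′ : F
          c  = proj₁ (proj₂ y)
          c′ = proj₂ (proj₂ y)
          prs : (large a ∧ validᵇ ℓ ≡ true) × (not (does (c Finₚ.≟ c′)) ≡ true)
          prs = ∧-true {proper (proj₁ y)} {not (does (c Finₚ.≟ c′))} pr
          lg : large a ≡ true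
          lg = proj₁ (∧-true {large a} {validᵇ ℓ} (proj₁ prs))
          val : Valid ℓ
          val = valid-sound ℓ (proj₂ (∧-true {large a} {validᵇ ℓ} (proj₁ prs)))
          c≢c′ : c ≢ c′
          c≢c′ e = contradiction (not-does (c Finₚ.≟ c′) (proj₂ prs) e) λ ()
          g≢k : direction (on ℓ c) ≢ direction (on ℓ c′)
          g≢k = groups-distinct {ℓ} val c≢c′
          slope≡ : slope (direction (on ℓ c)) (direction (on ℓ c′)) (value a b (direction (on ℓ c))) (value a b (direction (on ℓ c′))) ≡ a
          slope≡ = slope-value g≢k a b

        place-good : good (place y) ≡ true
        place-good = true-∧ (cong not (dec-false (direction (on ℓ c) ≟D direction (on ℓ c′)) g≢k)) (trans (cong large slope≡) lg)

        locate-place : locate (place y) ≡ y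
        locate-place = cong₂ _,_ (cong₂ _,_ (cong₂ _,_ slope≡ (trans (cong (λ z → intercept z (direction (on ℓ c)) (value a b (direction (on ℓ c)))) slope≡) (intercept-value a b (direction (on ℓ c)))))
            (cong proj₁ line≡)) (cong proj₂ line≡)
          where
          line≡ : lineThrough (toVec (fromVec (on ℓ c))) (toVec (fromVec (on ℓ c′))) ≡ (ℓ , c , c′)
          line≡ = trans (cong₂ lineThrough (toVec-fromVec (on ℓ c) (on≢origin {ℓ} val c)) (toVec-fromVec (on ℓ c′) (on≢origin {ℓ} val c′)))
            (lineThrough-on {ℓ} val c≢c′)

      -- Every good pair lies in exactly one proper block, since `locate` and `place` are inverse to
      -- each other there.
      ∑-proper₂ : (f : Point′ × Point′ → ℤ) → ∑ (Enum.list (enum× EP EP)) (λ pq → 𝟙 (good pq) * f pq)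
        ≡ ∑ blocks λ β → 𝟙 (proper β) * (∑ (fins 7) λ c → ∑ (fins 7) λ c′ → 𝟙 (not (does (c Finₚ.≟ c′))) * f (pos β c , pos β c′))
      ∑-proper₂ f = trans (sym (∑-reindex enumPlaces (enum× EP EP) proper₂ good place locate place-good locate-place locate-proper place-locate f))
        (trans (∑× enumBlock (enum× (enumFin 7) (enumFin 7)) λ y → 𝟙 (proper₂ y) * f (place y)) (∑-cong blocks λ β →
          trans (∑× (enumFin 7) (enumFin 7) λ cc → 𝟙 (proper₂ (β , cc)) * f (place (β , cc))) (trans (∑-cong (fins 7) λ c → trans (∑-cong (fins 7) λ c′ → split β c c′)
              (∑-*ˡ (fins 7) (𝟙 (proper β)) (term β c)))
            (∑-*ˡ (fins 7) (𝟙 (proper β)) λ c → ∑ (fins 7) (term β c)))))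
        where
        enumPlaces : Enum (Block × (F × F))
        enumPlaces = enum× enumBlock (enum× (enumFin 7) (enumFin 7))
        term : Block → F → F → ℤ
        term β c c′ = 𝟙 (not (does (c Finₚ.≟ c′))) * f (pos β c , pos β c′)
        split : ∀ β c c′ → 𝟙 (proper β ∧ not (does (c Finₚ.≟ c′))) * f (pos β c , pos β c′) ≡ 𝟙 (proper β) * term β c c′
        split β c c′ = trans (cong (λ z → z * f (pos β c , pos β c′)) (𝟙-∧ (proper β) (not (does (c Finₚ.≟ c′)))))
          (ℤₚ.*-assoc (𝟙 (proper β)) (𝟙 (not (does (c Finₚ.≟ c′)))) (f (pos β c , pos β c′)))

      -- A block has 7·6 = 42 ordered pairs of distinct points.
      ∑-good : ∑ (Enum.list (enum× EP EP)) (λ pq → 𝟙 (good pq)) ≡ ∑ blocks (λ β → 𝟙 (proper β)) * + 42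
      ∑-good = trans (∑-cong (Enum.list (enum× EP EP)) λ pq → sym (ℤₚ.*-identityʳ (𝟙 (good pq))))
        (trans (∑-proper₂ λ _ → + 1) (∑-*ʳ blocks (+ 42) (λ β → 𝟙 (proper β))))

      module _ (_⇒_ : Point′ → Point′ → Bool) where
        cyclic : Point′ × Point′ → ℤ
        cyclic (p , q) = 𝟙 (cyc _⇒_ p q (op p q))

        on-block : Block → F → F → Bool
        on-block β c c′ = pos β c ⇒ pos β c′

        cyclic-good : ∑ (Enum.list (enum× EP EP)) (λ pq → 𝟙 (good pq) * cyclic pq) ≤ ∑ blocks λ β → 𝟙 (proper β) * steinerCost (on-block β) (σ β)
        cyclic-good = ℤₚ.≤-trans (ℤₚ.≤-reflexive (∑-proper₂ cyclic)) (∑-mono blocks λ β → by-properness β (proper β) refl)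
          where
          pairwise : ∀ β → proper β ≡ true → ∀ c c′ → 𝟙 (not (does (c Finₚ.≟ c′))) * cyclic (pos β c , pos β c′) ≤ 𝟙 (cyc (on-block β) c c′ (_∙_ (σ β) c c′))
          pairwise β pr c c′ = go (c Finₚ.≟ c′)
            where
            go : (d : Dec (c ≡ c′)) → 𝟙 (not (does d)) * cyclic (pos β c , pos β c′) ≤ 𝟙 (cyc (on-block β) c c′ (_∙_ (σ β) c c′))
            go (yes _)    = subst (_≤ 𝟙 (cyc (on-block β) c c′ (_∙_ (σ β) c c′))) (sym (ℤₚ.*-zeroˡ (cyclic (pos β c , pos β c′)))) (𝟙≥0 (cyc (on-block β) c c′ (_∙_ (σ β) c c′)))
            go (no c≢c′) = ℤₚ.≤-reflexive (trans (ℤₚ.*-identityˡ (cyclic (pos β c , pos β c′))) (cong (λ z → 𝟙 (cyc _⇒_ (pos β c) (pos β c′) z)) (op-pos β pr c≢c′)))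
          by-properness : ∀ β p → proper β ≡ p → 𝟙 p * (∑ (fins 7) λ c → ∑ (fins 7) λ c′ → 𝟙 (not (does (c Finₚ.≟ c′))) * cyclic (pos β c , pos β c′))
            ≤ 𝟙 p * steinerCost (on-block β) (σ β)
          by-properness β false _  = ℤₚ.≤-refl
          by-properness β true  pr = ℤₚ.*-monoˡ-≤-nonNeg (+ 1) (subst ((∑ (fins 7) λ c → ∑ (fins 7) λ c′ → 𝟙 (not (does (c Finₚ.≟ c′))) * cyclic (pos β c , pos β c′)) ≤_)
            (sym (steinerCost-def (on-block β) (σ β))) (∑-mono (fins 7) λ c → ∑-mono (fins 7) λ c′ → pairwise β pr c c′))

        -- All ordered pairs that are not good, the diagonal included, are charged as cyclic.
        cyclic-bound : ∑ (Enum.list EP) (λ p → ∑ (Enum.list EP) λ q → cyclic (p , q))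
          ≤ (+ n * + n - ∑ blocks (λ β → 𝟙 (proper β)) * + 42) + ∑ blocks (λ β → 𝟙 (proper β) * steinerCost (on-block β) (σ β))
        cyclic-bound = subst₂ _≤_ (∑× EP EP cyclic) refl (ℤₚ.≤-trans (∑-mono pairs λ pq → crude (good pq) (cyc _⇒_ (proj₁ pq) (proj₂ pq) (op (proj₁ pq) (proj₂ pq))))
          (subst (_≤ (+ n * + n - ∑ blocks (λ β → 𝟙 (proper β)) * + 42) + ∑ blocks (λ β → 𝟙 (proper β) * steinerCost (on-block β) (σ β)))
            (sym (trans (∑-+ pairs (λ pq → + 1 - 𝟙 (good pq)) (λ pq → 𝟙 (good pq) * cyclic pq)) (cong (λ z → z + ∑ pairs (λ pq → 𝟙 (good pq) * cyclic pq))
              (trans (∑-- pairs (λ _ → + 1) (λ pq → 𝟙 (good pq))) (cong₂ _-_ count-pairs ∑-good)))))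
            (ℤₚ.+-monoʳ-≤ (+ n * + n - ∑ blocks (λ β → 𝟙 (proper β)) * + 42) cyclic-good)))
          where
          pairs : List (Point′ × Point′)
          pairs = Enum.list (enum× EP EP)
          count-pairs : ∑ pairs (λ _ → + 1) ≡ + n * + n
          count-pairs = trans (∑× EP EP λ _ → + 1) (trans (∑-cong (Enum.list EP) λ _ → trans (∑-enum-↔ isoP (+ 1)) (ℤₚ.*-identityʳ (+ n))) (∑-enum-↔ isoP (+ n)))
          crude : ∀ g c → 𝟙 c ≤ (+ 1 - 𝟙 g) + 𝟙 g * 𝟙 c
          crude true  true  = ℤₚ.≤-refl
          crude true  false = ℤₚ.≤-refl
          crude false true  = ℤₚ.≤-refl
          crude false false = +≤+ ℕ.z≤n

    private
      lead-origin : ∀ {i} (g : Dir i) → lead g origin ≡ 0ᵣ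
      lead-origin {suc i} (inj₁ _) = refl
      lead-origin {suc i} (inj₂ g) = lead-origin g

    -- There are r large slopes, m intercepts and h + h directions, and one of the 7^j parallel
    -- lines in each direction passes through the origin.
    ∑-proper : ∑ blocks (λ β → 𝟙 (proper β)) ≡ (+ r * + m) * (+ (h ℕ.+ h) * (+ (7 ℕ.^ j) - + 1))
    ∑-proper = trans (∑× (enum× (enumFin m) (enumFin m)) lineEnum λ β → 𝟙 (proper β))
      (trans (∑-cong (Enum.list (enum× (enumFin m) (enumFin m))) λ ab → trans (∑-cong (Enum.list lineEnum) λ ℓ → 𝟙-∧ (large (proj₁ ab)) (validᵇ ℓ))
          (trans (∑-*ˡ (Enum.list lineEnum) (𝟙 (large (proj₁ ab))) (λ ℓ → 𝟙 (validᵇ ℓ))) (cong (λ z → 𝟙 (large (proj₁ ab)) * z) count-lines)))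
        (trans (∑-*ʳ (Enum.list (enum× (enumFin m) (enumFin m))) L (λ ab → 𝟙 (large (proj₁ ab))))
          (cong (λ z → z * L) (trans (∑× (enumFin m) (enumFin m) λ ab → 𝟙 (large (proj₁ ab)))
            (trans (∑-cong (fins m) λ a → trans (∑-const (fins m) (𝟙 (large a))) (trans (cong (λ z → + z * 𝟙 (large a)) (length-fins m)) (ℤₚ.*-comm (+ m) (𝟙 (large a)))))
              (trans (∑-*ʳ (fins m) (+ m) (λ a → 𝟙 (large a))) (cong (λ z → z * + m) (∑-large t r))))))))
      where
      lineEnum : Enum Line
      lineEnum = enum× ED (enumVec (suc j))
      L : ℤ
      L = + (h ℕ.+ h) * (+ (7 ℕ.^ j) - + 1)
      vectors : List (Vec F (suc j))
      vectors = Enum.list (enumVec (suc j))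
      led : D → Vec F (suc j) → ℤ
      led g u = 𝟙 (does (lead g u Finₚ.≟ 0ᵣ))
      expand : ∀ x y → x * (+ 1 - y) ≡ x - y * x
      expand = solve-∀
      per-direction : ∀ g → ∑ vectors (λ u → 𝟙 (validᵇ (g , u))) ≡ + (7 ℕ.^ j) - + 1
      per-direction g = trans (∑-cong vectors λ u → trans (𝟙-∧ (does (lead g u Finₚ.≟ 0ᵣ)) (not (isOrigin u)))
          (trans (cong (λ z → led g u * z) (𝟙-not (isOrigin u))) (expand (led g u) (𝟙 (isOrigin u)))))
        (trans (∑-- vectors (led g) (λ u → 𝟙 (isOrigin u) * led g u)) (cong₂ _-_ (∑-lead j g)
          (trans (∑-isOrigin (led g)) (cong 𝟙 (dec-true (lead g origin Finₚ.≟ 0ᵣ) (lead-origin g))))))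
      count-lines : ∑ (Enum.list lineEnum) (λ ℓ → 𝟙 (validᵇ ℓ)) ≡ L
      count-lines = trans (∑× ED (enumVec (suc j)) λ ℓ → 𝟙 (validᵇ ℓ)) (trans (∑-cong (Enum.list ED) per-direction) (∑-enum-↔ isoD (+ (7 ℕ.^ j) - + 1)))

    module _ (r′ : ℕ) (n≡ : n ≡ 7 ℕ.+ r′) (large-n : + 40001 * + 21 ≤ + n) (all-good : ∀ b → IsTournament b → Good b)
      (_⇒_ : Fin n → Fin n → Bool) (tournament : IsTournament _⇒_) where

      few-cyclic : ∃ λ (s : Steiner (Fin n)) → (∑ (fins n) λ x → ∑ (fins n) λ y → 𝟙 (cyc _⇒_ x y (_∙_ s x y))) * + 21732
        ≤ (+ n * + n - ((+ r * + m) * (+ (h ℕ.+ h) * (+ (7 ℕ.^ j) - + 1))) * + 42) * + 21732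
          + ((+ r * + m) * (+ (h ℕ.+ h) * (+ (7 ℕ.^ j) - + 1))) * + 116200
      few-cyclic = build (good-relabelling n r′ n≡ large-n all-good _⇒_ tournament blocks proper tuple tuple-distinct)
        where
        W : ℤ
        W = (+ r * + m) * (+ (h ℕ.+ h) * (+ (7 ℕ.^ j) - + 1))
        build : (∃ λ π → ∃ λ (σ : Block → Steiner F) → ∑ blocks (λ β → 𝟙 (proper β) * steinerCost (at _⇒_ π (tuple β)) (σ β)) * + 21732 ≤ ∑ blocks (λ β → 𝟙 (proper β)) * + 116200) →
          ∃ λ (s : Steiner (Fin n)) → (∑ (fins n) λ x → ∑ (fins n) λ y → 𝟙 (cyc _⇒_ x y (_∙_ s x y))) * + 21732 ≤ (+ n * + n - W * + 42) * + 21732 + W * + 116200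
        build (π , σ , le) = transport Φ Ψ ΨΦ ΦΨ steiner , subst (λ z → z * + 21732 ≤ (+ n * + n - W * + 42) * + 21732 + W * + 116200) same-cost
            (ℤₚ.≤-trans (ℤₚ.*-monoʳ-≤-nonNeg (+ 21732) (cyclic-bound λ p q → Φ p ⇒ Φ q))
              (subst₂ _≤_ (sym (ℤₚ.*-distribʳ-+ (+ 21732) (+ n * + n - W′ * + 42) cost)) (cong (λ w → (+ n * + n - w * + 42) * + 21732 + w * + 116200) ∑-proper)
                (ℤₚ.+-monoʳ-≤ ((+ n * + n - W′ * + 42) * + 21732) (subst (λ z → z * + 21732 ≤ W′ * + 116200) same-blocks le))))
          where
          open WithChoice σ
          Φ : Point′ → Fin n
          Φ p = to π (φ p)
          Ψ : Fin n → Point′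
          Ψ x = ψ (from π x)
          ΨΦ : ∀ p → Ψ (Φ p) ≡ p
          ΨΦ p = trans (cong ψ (from-to π (φ p))) (Inverse.strictlyInverseʳ isoP p)
          ΦΨ : ∀ x → Φ (Ψ x) ≡ x
          ΦΨ x = trans (cong (to π) (Inverse.strictlyInverseˡ isoP (from π x))) (to-from π x)
          W′ cost : ℤ
          W′ = ∑ blocks (λ β → 𝟙 (proper β))
          cost = ∑ blocks (λ β → 𝟙 (proper β) * steinerCost (on-block (λ p q → Φ p ⇒ Φ q) β) (σ β))
          same-blocks : ∑ blocks (λ β → 𝟙 (proper β) * steinerCost (at _⇒_ π (tuple β)) (σ β)) ≡ cost
          same-blocks = ∑-cong blocks λ β → cong (λ z → 𝟙 (proper β) * z) (steinerCost-cong
            (λ c c′ → cong₂ (λ x y → to π x ⇒ to π y) (Vecₚ.lookup∘tabulate (φ ∘ pos β) c) (Vecₚ.lookup∘tabulate (φ ∘ pos β) c′)) (σ β))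
          third : Fin n → Fin n → Fin n
          third x y = Φ (op (Ψ x) (Ψ y))
          same-cost : ∑ (Enum.list EP) (λ p → ∑ (Enum.list EP) λ q → cyclic (λ p q → Φ p ⇒ Φ q) (p , q)) ≡ ∑ (fins n) λ x → ∑ (fins n) λ y → 𝟙 (cyc _⇒_ x y (third x y))
          same-cost = trans (∑-cong (Enum.list EP) λ p → trans
              (∑-cong (Enum.list EP) λ q → cong (λ z → 𝟙 (cyc _⇒_ (Φ p) (Φ q) (Φ z))) (sym (cong₂ op (ΨΦ p) (ΨΦ q))))
              (∑-bij EP (enumFin n) Φ Ψ ΨΦ ΦΨ λ y → 𝟙 (cyc _⇒_ (Φ p) y (third (Φ p) y))))
            (∑-bij EP (enumFin n) Φ Ψ ΨΦ ΦΨ λ x → ∑ (fins n) λ y → 𝟙 (cyc _⇒_ x y (third x y)))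

-- Parameters and the final estimate

module Decomposition where

  open import Defs
  open Sums
  open Permutations using (≟-does-comm)
  open Kernel using (cyc; cyc-swap; cyc-swap₁)
  open Tournaments using (IsTournament)
  open Certificate
  open Check using (allBounded)
  open SteinerSystems using (Steiner; _∙_)
  open Lines using (Dir)
  open TailedSystems
  open TransversalDesign using (Pt)
  open Points
  open FewCyclic
  open Triples
  open import Data.Bool using (true; false)
  open import Data.Fin using (Fin; zero; suc; toℕ)
  import Data.Fin.Properties as Finₚ
  open import Data.Integer using (ℤ; +_; _+_; _*_; -_; _-_; _≤_; +≤+; NonNegative; Positive)
  import Data.Integer.Properties as ℤₚ
  open import Data.Integer.Tactic.RingSolver using (solve-∀)
  import Data.Nat.Tactic.RingSolver as ℕSolver
  open import Data.List using (List; length)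
  open import Data.Nat as ℕ using (ℕ; zero; suc; _!; _/_; _%_)
  open import Data.Nat.Divisibility using (_∣_; divides; ∣-trans; m∣m*n; m≤n⇒m!∣n!)
  open import Data.Nat.DivMod using (m≡m%n+[m/n]*n; m%n<n; m*n/n≡m; /-monoˡ-≤)
  import Data.Nat.Properties as ℕₚ
  open import Data.Product using (_×_; _,_; Σ; ∃)
  open import Data.Sum using (inj₁)
  open import Data.Unit using (tt)
  open import Data.Vec using (replicate)
  open import Function using (_↔_)
  open import Function.Construct.Symmetry using (↔-sym)
  open import Function.Construct.Identity using (↔-id)
  open import Relation.Binary using (tri<; tri≈; tri>)
  open import Relation.Nullary using (does; contradiction)
  open import Relation.Binary.PropositionalEquality

  ∣-! : ∀ {d N} → d ℕ.< N → suc d ∣ N !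
  ∣-! {d} {N} d<N = ∣-trans (m∣m*n (d !)) (m≤n⇒m!∣n! d<N)

  -- Distinct indices below N differ in absolute value by a number from 1 to N - 1, and each of
  -- these divides N !.
  difference-∣-! : ∀ N (i k : Fin N) → i ≢ k → ∃ λ q → + (N !) ≡ q * (+ toℕ i - + toℕ k)
  difference-∣-! N i k i≢k with ℕₚ.<-cmp (toℕ i) (toℕ k)
  ... | tri≈ _ e _ = contradiction (Finₚ.toℕ-injective e) i≢k
  ... | tri> _ _ k<i with ∣-! {toℕ i ℕ.∸ suc (toℕ k)} {N} (ℕₚ.≤-<-trans (ℕₚ.m∸n≤m (toℕ i) (suc (toℕ k))) (Finₚ.toℕ<n i))
  ...   | divides q e = + q , trans (cong +_ e) (trans (ℤₚ.pos-* q _) (cong (λ z → + q * z) (trans (gap (+ toℕ k) (+ (toℕ i ℕ.∸ suc (toℕ k)))) (cong (λ z → + z - + toℕ k) (ℕₚ.m+[n∸m]≡n k<i)))))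
    where
    gap : ∀ k d → + 1 + d ≡ + 1 + k + d - k
    gap = solve-∀
  difference-∣-! N i k i≢k | tri< i<k _ _ with ∣-! {toℕ k ℕ.∸ suc (toℕ i)} {N} (ℕₚ.≤-<-trans (ℕₚ.m∸n≤m (toℕ k) (suc (toℕ i))) (Finₚ.toℕ<n k))
  ...   | divides q e = - + q , trans (cong +_ e) (trans (ℤₚ.pos-* q _) (trans (flip (+ q) (+ toℕ i) (+ (toℕ k ℕ.∸ suc (toℕ i))))
      (cong (λ z → - + q * (+ toℕ i - + z)) (ℕₚ.m+[n∸m]≡n i<k))))
    where
    flip : ∀ q i d → q * (+ 1 + d) ≡ - q * (i - (+ 1 + i + d))
    flip = solve-∀

  opaque
    -- Opaque, lest 400! be computed.
    period : ℕ
    period = 400 !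

    instance
      period≢0 : ℕ.NonZero period
      period≢0 = 400 ℕₚ.!≢0

    difference-∣-period : ∀ (i k : Fin 400) → i ≢ k → ∃ λ q → + period ≡ q * (+ toℕ i - + toℕ k)
    difference-∣-period = difference-∣-! 400

  -- Kept in letters so that no large product is expanded: C counts cyclic ordered pairs, W blocks,
  -- β = 42 the pairs in a block, v / u bounds the mean number of cyclic pairs per block, and γ / α
  -- = 13/98.
  cyclic-fraction : ∀ α β γ u v N W C .{{_ : Positive u}} .{{_ : NonNegative α}} → C * u ≤ (N * N - W * β) * u + W * v →
    N * N * ((α - γ) * u) + N * (γ * u) ≤ W * ((β * u - v) * α) → C * α ≤ (N * N - N) * γ
  cyclic-fraction α β γ u v N W C bound slack = ℤₚ.*-cancelʳ-≤-pos (C * α) ((N * N - N) * γ) u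
    (subst (_≤ (N * N - N) * γ * u) (swap C u α) (ℤₚ.≤-trans (ℤₚ.*-monoʳ-≤-nonNeg α bound)
      (ℤₚ.0≤i-j⇒j≤i (subst (+ 0 ≤_) (rearrange α β γ u v N W) (ℤₚ.i≤j⇒0≤j-i slack)))))
    where
    swap : ∀ c u α → c * u * α ≡ c * α * u
    swap = solve-∀
    rearrange : ∀ α β γ u v N W → W * ((β * u - v) * α) - (N * N * ((α - γ) * u) + N * (γ * u)) ≡ (N * N - N) * γ * u - ((N * N - W * β) * u + W * v) * α
    rearrange = solve-∀

  -- With n ≤ c r the left side is at most a multiple of r² plus a multiple of r. The latter is
  -- raised to r², and an inequality between constants is left.
  quadratic-bound : ∀ {n r m} c x y z → n ℕ.≤ r ℕ.* c → 1 ℕ.≤ r → r ℕ.≤ m → c ℕ.* c ℕ.* x ℕ.+ c ℕ.* y ℕ.≤ z → n ℕ.* n ℕ.* x ℕ.+ n ℕ.* y ℕ.≤ r ℕ.* m ℕ.* z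
  quadratic-bound {n} {r} {m} c x y z n≤ 1≤r r≤m c≤ = begin
    n ℕ.* n ℕ.* x ℕ.+ n ℕ.* y                                     ≤⟨ ℕₚ.+-mono-≤ (ℕₚ.*-monoˡ-≤ x (ℕₚ.*-mono-≤ n≤ n≤)) (ℕₚ.*-monoˡ-≤ y n≤) ⟩
    r ℕ.* c ℕ.* (r ℕ.* c) ℕ.* x ℕ.+ r ℕ.* c ℕ.* y                 ≡⟨ cong (λ w → r ℕ.* c ℕ.* (r ℕ.* c) ℕ.* x ℕ.+ w) (ℕₚ.*-assoc r c y) ⟩
    r ℕ.* c ℕ.* (r ℕ.* c) ℕ.* x ℕ.+ r ℕ.* (c ℕ.* y)               ≡⟨ cong (λ w → r ℕ.* c ℕ.* (r ℕ.* c) ℕ.* x ℕ.+ w ℕ.* (c ℕ.* y)) (sym (ℕₚ.*-identityʳ r)) ⟩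
    r ℕ.* c ℕ.* (r ℕ.* c) ℕ.* x ℕ.+ r ℕ.* 1 ℕ.* (c ℕ.* y)         ≤⟨ ℕₚ.+-monoʳ-≤ (r ℕ.* c ℕ.* (r ℕ.* c) ℕ.* x) (ℕₚ.*-monoˡ-≤ (c ℕ.* y) (ℕₚ.*-monoʳ-≤ r 1≤r)) ⟩
    r ℕ.* c ℕ.* (r ℕ.* c) ℕ.* x ℕ.+ r ℕ.* r ℕ.* (c ℕ.* y)         ≡⟨ collect r c x y ⟩
    r ℕ.* r ℕ.* (c ℕ.* c ℕ.* x ℕ.+ c ℕ.* y)                       ≤⟨ ℕₚ.*-mono-≤ (ℕₚ.*-monoʳ-≤ r r≤m) c≤ ⟩
    r ℕ.* m ℕ.* z                                                 ∎
    where
    open ℕₚ.≤-Reasoning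
    collect : ∀ r c x y → r ℕ.* c ℕ.* (r ℕ.* c) ℕ.* x ℕ.+ r ℕ.* r ℕ.* (c ℕ.* y) ≡ r ℕ.* r ℕ.* (c ℕ.* c ℕ.* x ℕ.+ c ℕ.* y)
    collect = ℕSolver.solve-∀

  -- n = 2400 (t + r) + 6 t + e points, with a point at infinity for t of the slopes.
  record Parameters (e n : ℕ) : Set where
    field
      t r s  : ℕ
      t≢0    : ℕ.NonZero t
      slopes : t ℕ.+ r ≡ suc (period ℕ.* s)
      points : n ≡ 400 ℕ.* 6 ℕ.* (t ℕ.+ r) ℕ.+ (6 ℕ.* t ℕ.+ e)
      -- As 3·802 = 2406 = 2400 + 6, this gives n = 2400 r + 2406 t + e ≤ 2403 r for e ≤ 3.
      many   : t ℕ.* 802 ℕ.+ 1 ℕ.≤ r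

  count-points : ∀ d c p s u e {x m} → x ≡ suc d ℕ.+ (u ℕ.+ s ℕ.* (p ℕ.* d)) → m ≡ suc (p ℕ.* s) → e ℕ.+ x ℕ.* c ≡ d ℕ.* c ℕ.* m ℕ.+ (c ℕ.* suc u ℕ.+ e)
  count-points d c p s u e refl refl = rearrange d c p s u e
    where
    rearrange : ∀ d c p s u e → e ℕ.+ (suc d ℕ.+ (u ℕ.+ s ℕ.* (p ℕ.* d))) ℕ.* c ≡ d ℕ.* c ℕ.* suc (p ℕ.* s) ℕ.+ (c ℕ.* suc u ℕ.+ e)
    rearrange = ℕSolver.solve-∀

  -- Dividing x - 401 by 400 · `period` writes x as 400 m + t with t = u + 1 and m = 1 + `period` ·
  -- s; the value 401 belongs to s = u = 0. The bound on x gives s ≥ 321200 = 400 · 803, which makes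
  -- r large against t.
  parameters : ∀ e x → 401 ℕ.+ period ℕ.* 400 ℕ.* 321200 ℕ.≤ x → Parameters e (e ℕ.+ x ℕ.* 6)
  parameters e x le = record { t = suc u ; r = r ; s = s ; t≢0 = _ ; slopes = slopes ; points = count-points 400 6 period s u e x≡ slopes ; many = ℕₚ.m+n≤o⇒m≤o∸n (suc u ℕ.* 802 ℕ.+ 1) enough }
    where
    q y s u r : ℕ
    q = period ℕ.* 400
    instance
      q≢0 : ℕ.NonZero q
      q≢0 = ℕₚ.m*n≢0 period 400
    y = x ℕ.∸ 401
    s = y / q
    u = y % q
    r = period ℕ.* s ℕ.∸ u
    x≡ : x ≡ 401 ℕ.+ (u ℕ.+ s ℕ.* q)
    x≡ = trans (sym (ℕₚ.m+[n∸m]≡n (ℕₚ.m+n≤o⇒m≤o 401 le))) (cong (λ z → 401 ℕ.+ z) (m≡m%n+[m/n]*n y q))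
    s≥ : 321200 ℕ.≤ s
    s≥ = subst (ℕ._≤ s) (trans (cong (_/ q) (ℕₚ.*-comm q 321200)) (m*n/n≡m 321200 q)) (/-monoˡ-≤ q (ℕₚ.m+n≤o⇒m≤o∸n (q ℕ.* 321200) (subst (ℕ._≤ x) (ℕₚ.+-comm 401 (q ℕ.* 321200)) le)))
    enough : suc u ℕ.* 802 ℕ.+ 1 ℕ.+ u ℕ.≤ period ℕ.* s
    enough = begin
      suc u ℕ.* 802 ℕ.+ 1 ℕ.+ u   ≡⟨ arrange′ (suc u ℕ.* 802) u ⟩
      suc u ℕ.* 802 ℕ.+ suc u     ≡⟨ arrange″ (suc u) 802 ⟩
      suc u ℕ.* 803               ≤⟨ ℕₚ.*-monoˡ-≤ 803 (m%n<n y q) ⟩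
      period ℕ.* 400 ℕ.* 803      ≡⟨ ℕₚ.*-assoc period 400 803 ⟩
      period ℕ.* 321200           ≤⟨ ℕₚ.*-monoʳ-≤ period s≥ ⟩
      period ℕ.* s                ∎
      where
      open ℕₚ.≤-Reasoning
      arrange′ : ∀ v u → v ℕ.+ 1 ℕ.+ u ≡ v ℕ.+ suc u
      arrange′ = ℕSolver.solve-∀
      arrange″ : ∀ v w → v ℕ.* w ℕ.+ v ≡ v ℕ.* suc w
      arrange″ = ℕSolver.solve-∀
    slopes : suc u ℕ.+ r ≡ suc (period ℕ.* s)
    slopes = cong suc (ℕₚ.m+[n∸m]≡n (ℕₚ.m+n≤o⇒n≤o (suc u ℕ.* 802 ℕ.+ 1) enough))

  module _ {e n} (par : Parameters e n) (e≤3 : e ℕ.≤ 3) where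
    open Parameters par

    n≤2403r : n ℕ.≤ r ℕ.* 2403
    n≤2403r = begin
      n                                                   ≡⟨ points ⟩
      400 ℕ.* 6 ℕ.* (t ℕ.+ r) ℕ.+ (6 ℕ.* t ℕ.+ e)         ≤⟨ ℕₚ.+-monoʳ-≤ (400 ℕ.* 6 ℕ.* (t ℕ.+ r)) (ℕₚ.+-monoʳ-≤ (6 ℕ.* t) e≤3) ⟩
      400 ℕ.* 6 ℕ.* (t ℕ.+ r) ℕ.+ (6 ℕ.* t ℕ.+ 3)         ≡⟨ arrange 400 6 802 3 t r refl ⟩
      r ℕ.* 2400 ℕ.+ (t ℕ.* 802 ℕ.+ 1) ℕ.* 3              ≤⟨ ℕₚ.+-monoʳ-≤ (r ℕ.* 2400) (ℕₚ.*-monoˡ-≤ 3 many) ⟩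
      r ℕ.* 2400 ℕ.+ r ℕ.* 3                              ≡⟨ sym (ℕₚ.*-distribˡ-+ r 2400 3) ⟩
      r ℕ.* 2403                                          ∎
      where
      open ℕₚ.≤-Reasoning
      expand : ∀ d c g t r → d ℕ.* c ℕ.* (t ℕ.+ r) ℕ.+ (c ℕ.* t ℕ.+ g) ≡ r ℕ.* (d ℕ.* c) ℕ.+ (t ℕ.* (d ℕ.* c ℕ.+ c) ℕ.+ g)
      expand = ℕSolver.solve-∀
      collect : ∀ f g t → t ℕ.* (f ℕ.* g) ℕ.+ g ≡ (t ℕ.* f ℕ.+ 1) ℕ.* g
      collect = ℕSolver.solve-∀
      arrange : ∀ d c f g t r → d ℕ.* c ℕ.+ c ≡ f ℕ.* g → d ℕ.* c ℕ.* (t ℕ.+ r) ℕ.+ (c ℕ.* t ℕ.+ g) ≡ r ℕ.* (d ℕ.* c) ℕ.+ (t ℕ.* f ℕ.+ 1) ℕ.* g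
      arrange d c f g t r eq = trans (expand d c g t r) (cong (λ z → r ℕ.* (d ℕ.* c) ℕ.+ z) (trans (cong (λ z → t ℕ.* z ℕ.+ g) eq) (collect f g t)))

    -- The constants are 85 · 21732, 13 · 21732, 400 · (343 - 1) and (42 · 21732 - 116200) · 98.
    -- After n ≤ 2403 r, about one part in a thousand is left over.
    slack : + n * + n * + 1847220 + + n * + 282516 ≤ (+ r * + (t ℕ.+ r)) * + 136800 * + 78061312
    slack = subst₂ _≤_ (cast n n 1847220 282516) (trans (ℤₚ.pos-* (r ℕ.* (t ℕ.+ r)) 10678787481600)
        (trans (cong (λ z → z * + 10678787481600) (ℤₚ.pos-* r (t ℕ.+ r))) (sym (ℤₚ.*-assoc (+ r * + (t ℕ.+ r)) (+ 136800) (+ 78061312)))))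
      (+≤+ (quadratic-bound {n} {r} {t ℕ.+ r} 2403 1847220 282516 10678787481600 n≤2403r
        (ℕₚ.≤-trans (ℕₚ.m≤n+m 1 (t ℕ.* 802)) many) (ℕₚ.m≤n+m r t) (ℕₚ.≤ᵇ⇒≤ (2403 ℕ.* 2403 ℕ.* 1847220 ℕ.+ 2403 ℕ.* 282516) 10678787481600 tt)))
      where
      cast : ∀ n m x y → + (n ℕ.* m ℕ.* x ℕ.+ n ℕ.* y) ≡ + n * + m * + x + + n * + y
      cast n m x y = trans (ℤₚ.pos-+ (n ℕ.* m ℕ.* x) (n ℕ.* y)) (cong₂ _+_ (trans (ℤₚ.pos-* (n ℕ.* m) x) (cong (λ z → z * + x) (ℤₚ.pos-* n m))) (ℤₚ.pos-* n y))

  tournament : ∀ {n} (G : Tournament n) → IsTournament (beats G)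
  tournament G = record { irr = irrefl G ; anti = antisym G }

  module _ {n : ℕ} (G : Tournament n) (S : Steiner (Fin n)) where
    private
      L = triples S
      numC3 : ℤ
      numC3 = ∑ L λ t → 𝟙 (isCyclic G t)

    length-triples : + n * + n - + n ≡ + length L * + 6
    length-triples = trans (trans (factor (+ n)) (sym (trans (∑-cong (fins n) λ x → trans (∑-cong (fins n) λ y → ℤₚ.*-identityʳ (≠ S x y))
          (trans (∑-- (fins n) (λ _ → + 1) (δ S x)) (cong₂ _-_ (count-fins (+ 1)) (trans (∑-cong (fins n) λ y → cong 𝟙 (≟-does-comm x y)) (Enum.once (enumFin n) x)))))
        (count-fins (+ n * + 1 - + 1)))))
      (trans (∑-triples-six S (λ _ → + 1) ((λ _ _ _ → refl) , (λ _ _ _ → refl))) (cong (λ z → z * + 6) (trans (∑-const L (+ 1)) (ℤₚ.*-identityʳ (+ length L)))))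
      where
      count-fins : ∀ z → ∑ (fins n) (λ _ → z) ≡ + n * z
      count-fins z = trans (∑-const (fins n) z) (cong (λ k → + k * z) (length-fins n))
      factor : ∀ n → n * n - n ≡ n * (n * + 1 - + 1)
      factor = solve-∀

    numC3≤ : numC3 * + 6 ≤ ∑ (fins n) λ x → ∑ (fins n) λ y → 𝟙 (cyc (beats G) x y (_∙_ S x y))
    numC3≤ = subst (_≤ (∑ (fins n) λ x → ∑ (fins n) λ y → 𝟙 (cyc (beats G) x y (_∙_ S x y))))
      (∑-triples-six S (λ t → 𝟙 (isCyclic G t)) ((λ x y z → cong 𝟙 (cyc-swap₁ (beats G) x y z)) , (λ x y z → cong 𝟙 (cyc-swap (beats G) x y z))))
      (∑-mono (fins n) λ x → ∑-mono (fins n) λ y → drop (𝟙 (cyc (beats G) x y (_∙_ S x y))) (𝟙≥0 (cyc (beats G) x y (_∙_ S x y))) (does (x Finₚ.≟ y)))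
      where
      drop : ∀ z → + 0 ≤ z → ∀ d → (+ 1 - 𝟙 d) * z ≤ z
      drop z z≥0 true  = subst (_≤ z) (sym (ℤₚ.*-zeroˡ z)) z≥0
      drop z z≥0 false = ℤₚ.≤-reflexive (ℤₚ.*-identityˡ z)

    numT3-numC3 : + numT3 G L ≡ + length L - numC3
    numT3-numC3 = trans (count-∑ S (isTransitive G) L) (trans (∑-cong L λ t → 𝟙-not (isCyclic G t)) (trans (∑-- L (λ _ → + 1) λ t → 𝟙 (isCyclic G t))
      (cong (λ z → z - numC3) (trans (∑-const L (+ 1)) (ℤₚ.*-identityʳ (+ length L))))))

    transitive-fraction : (∑ (fins n) λ x → ∑ (fins n) λ y → 𝟙 (cyc (beats G) x y (_∙_ S x y))) * + 98 ≤ (+ n * + n - + n) * + 13 → length L ℕ.* 85 ℕ.≤ numT3 G L ℕ.* 98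
    transitive-fraction le = ℤₚ.drop‿+≤+ (subst₂ _≤_ (sym (ℤₚ.pos-* (length L) 85)) (trans (cong (λ z → z * + 98) (sym numT3-numC3)) (sym (ℤₚ.pos-* (numT3 G L) 98)))
      (complement (+ 98) (+ 13) (+ length L) numC3 (ℤₚ.*-cancelʳ-≤-pos (numC3 * + 98) (+ length L * + 13) (+ 6)
        (subst₂ _≤_ (swap numC3 (+ 6) (+ 98)) (trans (cong (λ z → z * + 13) length-triples) (swap (+ length L) (+ 6) (+ 13)))
          (ℤₚ.≤-trans (ℤₚ.*-monoʳ-≤-nonNeg (+ 98) numC3≤) le)))))
      where
      swap : ∀ x y z → x * y * z ≡ x * z * y
      swap = solve-∀
      complement : ∀ α γ l c → c * α ≤ l * γ → l * (α - γ) ≤ (l - c) * α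
      complement α γ l c le = ℤₚ.0≤i-j⇒j≤i (subst (+ 0 ≤_) (rearrange α γ l c) (ℤₚ.i≤j⇒0≤j-i le))
        where
        rearrange : ∀ α γ l c → l * γ - c * α ≡ (l - c) * α - l * (α - γ)
        rearrange = solve-∀

  good : ∀ b → IsTournament b → Good b
  good = Conclusion.good allBounded

  threshold : ℕ
  threshold = (401 ℕ.+ period ℕ.* 400 ℕ.* 321200) ℕ.* 6

  module _ {E : Set} {e : ℕ} (isoE : E ↔ Fin e) (tailed : Tailed E) (e≤3 : e ℕ.≤ 3) where

    mostly-transitive : ∀ {n} → Parameters e n → + 40001 * + 21 ≤ + n → (G : Tournament n) →
      ∃ λ (L : List (Triple n)) → IsTriangleDecomposition L × length L ℕ.* 85 ℕ.≤ numT3 G L ℕ.* 98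
    mostly-transitive {n} par large-n G = conclude
        -- Dimension 3 + 1 over F₇, with 200 + 200 directions.
        (few-cyclic {E} {e} {3} {200} isoE tailed (dir↔ 4) (inj₁ (replicate _ zero)) t r period s n {{t≢0}} slopes difference-∣-period isoP
          (n ℕ.∸ 7) (sym (ℕₚ.m+[n∸m]≡n (ℕₚ.≤-trans (ℕₚ.≤ᵇ⇒≤ 7 840021 tt) (ℤₚ.drop‿+≤+ large-n)))) large-n good (beats G) (tournament G))
      where
      open Parameters par
      isoP : Pt (Dir 4) E (t ℕ.+ r) t ↔ Fin n
      isoP = subst (λ k → Pt (Dir 4) E (t ℕ.+ r) t ↔ Fin k) (sym points) (point↔ (dir↔ 4) isoE)
      W : ℤ
      W = (+ r * + (t ℕ.+ r)) * + 136800
      conclude : (∃ λ (S : Steiner (Fin n)) → (∑ (fins n) λ x → ∑ (fins n) λ y → 𝟙 (cyc (beats G) x y (_∙_ S x y))) * + 21732 ≤ (+ n * + n - W * + 42) * + 21732 + W * + 116200) →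
        ∃ λ (L : List (Triple n)) → IsTriangleDecomposition L × length L ℕ.* 85 ℕ.≤ numT3 G L ℕ.* 98
      conclude (S , le) = triples S , triples-decomposition S , transitive-fraction G S
        (cyclic-fraction (+ 98) (+ 42) (+ 13) (+ 21732) (+ 116200) (+ n) W (∑ (fins n) λ x → ∑ (fins n) λ y → 𝟙 (cyc (beats G) x y (_∙_ S x y))) le (slack par e≤3))

    -- The fraction 85/98 is attained without error, so `k` enters only in the final weakening.
    decomposition : ∀ n → threshold ℕ.≤ n → n % 6 ≡ e → (G : Tournament n) (k : ℕ) →
      Σ (List (Triple n)) λ L → IsTriangleDecomposition L × FractionT3AtLeast G L k
    decomposition n N≤n n%6≡e G k = weaken (mostly-transitive (subst (Parameters e) (sym n≡) (parameters e (n / 6) x≥)) (+≤+ n≥) G)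
      where
      X : ℕ
      X = 401 ℕ.+ period ℕ.* 400 ℕ.* 321200
      n≡ : n ≡ e ℕ.+ n / 6 ℕ.* 6
      n≡ = trans (m≡m%n+[m/n]*n n 6) (cong (λ z → z ℕ.+ n / 6 ℕ.* 6) n%6≡e)
      x≥ : X ℕ.≤ n / 6
      x≥ = subst (ℕ._≤ n / 6) (m*n/n≡m X 6) (/-monoˡ-≤ 6 N≤n)
      n≥ : 840021 ℕ.≤ n
      n≥ = begin
        -- The number 770880000 is 400 · 321200 · 6. Only `period` ≥ 1 enters, so 400 ! stays
        -- unevaluated.
        840021                           ≤⟨ ℕₚ.≤ᵇ⇒≤ 840021 770880000 tt ⟩
        770880000                        ≤⟨ ℕₚ.m≤n*m 770880000 period ⟩
        period ℕ.* 770880000             ≡⟨ sym (trans (cong (λ z → z ℕ.* 6) (ℕₚ.*-assoc period 400 321200)) (ℕₚ.*-assoc period 128480000 6)) ⟩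
        period ℕ.* 400 ℕ.* 321200 ℕ.* 6  ≤⟨ ℕₚ.*-monoˡ-≤ 6 (ℕₚ.m≤n+m (period ℕ.* 400 ℕ.* 321200) 401) ⟩
        X ℕ.* 6                          ≤⟨ N≤n ⟩
        n                                ∎
        where open ℕₚ.≤-Reasoning
      weaken : (∃ λ (L : List (Triple n)) → IsTriangleDecomposition L × length L ℕ.* 85 ℕ.≤ numT3 G L ℕ.* 98) →
        Σ (List (Triple n)) λ L → IsTriangleDecomposition L × FractionT3AtLeast G L k
      weaken (L , dec , le) = L , dec , ℕₚ.≤-trans (subst₂ ℕ._≤_ (swap (length L) 85 (suc k)) (swap (numT3 G L) 98 (suc k)) (ℕₚ.*-monoˡ-≤ (suc k) le))
          (ℕₚ.m≤m+n (98 ℕ.* suc k ℕ.* numT3 G L) (98 ℕ.* length L))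
        where
        swap : ∀ x y z → x ℕ.* y ℕ.* z ≡ y ℕ.* z ℕ.* x
        swap = ℕSolver.solve-∀

  decomposition₁ : ∀ n → threshold ℕ.≤ n → n % 6 ≡ 1 → (G : Tournament n) (k : ℕ) → Σ (List (Triple n)) λ L → IsTriangleDecomposition L × FractionT3AtLeast G L k
  decomposition₁ = decomposition (↔-sym Finₚ.1↔⊤) tailed₁ (ℕ.s≤s ℕ.z≤n)

  decomposition₃ : ∀ n → threshold ℕ.≤ n → n % 6 ≡ 3 → (G : Tournament n) (k : ℕ) → Σ (List (Triple n)) λ L → IsTriangleDecomposition L × FractionT3AtLeast G L k
  decomposition₃ = decomposition (↔-id (Fin 3)) tailed₃ ℕₚ.≤-refl

open Decomposition
open import Defs
open import Data.Nat using (ℕ; _≤_; _%_)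
open import Data.Sum using (_⊎_; inj₁; inj₂)
open import Data.Product using (Σ; ∃; _×_; _,_)
open import Data.List using (List)
open import Relation.Binary.PropositionalEquality using (_≡_)

theorem3p2 : (k : ℕ) → Σ ℕ λ N → (n : ℕ) → N ≤ n → (n % 6 ≡ 1 ⊎ n % 6 ≡ 3) →
    (G : Tournament n) → Σ (List (Triple n)) λ L →
    IsTriangleDecomposition L × FractionT3AtLeast G L k
theorem3p2 k = threshold , λ n N≤n → λ
  { (inj₁ n%6≡1) G → decomposition₁ n N≤n n%6≡1 G k
  ; (inj₂ n%6≡3) G → decomposition₃ n N≤n n%6≡3 G k }
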